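{- Let $p\neq\ell$ be primes, $d\ge1$ an integer, $\Gamma=\mathbb{Z}_p^d$ and $\Gamma_n=\Gamma/\Gamma^{p^n}$. Let $F=\sum_{i=1}^kb_iT_1^{a_{i,1}}\cdots T_d^{a_{i,d}}\in\Phi_{p,d}$ be a non-zero element, where the exponent vectors $(a_{i,1},\dots,a_{i,d})\in\mathbb{Z}_p^d$ are pairwise distinct and $b_i\in\mathbb{Z}$. Then $$\sum_{\omega\in\mathrm{Supp}_n(F)}\mathrm{ord}_\ell(\omega(F))=p^{nd}\mu_\ell(F)+O(p^{(d-1)n})$$ as $n\to\infty$, where $\mu_\ell(F)=\min(\mathrm{ord}_\ell(b_i):1\le i\le k)$.
   Context: $\Phi_{p,d}=\mathbb{Z}[T_1,\dots,T_d;\mathbb{Z}_p]$ is the ring of finite $\mathbb{Z}$-linear combinations of monomials $T_1^{a_1}\cdots T_d^{a_d}$ with $a_i\in\mathbb{Z}_p$, i.e. the group ring $\mathbb{Z}[\mathbb{Z}_p^d]$. The group $\Gamma=\mathbb{Z}_p^d$ is written multiplicatively, with standard topological generators $\gamma_1,\dots,\gamma_d$. $\Gamma_n^\vee$ is the set of characters $\Gamma_n\to\overline{\mathbb{Q}}_\ell^\times$, regarded as characters of $\Gamma$. For $\omega\in\Gamma_n^\vee$, $\omega(F)\in\overline{\mathbb{Q}}_\ell$ is obtained by the substitution $T_1^{a_1}\cdots T_d^{a_d}\mapsto\omega(\gamma_1)^{a_1}\cdots\omega(\gamma_d)^{a_d}$ ($p$-power roots of unity may be raised to powers in $\mathbb{Z}_p$).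 $\mathrm{Supp}_n(F)=\{\omega\in\Gamma_n^\vee:\omega(F)\ne0\}$. $\mathrm{ord}_\ell$ is the valuation on $\overline{\mathbb{Q}}_\ell$ with $\mathrm{ord}_\ell(\ell)=1$. The implied constant does not depend on $n$. -}

module Defs where

open import Algebra.Apartness.Bundles using (HeytingField; HeytingCommutativeRing)
open import Algebra.Bundles using (AbelianGroup; CommutativeRing)
import Algebra.Construct.Pointwise as Pointwise
import Algebra.Definitions.RawMonoid as Multiple
open import Algebra.Morphism.Bundles using (MonoidHomomorphism)
open import Algebra.Morphism.Structures using (IsRingMonomorphism)
open import Algebra.Structures using (IsCommutativeRing)
import Algebra.Properties.AbelianGroup as AbelianGroupProperties
import Algebra.Properties.CommutativeMonoid.Mult as CommutativeMultiple
import Algebra.Properties.Monoid.Mult as MultipleProperties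
import Algebra.Properties.Ring as RingProperties
import Algebra.Properties.Semiring.Exp as Powers
open import Data.Fin.Base using (Fin)
import Data.Fin.Properties as Fin
open import Data.Integer.Base as ℤ using (ℤ; +_; 0ℤ; 1ℤ; _%ℕ_)
open import Data.Integer.Divisibility.Signed
  using (_∣_; divides; ∣m∣n⇒∣m+n; ∣m⇒∣-m; ∣n⇒∣m*n; ∣m⇒∣m*n; *-cancelʳ-∣)
import Data.Integer.Properties as ℤ
open import Data.Integer.Tactic.RingSolver using (solve-∀)
open import Data.List.Base using (List; []; _∷_; foldr; map)
open import Data.List.Membership.Propositional using (_∈_)
open import Data.List.Relation.Unary.AllPairs using (AllPairs)
open import Data.List.Relation.Unary.Any using (Any)
import Data.List.Relation.Unary.Enumerates.Setoid as Enumerates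
import Data.List.Relation.Unary.Unique.Setoid as Unique
open import Data.Nat.Base as ℕ using (ℕ; zero; suc; NonZero)
import Data.Nat.Properties as ℕ
open import Data.Nat.Primality using (Prime; prime⇒nonZero)
open import Data.Product.Base using (Σ; ∃; ∃-syntax; Σ-syntax; _×_; _,_; proj₁; proj₂)
open import Data.Rational.Base as ℚ using (ℚ; 0ℚ; 1ℚ)
open import Level using (Level; 0ℓ; _⊔_) renaming (suc to lsuc)
open import Relation.Binary.Bundles using (Setoid)
import Relation.Binary.Construct.On as On
open import Relation.Binary.PropositionalEquality
  using (_≡_; refl; sym; trans; cong; subst)
open import Relation.Nullary using (¬_; yes; no)

ℕ→ℚ : ℕ → ℚ
ℕ→ℚ n = + n ℚ./ 1

_=O[_] : (ℕ → ℚ) → (ℕ → ℕ) → Set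
f =O[ g ] = Σ[ C ∈ ℚ ] Σ[ N ∈ ℕ ] (∀ n → N ℕ.≤ n → ℚ.∣ f n ∣ ℚ.≤ C ℚ.* ℕ→ℚ (g n))

-- "S is finite and the sum of f over S is s".  For f respecting _≈_, the
-- number s does not depend on the enumeration.

HasSum : {a r : Level} (S : Setoid a r) → (Setoid.Carrier S → ℚ) → ℚ → Set (a ⊔ r)
HasSum S f s = ∃[ xs ] (Unique.Unique S xs × Enumerates.IsEnumeration S xs
                        × s ≡ foldr ℚ._+_ 0ℚ (map f xs))

module PowerQuotient {a r : Level} (G : AbelianGroup a r) (m : ℕ) where
  open AbelianGroup G
  open AbelianGroupProperties G using (inverseˡ-unique)
  open Multiple rawMonoid renaming (_×_ to infixr 8 _times_)
  open MultipleProperties monoid renaming (×-congʳ to times-cong; ×-homo-0 to times-0)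
  open CommutativeMultiple commutativeMonoid renaming (×-distrib-+ to times-∙)
  open import Relation.Binary.Reasoning.Setoid setoid

  _^m : Carrier → Carrier
  z ^m = m times z

  ε^m : ε ^m ≈ ε
  ε^m = go m
    where
    go : ∀ k → k times ε ≈ ε
    go zero    = AbelianGroup.refl G
    go (suc k) = AbelianGroup.trans G (identityˡ _) (go k)

  ⁻¹^m : ∀ z → (z ⁻¹) ^m ≈ (z ^m) ⁻¹
  ⁻¹^m z = inverseˡ-unique _ _ (begin
    (z ⁻¹) ^m ∙ z ^m ≈⟨ times-∙ (z ⁻¹) z m ⟨
    (z ⁻¹ ∙ z) ^m    ≈⟨ times-cong m (inverseˡ z) ⟩
    ε ^m             ≈⟨ ε^m ⟩
    ε                ∎)

  record _≈/_ (x y : Carrier) : Set (a ⊔ r) where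
    constructor differBy
    field
      root  : Carrier
      proof : x ≈ y ∙ root ^m

  ≈⇒≈/ : ∀ {x y} → x ≈ y → x ≈/ y
  ≈⇒≈/ {x} {y} x≈y = differBy ε (begin
    x          ≈⟨ x≈y ⟩
    y          ≈⟨ identityʳ y ⟨
    y ∙ ε      ≈⟨ ∙-congˡ ε^m ⟨
    y ∙ ε ^m   ∎)

  ≈/-sym : ∀ {x y} → x ≈/ y → y ≈/ x
  ≈/-sym {x} {y} (differBy z e) = differBy (z ⁻¹) (begin
    y                         ≈⟨ identityʳ y ⟨
    y ∙ ε                     ≈⟨ ∙-congˡ (inverseʳ (z ^m)) ⟨
    y ∙ (z ^m ∙ (z ^m) ⁻¹)    ≈⟨ assoc _ _ _ ⟨
    y ∙ z ^m ∙ (z ^m) ⁻¹      ≈⟨ ∙-cong e (⁻¹^m z) ⟨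
    x ∙ (z ⁻¹) ^m             ∎)

  ≈/-trans : ∀ {x y w} → x ≈/ y → y ≈/ w → x ≈/ w
  ≈/-trans {x} {y} {w} (differBy z e) (differBy z′ e′) = differBy (z′ ∙ z) (begin
    x                      ≈⟨ e ⟩
    y ∙ z ^m               ≈⟨ ∙-congʳ e′ ⟩
    w ∙ z′ ^m ∙ z ^m       ≈⟨ assoc _ _ _ ⟩
    w ∙ (z′ ^m ∙ z ^m)     ≈⟨ ∙-congˡ (times-∙ z′ z m) ⟨
    w ∙ (z′ ∙ z) ^m        ∎)

  ∙-cong/ : ∀ {x y u v} → x ≈/ y → u ≈/ v → (x ∙ u) ≈/ (y ∙ v)
  ∙-cong/ {x} {y} {u} {v} (differBy z e) (differBy z′ e′) = differBy (z ∙ z′) (begin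
    x ∙ u                      ≈⟨ ∙-cong e e′ ⟩
    y ∙ z ^m ∙ (v ∙ z′ ^m)     ≈⟨ assoc _ _ _ ⟩
    y ∙ (z ^m ∙ (v ∙ z′ ^m))   ≈⟨ ∙-congˡ (assoc _ _ _) ⟨
    y ∙ (z ^m ∙ v ∙ z′ ^m)     ≈⟨ ∙-congˡ (∙-congʳ (comm _ _)) ⟩
    y ∙ (v ∙ z ^m ∙ z′ ^m)     ≈⟨ ∙-congˡ (assoc _ _ _) ⟩
    y ∙ (v ∙ (z ^m ∙ z′ ^m))   ≈⟨ assoc _ _ _ ⟨
    y ∙ v ∙ (z ^m ∙ z′ ^m)     ≈⟨ ∙-congˡ (times-∙ z z′ m) ⟨
    y ∙ v ∙ (z ∙ z′) ^m        ∎)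

  ⁻¹-cong/ : ∀ {x y} → x ≈/ y → (x ⁻¹) ≈/ (y ⁻¹)
  ⁻¹-cong/ {x} {y} (differBy z e) = differBy (z ⁻¹) (begin
    x ⁻¹                  ≈⟨ ⁻¹-cong e ⟩
    (y ∙ z ^m) ⁻¹         ≈⟨ AbelianGroupProperties.⁻¹-∙-comm G _ _ ⟨
    y ⁻¹ ∙ (z ^m) ⁻¹      ≈⟨ ∙-congˡ (⁻¹^m z) ⟨
    y ⁻¹ ∙ (z ⁻¹) ^m      ∎)

  quotient : AbelianGroup a (a ⊔ r)
  quotient = record
    { Carrier = Carrier
    ; _≈_     = _≈/_
    ; _∙_     = _∙_
    ; ε       = ε
    ; _⁻¹     = _⁻¹
    ; isAbelianGroup = record
      { isGroup = record
        { isMonoid = record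
          { isSemigroup = record
            { isMagma = record
              { isEquivalence = record
                { refl = ≈⇒≈/ (AbelianGroup.refl G) ; sym = ≈/-sym ; trans = ≈/-trans }
              ; ∙-cong = ∙-cong/
              }
            ; assoc = λ x y z → ≈⇒≈/ (assoc x y z)
            }
          ; identity = (λ x → ≈⇒≈/ (identityˡ x)) , (λ x → ≈⇒≈/ (identityʳ x))
          }
        ; inverse = (λ x → ≈⇒≈/ (inverseˡ x)) , (λ x → ≈⇒≈/ (inverseʳ x))
        ; ⁻¹-cong = ⁻¹-cong/
        }
      ; comm = λ x y → ≈⇒≈/ (comm x y)
      }
    }

open PowerQuotient public using () renaming (quotient to _/powers_)

NonZeroDivisor : {a r : Level} (R : CommutativeRing a r) → CommutativeRing.Carrier R → Set (a ⊔ r)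
NonZeroDivisor R π = ∀ x y → x * π ≈ y * π → x ≈ y
  where open CommutativeRing R

-- num /π^ den is the fraction num / π^den.

record Fraction {a : Level} (A : Set a) : Set a where
  constructor _/π^_
  field
    num : A
    den : ℕ

module Localization {a r : Level} (R : CommutativeRing a r)
  (π : CommutativeRing.Carrier R) (π-cancel : NonZeroDivisor R π) where

  open CommutativeRing R renaming (refl to refl′; sym to sym′)
  open Powers semiring using (_^_; ^-homo-*)
  open RingProperties (CommutativeRing.ring R) using (-‿distribˡ-*)
  open import Relation.Binary.Reasoning.Setoid setoid
  open import Algebra.Solver.Ring.NaturalCoefficients.Default commutativeSemiring
    using (solve; _:+_; _:*_; _:=_)

  open Fraction

  infix 4 _≈ᶠ_

  record _≈ᶠ_ (x y : Fraction Carrier) : Set r where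
    constructor cross
    field
      cross-eq : num x * π ^ den y ≈ num y * π ^ den x

  open _≈ᶠ_ public

  infixl 6 _+ᶠ_
  infixl 7 _*ᶠ_

  _+ᶠ_ _*ᶠ_ : Fraction Carrier → Fraction Carrier → Fraction Carrier
  (x /π^ k) +ᶠ (y /π^ m) = (x * π ^ m + y * π ^ k) /π^ (k ℕ.+ m)
  (x /π^ k) *ᶠ (y /π^ m) = (x * y) /π^ (k ℕ.+ m)

  -ᶠ_ : Fraction Carrier → Fraction Carrier
  -ᶠ (x /π^ k) = (- x) /π^ k

  embed : Carrier → Fraction Carrier
  embed x = x /π^ 0

  private
    ^-cancel : ∀ n x y → x * π ^ n ≈ y * π ^ n → x ≈ y
    ^-cancel zero    x y h = begin
      x       ≈⟨ *-identityʳ x ⟨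
      x * 1#  ≈⟨ h ⟩
      y * 1#  ≈⟨ *-identityʳ y ⟩
      y       ∎
    ^-cancel (suc n) x y h = π-cancel x y (^-cancel n (x * π) (y * π) (begin
      x * π * π ^ n    ≈⟨ *-assoc _ _ _ ⟩
      x * π ^ (suc n)  ≈⟨ h ⟩
      y * π ^ (suc n)  ≈⟨ *-assoc _ _ _ ⟨
      y * π * π ^ n    ∎))

    same-den : ∀ {x y k m} → x ≈ y → k ≡ m → (x /π^ k) ≈ᶠ (y /π^ m)
    same-den x≈y refl = cross (*-congʳ x≈y)

    exch : ∀ x b c → x * b * c ≈ x * c * b
    exch = solve 3 (λ x b c → x :* b :* c := x :* c :* b) refl′

    ≈ᶠ-trans : ∀ {x y z} → x ≈ᶠ y → y ≈ᶠ z → x ≈ᶠ z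
    ≈ᶠ-trans {x /π^ k} {y /π^ m} {z /π^ n} (cross h) (cross h′) = cross (^-cancel m _ _ (begin
      x * π ^ n * π ^ m  ≈⟨ exch _ _ _ ⟩
      x * π ^ m * π ^ n  ≈⟨ *-congʳ h ⟩
      y * π ^ k * π ^ n  ≈⟨ exch _ _ _ ⟩
      y * π ^ n * π ^ k  ≈⟨ *-congʳ h′ ⟩
      z * π ^ m * π ^ k  ≈⟨ exch _ _ _ ⟩
      z * π ^ k * π ^ m  ∎))

    +ᶠ-cong : ∀ {x x′ y y′} → x ≈ᶠ x′ → y ≈ᶠ y′ → x +ᶠ y ≈ᶠ x′ +ᶠ y′
    +ᶠ-cong {x /π^ k} {x′ /π^ k′} {y /π^ m} {y′ /π^ m′} (cross h) (cross h′) = cross (begin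
      (x * B + y * A) * π ^ (k′ ℕ.+ m′)      ≈⟨ *-congˡ (^-homo-* π k′ m′) ⟩
      (x * B + y * A) * (A′ * B′)            ≈⟨ expand x y A B A′ B′ ⟩
      x * A′ * (B * B′) + y * B′ * (A * A′)  ≈⟨ +-cong (*-congʳ h) (*-congʳ h′) ⟩
      x′ * A * (B * B′) + y′ * B * (A * A′)  ≈⟨ collect x′ y′ A B A′ B′ ⟩
      (x′ * B′ + y′ * A′) * (A * B)          ≈⟨ *-congˡ (^-homo-* π k m) ⟨
      (x′ * B′ + y′ * A′) * π ^ (k ℕ.+ m)    ∎)
      where
      A = π ^ k ; A′ = π ^ k′ ; B = π ^ m ; B′ = π ^ m′

      expand : ∀ x y A B A′ B′ →
        (x * B + y * A) * (A′ * B′) ≈ x * A′ * (B * B′) + y * B′ * (A * A′)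
      expand = solve 6 (λ x y A B A′ B′ → (x :* B :+ y :* A) :* (A′ :* B′)
                 := x :* A′ :* (B :* B′) :+ y :* B′ :* (A :* A′)) refl′

      collect : ∀ x y A B A′ B′ →
        x * A * (B * B′) + y * B * (A * A′) ≈ (x * B′ + y * A′) * (A * B)
      collect = solve 6 (λ x y A B A′ B′ → x :* A :* (B :* B′) :+ y :* B :* (A :* A′)
                  := (x :* B′ :+ y :* A′) :* (A :* B)) refl′

    *ᶠ-cong : ∀ {x x′ y y′} → x ≈ᶠ x′ → y ≈ᶠ y′ → x *ᶠ y ≈ᶠ x′ *ᶠ y′
    *ᶠ-cong {x /π^ k} {x′ /π^ k′} {y /π^ m} {y′ /π^ m′} (cross h) (cross h′) = cross (begin
      x * y * π ^ (k′ ℕ.+ m′)      ≈⟨ *-congˡ (^-homo-* π k′ m′) ⟩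
      x * y * (π ^ k′ * π ^ m′)    ≈⟨ interchange _ _ _ _ ⟩
      x * π ^ k′ * (y * π ^ m′)    ≈⟨ *-cong h h′ ⟩
      x′ * π ^ k * (y′ * π ^ m)    ≈⟨ interchange _ _ _ _ ⟨
      x′ * y′ * (π ^ k * π ^ m)    ≈⟨ *-congˡ (^-homo-* π k m) ⟨
      x′ * y′ * π ^ (k ℕ.+ m)      ∎)
      where
      interchange : ∀ x y A B → x * y * (A * B) ≈ x * A * (y * B)
      interchange = solve 4 (λ x y A B → x :* y :* (A :* B) := x :* A :* (y :* B)) refl′

    -ᶠ-cong : ∀ {x x′} → x ≈ᶠ x′ → -ᶠ x ≈ᶠ -ᶠ x′
    -ᶠ-cong {x /π^ k} {x′ /π^ k′} (cross h) = cross (begin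
      - x * π ^ k′     ≈⟨ -‿distribˡ-* _ _ ⟨
      - (x * π ^ k′)   ≈⟨ -‿cong h ⟩
      - (x′ * π ^ k)   ≈⟨ -‿distribˡ-* _ _ ⟩
      - x′ * π ^ k     ∎)

    +ᶠ-assoc : ∀ x y z → (x +ᶠ y) +ᶠ z ≈ᶠ x +ᶠ (y +ᶠ z)
    +ᶠ-assoc (x /π^ k) (y /π^ m) (z /π^ n) = same-den (begin
      (x * B + y * A) * C + z * π ^ (k ℕ.+ m)  ≈⟨ +-congˡ (*-congˡ (^-homo-* π k m)) ⟩
      (x * B + y * A) * C + z * (A * B)        ≈⟨ regroup x y z A B C ⟩
      x * (B * C) + (y * C + z * B) * A        ≈⟨ +-congʳ (*-congˡ (^-homo-* π m n)) ⟨
      x * π ^ (m ℕ.+ n) + (y * C + z * B) * A  ∎) (ℕ.+-assoc k m n)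
      where
      A = π ^ k ; B = π ^ m ; C = π ^ n

      regroup : ∀ x y z A B C →
        (x * B + y * A) * C + z * (A * B) ≈ x * (B * C) + (y * C + z * B) * A
      regroup = solve 6 (λ x y z A B C → (x :* B :+ y :* A) :* C :+ z :* (A :* B)
                  := x :* (B :* C) :+ (y :* C :+ z :* B) :* A) refl′

    +ᶠ-comm : ∀ x y → x +ᶠ y ≈ᶠ y +ᶠ x
    +ᶠ-comm (x /π^ k) (y /π^ m) = same-den (+-comm _ _) (ℕ.+-comm k m)

    +ᶠ-identityˡ : ∀ x → embed 0# +ᶠ x ≈ᶠ x
    +ᶠ-identityˡ (x /π^ k) = same-den (begin
      0# * π ^ k + x * 1#  ≈⟨ +-cong (zeroˡ _) (*-identityʳ x) ⟩
      0# + x               ≈⟨ +-identityˡ x ⟩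
      x                    ∎) refl

    +ᶠ-inverseˡ : ∀ x → (-ᶠ x) +ᶠ x ≈ᶠ embed 0#
    +ᶠ-inverseˡ (x /π^ k) = cross (begin
      (- x * π ^ k + x * π ^ k) * 1#  ≈⟨ *-identityʳ _ ⟩
      - x * π ^ k + x * π ^ k         ≈⟨ distribʳ _ _ _ ⟨
      (- x + x) * π ^ k               ≈⟨ *-congʳ (-‿inverseˡ x) ⟩
      0# * π ^ k                      ≈⟨ zeroˡ _ ⟩
      0#                              ≈⟨ zeroˡ _ ⟨
      0# * π ^ (k ℕ.+ k)              ∎)

    *ᶠ-assoc : ∀ x y z → (x *ᶠ y) *ᶠ z ≈ᶠ x *ᶠ (y *ᶠ z)
    *ᶠ-assoc (x /π^ k) (y /π^ m) (z /π^ n) = same-den (*-assoc x y z) (ℕ.+-assoc k m n)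

    *ᶠ-comm : ∀ x y → x *ᶠ y ≈ᶠ y *ᶠ x
    *ᶠ-comm (x /π^ k) (y /π^ m) = same-den (*-comm x y) (ℕ.+-comm k m)

    *ᶠ-identityˡ : ∀ x → embed 1# *ᶠ x ≈ᶠ x
    *ᶠ-identityˡ (x /π^ k) = same-den (*-identityˡ x) refl

    *ᶠ-distribˡ : ∀ x y z → x *ᶠ (y +ᶠ z) ≈ᶠ (x *ᶠ y) +ᶠ (x *ᶠ z)
    *ᶠ-distribˡ (x /π^ k) (y /π^ m) (z /π^ n) = cross (begin
      x * (y * C + z * B) * π ^ ((k ℕ.+ m) ℕ.+ (k ℕ.+ n))
        ≈⟨ *-congˡ (^-homo-* π (k ℕ.+ m) (k ℕ.+ n)) ⟩
      x * (y * C + z * B) * (π ^ (k ℕ.+ m) * π ^ (k ℕ.+ n))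
        ≈⟨ *-congˡ (*-cong (^-homo-* π k m) (^-homo-* π k n)) ⟩
      x * (y * C + z * B) * ((A * B) * (A * C))
        ≈⟨ expand x y z A B C ⟩
      (x * y * (A * C) + x * z * (A * B)) * (A * (B * C))
        ≈⟨ *-cong (+-cong (*-congˡ (^-homo-* π k n)) (*-congˡ (^-homo-* π k m)))
                  (*-congˡ (^-homo-* π m n)) ⟨
      (x * y * π ^ (k ℕ.+ n) + x * z * π ^ (k ℕ.+ m)) * (A * π ^ (m ℕ.+ n))
        ≈⟨ *-congˡ (^-homo-* π k (m ℕ.+ n)) ⟨
      (x * y * π ^ (k ℕ.+ n) + x * z * π ^ (k ℕ.+ m)) * π ^ (k ℕ.+ (m ℕ.+ n)) ∎)
      where
      A = π ^ k ; B = π ^ m ; C = π ^ n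

      expand : ∀ x y z A B C → x * (y * C + z * B) * ((A * B) * (A * C))
                               ≈ (x * y * (A * C) + x * z * (A * B)) * (A * (B * C))
      expand = solve 6 (λ x y z A B C → x :* (y :* C :+ z :* B) :* ((A :* B) :* (A :* C))
                 := (x :* y :* (A :* C) :+ x :* z :* (A :* B)) :* (A :* (B :* C))) refl′

  abstract
    localization-isCommutativeRing : IsCommutativeRing _≈ᶠ_ _+ᶠ_ _*ᶠ_ -ᶠ_ (embed 0#) (embed 1#)
    localization-isCommutativeRing = record
      { isRing = record
        { +-isAbelianGroup = record
          { isGroup = record
            { isMonoid = record
              { isSemigroup = record
                { isMagma = record
                  { isEquivalence = record
                    { refl  = cross refl′
                    ; sym   = λ h → cross (sym′ (cross-eq h))
                    ; trans = ≈ᶠ-trans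
                    }
                  ; ∙-cong = +ᶠ-cong
                  }
                ; assoc = +ᶠ-assoc
                }
              ; identity = +ᶠ-identityˡ , (λ x → ≈ᶠ-trans (+ᶠ-comm x _) (+ᶠ-identityˡ x))
              }
            ; inverse = +ᶠ-inverseˡ , (λ x → ≈ᶠ-trans (+ᶠ-comm x _) (+ᶠ-inverseˡ x))
            ; ⁻¹-cong = -ᶠ-cong
            }
          ; comm = +ᶠ-comm
          }
        ; *-cong = *ᶠ-cong
        ; *-assoc = *ᶠ-assoc
        ; *-identity = *ᶠ-identityˡ , (λ x → ≈ᶠ-trans (*ᶠ-comm x _) (*ᶠ-identityˡ x))
        ; distrib = *ᶠ-distribˡ , (λ x y z →
            ≈ᶠ-trans (*ᶠ-comm (y +ᶠ z) x)
              (≈ᶠ-trans (*ᶠ-distribˡ x y z) (+ᶠ-cong (*ᶠ-comm x y) (*ᶠ-comm x z))))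
        }
      ; *-comm = *ᶠ-comm
      }

  localization : CommutativeRing a r
  localization = record
    { Carrier = Fraction Carrier
    ; _≈_ = _≈ᶠ_
    ; _+_ = _+ᶠ_
    ; _*_ = _*ᶠ_
    ; -_  = -ᶠ_
    ; 0#  = embed 0#
    ; 1#  = embed 1#
    ; isCommutativeRing = localization-isCommutativeRing
    }

module Padic (p : ℕ) (p-prime : Prime p) where

  private instance
    p≢0 : NonZero p
    p≢0 = prime⇒nonZero p-prime

  p^_ : ℕ → ℤ
  p^ n = + (p ℕ.^ n)

  p^-nonZero : ∀ n → NonZero (p ℕ.^ n)
  p^-nonZero n = ℕ.m^n≢0 p n

  -- An element of lim Z/pⁿ: the n-th residue class is that of seq n, and any
  -- integer representatives are allowed.

  record ℤₚ : Set where
    constructor mkℤₚ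
    field
      seq      : ℕ → ℤ
      coherent : ∀ n → p^ n ∣ seq (suc n) ℤ.- seq n

  open ℤₚ public

  infix 4 _≈ᶻ_

  record _≈ᶻ_ (x y : ℤₚ) : Set where
    constructor mk≈
    field
      cong-mod : ∀ n → p^ n ∣ seq x n ℤ.- seq y n

  open _≈ᶻ_ public

  private
    transport : ∀ {k a b} → a ≡ b → k ∣ a → k ∣ b
    transport refl h = h

    ∣0 : ∀ {k} → k ∣ 0ℤ
    ∣0 = divides 0ℤ refl

    ∣a-a : ∀ {k a} → k ∣ a ℤ.- a
    ∣a-a {k} {a} = transport (sym (ℤ.+-inverseʳ a)) ∣0

    +-id : ∀ a b c d → (a ℤ.- c) ℤ.+ (b ℤ.- d) ≡ (a ℤ.+ b) ℤ.- (c ℤ.+ d)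
    +-id = solve-∀

    *-id : ∀ a b c d → (a ℤ.- c) ℤ.* b ℤ.+ c ℤ.* (b ℤ.- d) ≡ a ℤ.* b ℤ.- c ℤ.* d
    *-id = solve-∀

    neg-id : ∀ a c → ℤ.- (a ℤ.- c) ≡ (ℤ.- a) ℤ.- (ℤ.- c)
    neg-id = solve-∀

    swap-id : ∀ a c → ℤ.- (a ℤ.- c) ≡ c ℤ.- a
    swap-id = solve-∀

    trans-id : ∀ a b c → (a ℤ.- b) ℤ.+ (b ℤ.- c) ≡ a ℤ.- c
    trans-id = solve-∀

    ∣-+ : ∀ {k} a b c d → k ∣ a ℤ.- c → k ∣ b ℤ.- d → k ∣ (a ℤ.+ b) ℤ.- (c ℤ.+ d)
    ∣-+ a b c d h h′ = transport (+-id a b c d) (∣m∣n⇒∣m+n h h′)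

    ∣-* : ∀ {k} a b c d → k ∣ a ℤ.- c → k ∣ b ℤ.- d → k ∣ a ℤ.* b ℤ.- c ℤ.* d
    ∣-* a b c d h h′ = transport (*-id a b c d) (∣m∣n⇒∣m+n (∣m⇒∣m*n b h) (∣n⇒∣m*n c h′))

    ∣-neg : ∀ {k} a c → k ∣ a ℤ.- c → k ∣ (ℤ.- a) ℤ.- (ℤ.- c)
    ∣-neg a c h = transport (neg-id a c) (∣m⇒∣-m h)

  _+ᶻ_ _*ᶻ_ : ℤₚ → ℤₚ → ℤₚ
  x +ᶻ y = mkℤₚ (λ n → seq x n ℤ.+ seq y n)
                (λ n → ∣-+ (seq x (suc n)) (seq y (suc n)) (seq x n) (seq y n)
                           (coherent x n) (coherent y n))
  x *ᶻ y = mkℤₚ (λ n → seq x n ℤ.* seq y n)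
                (λ n → ∣-* (seq x (suc n)) (seq y (suc n)) (seq x n) (seq y n)
                           (coherent x n) (coherent y n))

  -ᶻ_ : ℤₚ → ℤₚ
  -ᶻ x = mkℤₚ (λ n → ℤ.- seq x n) (λ n → ∣-neg (seq x (suc n)) (seq x n) (coherent x n))

  ℤ→ℤₚ : ℤ → ℤₚ
  ℤ→ℤₚ a = mkℤₚ (λ _ → a) (λ _ → ∣a-a {a = a})

  private
    ≡⇒≈ : ∀ {x y} → (∀ n → seq x n ≡ seq y n) → x ≈ᶻ y
    ≡⇒≈ {x} {y} e = mk≈ (λ n → transport (cong (ℤ._- seq y n) (sym (e n))) (∣a-a {a = seq y n}))

    ≈ᶻ-sym : ∀ {x y} → x ≈ᶻ y → y ≈ᶻ x
    ≈ᶻ-sym {x} {y} h = mk≈ (λ n → transport (swap-id (seq x n) (seq y n)) (∣m⇒∣-m (cong-mod h n)))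

    ≈ᶻ-trans : ∀ {x y z} → x ≈ᶻ y → y ≈ᶻ z → x ≈ᶻ z
    ≈ᶻ-trans {x} {y} {z} h h′ = mk≈ (λ n →
      transport (trans-id (seq x n) (seq y n) (seq z n))
                (∣m∣n⇒∣m+n (cong-mod h n) (cong-mod h′ n)))

  abstract
    ℤₚ-ring-isCommutativeRing : IsCommutativeRing _≈ᶻ_ _+ᶻ_ _*ᶻ_ -ᶻ_ (ℤ→ℤₚ 0ℤ) (ℤ→ℤₚ 1ℤ)
    ℤₚ-ring-isCommutativeRing = record
      { isRing = record
        { +-isAbelianGroup = record
          { isGroup = record
            { isMonoid = record
              { isSemigroup = record
                { isMagma = record
                  { isEquivalence = record
                    { refl = ≡⇒≈ (λ _ → refl) ; sym = ≈ᶻ-sym ; trans = ≈ᶻ-trans }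
                  ; ∙-cong = λ {x} {y} {u} {v} h h′ → mk≈ (λ n →
                      ∣-+ (seq x n) (seq u n) (seq y n) (seq v n) (cong-mod h n) (cong-mod h′ n))
                  }
                ; assoc = λ x y z → ≡⇒≈ (λ n → ℤ.+-assoc (seq x n) (seq y n) (seq z n))
                }
              ; identity = (λ x → ≡⇒≈ (λ n → ℤ.+-identityˡ (seq x n)))
                         , (λ x → ≡⇒≈ (λ n → ℤ.+-identityʳ (seq x n)))
              }
            ; inverse = (λ x → ≡⇒≈ (λ n → ℤ.+-inverseˡ (seq x n)))
                      , (λ x → ≡⇒≈ (λ n → ℤ.+-inverseʳ (seq x n)))
            ; ⁻¹-cong = λ {x} {y} h → mk≈ (λ n → ∣-neg (seq x n) (seq y n) (cong-mod h n))
            }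
          ; comm = λ x y → ≡⇒≈ (λ n → ℤ.+-comm (seq x n) (seq y n))
          }
        ; *-cong = λ {x} {y} {u} {v} h h′ → mk≈ (λ n →
            ∣-* (seq x n) (seq u n) (seq y n) (seq v n) (cong-mod h n) (cong-mod h′ n))
        ; *-assoc = λ x y z → ≡⇒≈ (λ n → ℤ.*-assoc (seq x n) (seq y n) (seq z n))
        ; *-identity = (λ x → ≡⇒≈ (λ n → ℤ.*-identityˡ (seq x n)))
                     , (λ x → ≡⇒≈ (λ n → ℤ.*-identityʳ (seq x n)))
        ; distrib = (λ x y z → ≡⇒≈ (λ n → ℤ.*-distribˡ-+ (seq x n) (seq y n) (seq z n)))
                  , (λ x y z → ≡⇒≈ (λ n → ℤ.*-distribʳ-+ (seq x n) (seq y n) (seq z n)))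
        }
      ; *-comm = λ x y → ≡⇒≈ (λ n → ℤ.*-comm (seq x n) (seq y n))
      }

  ℤₚ-ring : CommutativeRing 0ℓ 0ℓ
  ℤₚ-ring = record
    { Carrier = ℤₚ
    ; _≈_ = _≈ᶻ_
    ; _+_ = _+ᶻ_
    ; _*_ = _*ᶻ_
    ; -_  = -ᶻ_
    ; 0#  = ℤ→ℤₚ 0ℤ
    ; 1#  = ℤ→ℤₚ 1ℤ
    ; isCommutativeRing = ℤₚ-ring-isCommutativeRing
    }

  abstract
    ℤₚ-cancel : NonZeroDivisor ℤₚ-ring (ℤ→ℤₚ (+ p))
    ℤₚ-cancel x y h = mk≈ goal
      where
      factor : ∀ a b c → a ℤ.* c ℤ.- b ℤ.* c ≡ (a ℤ.- b) ℤ.* c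
      factor = solve-∀

      shift : ∀ a b a′ b′ → (a′ ℤ.- b′) ℤ.+ ℤ.- ((a′ ℤ.- b′) ℤ.- (a ℤ.- b)) ≡ a ℤ.- b
      shift = solve-∀

      regroup : ∀ a b a′ b′ → (a′ ℤ.- a) ℤ.+ ℤ.- (b′ ℤ.- b) ≡ (a′ ℤ.- b′) ℤ.- (a ℤ.- b)
      regroup = solve-∀

      next : ∀ n → p^ n ∣ seq x (suc n) ℤ.- seq y (suc n)
      next n = *-cancelʳ-∣ (+ p) (subst (_∣ (seq x (suc n) ℤ.- seq y (suc n)) ℤ.* + p)
        (trans (cong +_ (ℕ.*-comm p (p ℕ.^ n))) (ℤ.pos-* (p ℕ.^ n) p))
        (transport (factor (seq x (suc n)) (seq y (suc n)) (+ p)) (cong-mod h (suc n))))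

      goal : ∀ n → p^ n ∣ seq x n ℤ.- seq y n
      goal n = transport (shift (seq x n) (seq y n) (seq x (suc n)) (seq y (suc n)))
        (∣m∣n⇒∣m+n (next n) (∣m⇒∣-m
          (transport (regroup (seq x n) (seq y n) (seq x (suc n)) (seq y (suc n)))
            (∣m∣n⇒∣m+n (coherent x n) (∣m⇒∣-m (coherent y n))))))

  module ℚₚ-localization = Localization ℤₚ-ring (ℤ→ℤₚ (+ p)) ℤₚ-cancel

  ℚₚ-ring : CommutativeRing 0ℓ 0ℓ
  ℚₚ-ring = ℚₚ-localization.localization

  ℚₚ : Set
  ℚₚ = Fraction ℤₚ

  ℤₚ→ℚₚ : ℤₚ → ℚₚ
  ℤₚ→ℚₚ = ℚₚ-localization.embed

  ℤ→ℚₚ : ℤ → ℚₚ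
  ℤ→ℚₚ a = ℤₚ→ℚₚ (ℤ→ℤₚ a)

-- Coefficients are listed from degree 0 upwards.

evalPoly : {a r : Level} (R : CommutativeRing a r) →
           List (CommutativeRing.Carrier R) → CommutativeRing.Carrier R → CommutativeRing.Carrier R
evalPoly R cs x = foldr (λ c v → c + x * v) 0# cs
  where open CommutativeRing R

-- HeytingField is the field structure of the library.  All non-vanishing
-- conditions below use _≉_; under excluded middle it is equivalent to _#_.

fieldRing : {a r s : Level} → HeytingField a r s → CommutativeRing a r
fieldRing K = HeytingCommutativeRing.commutativeRing (HeytingField.heytingCommutativeRing K)

module Closure (ℓ : ℕ) (ℓ-prime : Prime ℓ) {a r s : Level} (K : HeytingField a r s) where

  open Padic ℓ ℓ-prime renaming (ℚₚ to ℚₗ; ℚₚ-ring to ℚₗ-ring; ℤₚ to ℤₗ; ℤₚ→ℚₚ to ℤₗ→ℚₗ; ℤ→ℚₚ to ℤ→ℚₗ)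
  open CommutativeRing (fieldRing K)
  open CommutativeRing ℚₗ-ring using () renaming (_≉_ to _≉ₗ_; 0# to 0ₗ)

  record IsAlgebraicClosure : Set (a ⊔ r) where
    field
      ι : ℚₗ → Carrier
      ι-isRingMonomorphism :
        IsRingMonomorphism (CommutativeRing.rawRing ℚₗ-ring) rawRing ι
      algebraic : ∀ x → ∃[ cs ] (Any (_≉ₗ 0ₗ) cs × evalPoly (fieldRing K) (map ι cs) x ≈ 0#)
      algebraicallyClosed :
        ∀ c cs → Any (_≉ 0#) cs → ∃[ x ] (evalPoly (fieldRing K) (c ∷ cs) x ≈ 0#)

    ℤ→K : ℤ → Carrier
    ℤ→K b = ι (ℤ→ℚₗ b)

  -- ord is only defined away from 0, where its values are rational.  Together
  -- with ord-ℓ, the field ord-ℤₗ says that ord restricts to the ℓ-adic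
  -- valuation of Q_ℓ (it forces ord u = 0 for units u of Z_ℓ).  Without it
  -- there are other valuations with ord ℓ = 1.

  module _ (closure : IsAlgebraicClosure) where
    open IsAlgebraicClosure closure

    record Valuation : Set (a ⊔ r) where
      field
        ord      : ∀ x → x ≉ 0# → ℚ
        ord-cong : ∀ {x y} (x≉0 : x ≉ 0#) (y≉0 : y ≉ 0#) → x ≈ y → ord x x≉0 ≡ ord y y≉0
        ord-*    : ∀ {x y} (x≉0 : x ≉ 0#) (y≉0 : y ≉ 0#) (xy≉0 : x * y ≉ 0#) →
                   ord (x * y) xy≉0 ≡ ord x x≉0 ℚ.+ ord y y≉0
        ord-+    : ∀ {x y} (x≉0 : x ≉ 0#) (y≉0 : y ≉ 0#) (x+y≉0 : x + y ≉ 0#) →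
                   ord x x≉0 ℚ.⊓ ord y y≉0 ℚ.≤ ord (x + y) x+y≉0
        ord-ℓ    : (ℓ≉0 : ℤ→K (+ ℓ) ≉ 0#) → ord (ℤ→K (+ ℓ)) ℓ≉0 ≡ 1ℚ
        ord-ℤₗ   : ∀ (u : ℤₗ) (u≉0 : ι (ℤₗ→ℚₗ u) ≉ 0#) → 0ℚ ℚ.≤ ord (ι (ℤₗ→ℚₗ u)) u≉0

module Gamma (p : ℕ) (p-prime : Prime p) (d : ℕ) where
  open Padic p p-prime

  Γ : AbelianGroup 0ℓ 0ℓ
  Γ = Pointwise.abelianGroup (Fin d) (CommutativeRing.+-abelianGroup ℤₚ-ring)

  open AbelianGroup Γ public using () renaming (Carrier to ∣Γ∣; _≈_ to _≈Γ_)

  γ : Fin d → ∣Γ∣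
  γ i j with i Fin.≟ j
  ... | yes _ = ℤ→ℤₚ 1ℤ
  ... | no  _ = ℤ→ℤₚ 0ℤ

  Γ/ : ℕ → AbelianGroup 0ℓ 0ℓ
  Γ/ n = Γ /powers (p ℕ.^ n)

  -- A formal sum of terms b T^a.  Only the additive structure of the group
  -- ring is needed: it is the free abelian group on Γ.

  Term : Set
  Term = ℤ × ∣Γ∣

  coefficient : Term → ℤ
  coefficient = proj₁

  exponent : Term → ∣Γ∣
  exponent = proj₂

  Φ : Set
  Φ = List Term

  infix 4 _≈Φ_

  data _≈Φ_ : Φ → Φ → Set where
    ≈-refl  : ∀ {F} → F ≈Φ F
    ≈-sym   : ∀ {F G} → F ≈Φ G → G ≈Φ F
    ≈-trans : ∀ {F G H} → F ≈Φ G → G ≈Φ H → F ≈Φ H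
    ≈-cons  : ∀ {b a a′ F G} → a ≈Γ a′ → F ≈Φ G → ((b , a) ∷ F) ≈Φ ((b , a′) ∷ G)
    ≈-swap  : ∀ {s t F} → (s ∷ t ∷ F) ≈Φ (t ∷ s ∷ F)
    ≈-merge : ∀ {b c a F} → ((b , a) ∷ (c , a) ∷ F) ≈Φ ((b ℤ.+ c , a) ∷ F)
    ≈-zero  : ∀ {a F} → ((0ℤ , a) ∷ F) ≈Φ F

  0Φ : Φ
  0Φ = []

  DistinctExponents : Φ → Set
  DistinctExponents = AllPairs (λ t t′ → ¬ (exponent t ≈Γ exponent t′))

module Characters
  (p ℓ : ℕ) (p-prime : Prime p) (ℓ-prime : Prime ℓ) (d : ℕ) {a r s : Level}
  (K : HeytingField a r s)
  (closure : Closure.IsAlgebraicClosure ℓ ℓ-prime K)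
  (v : Closure.Valuation ℓ ℓ-prime K closure) where

  open Padic p p-prime using (ℤₚ; seq; p^-nonZero)
  open Gamma p p-prime d
  open CommutativeRing (fieldRing K)
  open Closure ℓ ℓ-prime K
  open IsAlgebraicClosure closure
  open Valuation v

  -- A homomorphism of monoids from a group to (K , *) takes values in the
  -- units, so these are exactly the homomorphisms Γ/ n → K^×.

  Γ/_∨ : ℕ → Set (a ⊔ r)
  Γ/ n ∨ = MonoidHomomorphism (AbelianGroup.rawMonoid (Γ/ n)) *-rawMonoid

  open MonoidHomomorphism public using (⟦_⟧)

  characterSetoid : ℕ → Setoid (a ⊔ r) r
  characterSetoid n = record
    { Carrier = Γ/ n ∨
    ; _≈_     = λ ω χ → ∀ g → ⟦ ω ⟧ g ≈ ⟦ χ ⟧ g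
    ; isEquivalence = record
      { refl  = λ _ → CommutativeRing.refl (fieldRing K)
      ; sym   = λ e g → CommutativeRing.sym (fieldRing K) (e g)
      ; trans = λ e e′ g → CommutativeRing.trans (fieldRing K) (e g) (e′ g)
      }
    }

  _^ᴷ_ : Carrier → ℕ → Carrier
  x ^ᴷ n = Multiple._×_ *-rawMonoid n x

  -- ζ^α for ζ with ζ^(pⁿ) = 1 and α in Z_p.

  _^[_]_ : Carrier → ℕ → ℤₚ → Carrier
  ζ ^[ n ] α = ζ ^ᴷ (_%ℕ_ (seq α n) (p ℕ.^ n) {{p^-nonZero n}})

  evalMonomial : ∀ n → Γ/ n ∨ → ∣Γ∣ → Carrier
  evalMonomial n ω α = Multiple.sum *-rawMonoid (λ i → ⟦ ω ⟧ (γ i) ^[ n ] α i)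

  eval : ∀ n → Γ/ n ∨ → Φ → Carrier
  eval n ω = foldr (λ t x → ℤ→K (coefficient t) * evalMonomial n ω (exponent t) + x) 0#

  Supp : ℕ → Φ → Setoid (a ⊔ r) r
  Supp n F = On.setoid {B = Σ[ ω ∈ Γ/ n ∨ ] (eval n ω F ≉ 0#)} (characterSetoid n) proj₁

  ordSupp : ∀ n F → Setoid.Carrier (Supp n F) → ℚ
  ordSupp n F (ω , ωF≉0) = ord (eval n ω F) ωF≉0

  -- μ is the minimum of the ord (b_i); zero coefficients have ord = ∞ and so
  -- do not contribute.

  record IsMu (F : Φ) (μ : ℚ) : Set (a ⊔ r) where
    field
      attained   : ∃[ t ] Σ[ b≉0 ∈ ℤ→K (coefficient t) ≉ 0# ]
                     (t ∈ F × ord (ℤ→K (coefficient t)) b≉0 ≡ μ)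
      lowerBound : ∀ t (b≉0 : ℤ→K (coefficient t) ≉ 0#) → t ∈ F →
                     μ ℚ.≤ ord (ℤ→K (coefficient t)) b≉0

{-# OPTIONS --safe #-}
module Submission where

-- Write F = ℓ^μ G, where some coefficient b₀ of G is prime to ℓ, and fix a character ω of Γ/ n; then
-- ω(G) = Σ bⱼ ζⱼ for p-power roots of unity ζⱼ.  Modulo ℓ an integral expression x in roots of unity
-- satisfies x^ℓ ≡ φ(x), with φ raising the roots to the power ℓ, and φᵗ = id for some t > 0.  By
-- induction on k this shows that φ preserves the relation ord x ≥ k, without any Galois theory.  The
-- powers of ℓ come arbitrarily close to every element of 1 + W ℤ_p for some power W of p, so averaging
-- the conjugates φᵗ(ω(G)), with p-power and hence ℓ-adically invertible denominator, keeps only the terms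
-- with ζⱼ ∈ μ_W: if ord ω(G) ≥ k, then every subsum over a coset of μ_W has ord ≥ k as well.
--
-- First consequence: if ord ω(G) > 0 then, because b₀ alone is a unit, ζⱼ^W = ζ₀^W for some j ≠ 0.  This
-- is a non-trivial condition on ω, satisfied by O(p^((d-1)n)) characters; for all others ord ω(F) = μ.
-- Second consequence: when ω(G) ≠ 0, some coset subsum is non-zero; up to a root of unity it takes only
-- finitely many values, so ord ω(G) ≤ C with C independent of n and ω.

open import Defs
open import Algebra.Apartness.Bundles using (HeytingField)
open import Algebra.Bundles using (AbelianGroup; CommutativeMonoid; CommutativeRing; CommutativeSemiring)
import Algebra.Construct.Pointwise as Pointwise
import Algebra.Definitions.RawMonoid as Multiple
open import Algebra.Morphism.Bundles using (MonoidHomomorphism)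
import Algebra.Morphism.RingMonomorphism as RingMonomorphism
open import Algebra.Morphism.Structures using (IsRingMonomorphism)
open import Axiom.ExcludedMiddle using (ExcludedMiddle)
open import Data.Fin as Fin using (Fin; toℕ; punchIn; finToFun; funToFin; combine; fromℕ; fromℕ<; inject₁)
import Data.Fin.Properties as Fin
open import Data.Integer as ℤ using (ℤ; +_; -[1+_])
open import Data.Integer.DivMod using (a≡a%ℕn+[a/ℕn]*n)
import Data.Integer.Divisibility.Signed as ℤ∣
import Data.Integer.Properties as ℤ
open import Data.Integer.Tactic.RingSolver using (solve-∀)
open import Data.List as List using (List; []; _∷_; _++_; allFin; foldr; length; map; replicate)
open import Data.List.Membership.Propositional using (_∈_; find)
open import Data.List.Membership.Propositional.Properties
  using (∈-allFin; ∈-filter⁻; ∈-lookup; ∈-map⁺; ∈-map⁻)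
import Data.List.Properties as List
open import Data.List.Relation.Binary.Sublist.Propositional using (_⊆_; []; _∷_; _∷ʳ_; ⊆-refl; ⊆-trans)
import Data.List.Relation.Binary.Sublist.Propositional.Properties as Sublist
open import Data.List.Relation.Unary.All as All using (All; []; _∷_)
import Data.List.Relation.Unary.All.Properties as All
open import Data.List.Relation.Unary.AllPairs using (AllPairs; []; _∷_)
import Data.List.Relation.Unary.AllPairs.Properties as AllPairs
open import Data.List.Relation.Unary.Any as Any using (Any; here; there)
import Data.List.Relation.Unary.Any.Properties as Any
import Data.List.Relation.Unary.Unique.Propositional.Properties as Unique
open import Data.Nat as ℕ using (ℕ; zero; suc; NonZero)
open import Data.Nat.Coprimality using (Coprime; coprime-Bézout)
import Data.Nat.Divisibility as ℕ∣
open import Data.Nat.DivMod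
  using (_/_; _%_; m%n<n; m≡m%n+[m/n]*n; m/n*n≡m; m*n/n≡m; +-distrib-/-∣ʳ; m<n*o⇒m/o<n)
open import Data.Nat.GCD using (module Bézout)
open import Data.Nat.Primality
  using (Prime; euclidsLemma; prime⇒irreducible; prime⇒nonTrivial; prime⇒nonZero)
import Data.Nat.Properties as ℕ
open import Data.Nat.Tactic.RingSolver using () renaming (solve-∀ to ℕ-solve-∀)
open import Data.Product using (∃-syntax; Σ-syntax; _×_; _,_; proj₁; proj₂)
open import Data.Rational as ℚ using (ℚ; 0ℚ; 1ℚ)
import Data.Rational.Properties as ℚ
import Data.Rational.Unnormalised as ℚᵘ
import Data.Rational.Unnormalised.Properties as ℚᵘ
open import Data.Sum using (inj₁; inj₂)
open import Data.Vec.Functional using (removeAt)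
open import Function using (id)
open import Level using (Level; _⊔_; Lift; lift; lower)
open import Relation.Binary.Bundles using (Setoid)
open import Relation.Binary.PropositionalEquality as ≡ using (_≡_; _≢_; cong; cong₂; subst; subst₂)
open import Relation.Nullary using (¬_; ¬?; Dec; yes; no; contradiction)
open import Relation.Nullary.Decidable using (decidable-stable; map′)
open import Relation.Unary using (Pred; Decidable)

open import Algebra.Properties.CommutativeSemigroup
  (AbelianGroup.commutativeSemigroup ℚ.+-0-abelianGroup) using (interchange)
open import Algebra.Properties.Group ℚ.+-0-group using () renaming (∙-cancelˡ to ℚ-+-cancelˡ)
open import Algebra.Properties.Semiring.Exp ℤ.+-*-semiring using () renaming (_^_ to _^ℤ_)

-- Arithmetic of prime powers

-- The conjugation argument transports integer bounds only, since each induction step divides by ℓ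
-- once. What it needs in addition is that no valuation lies strictly between 0 and 1, in other
-- words that p-power roots of unity are unramified at ℓ; otherwise characters with 0 < ord ω(G) < 1
-- would escape the collision argument. `gap` extracts this from the same identity x^M = x + ℓ g
-- that drives `galois`.
--
-- Conjugation acts on formal expressions, because nothing guarantees in advance that two
-- expressions of one element have equal conjugates. That they do is a consequence: for the
-- difference of the two, whose value is 0, `galois` holds with every k.
--
-- The powers of ℓ are dense only in an open subgroup of the p-adic units, so the conjugations need
-- not separate the roots inside μ_W. As W does not depend on n, this costs only constants.

module Arithmetic where

  open import Data.Nat using (_+_; _*_; _∸_; _^_; _≤_; _<_; s≤s; z≤n; _!)
  open import Data.Nat.Combinatorics using (_C_; nCk≡n!/k![n-k]!; k![n∸k]!∣n!; nCn≡1)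
  open import Data.Nat.Divisibility using (divides; _∣_; _∤_)

  module _ {ℓ : ℕ} (ℓ-prime : Prime ℓ) where

    private instance
      ℓ≢0 : NonZero ℓ
      ℓ≢0 = prime⇒nonZero ℓ-prime

    abstract
      1<prime : 1 < ℓ
      1<prime = ℕ.nonTrivial⇒n>1 ℓ {{prime⇒nonTrivial ℓ-prime}}

    prime∤1 : ℓ ∤ 1
    prime∤1 ℓ∣1 = ℕ.<⇒≢ 1<prime (≡.sym (ℕ∣.∣1⇒≡1 ℓ∣1))

    prime∣!⇒≤ : ∀ n → ℓ ∣ n ! → ℓ ≤ n
    prime∣!⇒≤ zero    d = contradiction d prime∤1
    prime∣!⇒≤ (suc n) d with euclidsLemma (suc n) (n !) ℓ-prime d
    ... | inj₁ ℓ∣1+n = ℕ∣.∣⇒≤ ℓ∣1+n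
    ... | inj₂ ℓ∣n!  = ℕ.m≤n⇒m≤1+n (prime∣!⇒≤ n ℓ∣n!)

    -- The prime ℓ divides ℓ! but neither k! nor (ℓ - k)!, all of whose factors are below ℓ.
    prime∣C : ∀ k → 0 < k → k < ℓ → ℓ ∣ ℓ C k
    prime∣C k 0<k k<ℓ with euclidsLemma (ℓ C k) (k ! * (ℓ ∸ k) !) ℓ-prime ℓ∣product
      where
      instance
        k![ℓ-k]!≢0 : NonZero (k ! * (ℓ ∸ k) !)
        k![ℓ-k]!≢0 = k ℕ.!* (ℓ ∸ k) !≢0

      product≡ : (ℓ C k) * (k ! * (ℓ ∸ k) !) ≡ ℓ !
      product≡ = ≡.trans (cong (λ c → c * (k ! * (ℓ ∸ k) !)) (nCk≡n!/k![n-k]! (ℕ.<⇒≤ k<ℓ))) (m/n*n≡m (k![n∸k]!∣n! (ℕ.<⇒≤ k<ℓ)))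

      n∣n! : ∀ n → .{{NonZero n}} → n ∣ n !
      n∣n! (suc n) = ℕ∣.m∣m*n (n !)

      ℓ∣product : ℓ ∣ (ℓ C k) * (k ! * (ℓ ∸ k) !)
      ℓ∣product = subst (ℓ ∣_) (≡.sym product≡) (n∣n! ℓ)
    ... | inj₁ d = d
    ... | inj₂ d with euclidsLemma (k !) ((ℓ ∸ k) !) ℓ-prime d
    ...   | inj₁ e = contradiction (prime∣!⇒≤ k e) (ℕ.<⇒≱ k<ℓ)
    ...   | inj₂ e = contradiction (prime∣!⇒≤ (ℓ ∸ k) e) (ℕ.<⇒≱ (ℕ.∸-monoʳ-< 0<k (ℕ.<⇒≤ k<ℓ)))

    -- The semiring is arbitrary because there are two uses: in ℤ the dream yields Fermat's little
    -- theorem, and in the ring of expressions it delivers the multiple of ℓ as an expression again.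
    module FreshmansDream {c e} (S : CommutativeSemiring c e) where
      open CommutativeSemiring S hiding (_+_; _*_)
      open CommutativeSemiring S using () renaming (_+_ to _⊕_)
      open import Algebra.Properties.Semiring.Exp semiring using () renaming (_^_ to _↑_)
      open import Algebra.Properties.Semiring.Mult semiring using (×-assocˡ; ×-congˡ; ×-homo-1) renaming (_×_ to _·_)
      open import Algebra.Properties.Semiring.Sum semiring using (sum; sum-init-last)
      open import Algebra.Properties.CommutativeMonoid.Mult +-commutativeMonoid using (×-distrib-+)
      open import Algebra.Properties.CommutativeSemiring.Binomial S using (binomial; binomialTerm; theorem)
      open import Relation.Binary.Reasoning.Setoid setoid

      sum-divisible : ∀ m n (f : Fin n → Carrier) → (∀ i → ∃[ y ] f i ≈ m · y) →
                      ∃[ y ] sum f ≈ m · y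
      sum-divisible m zero    f h = 0# , go m
        where
        go : ∀ k → 0# ≈ k · 0#
        go zero    = refl
        go (suc k) = trans (go k) (sym (+-identityˡ _))
      sum-divisible m (suc n) f h =
        let y , e = h Fin.zero
            z , e′ = sum-divisible m n (λ i → f (Fin.suc i)) (λ i → h (Fin.suc i))
        in y ⊕ z , trans (+-cong e e′) (sym (×-distrib-+ y z m))

      freshmansDream : ∀ x y → ∃[ z ] (x ⊕ y) ↑ ℓ ≈ x ↑ ℓ ⊕ y ↑ ℓ ⊕ ℓ · z
      freshmansDream x y = go ℓ ≡.refl
        where
        -- The exponent becomes a variable, so that matching on `suc n` exposes the first and the
        -- last binomial term.
        go : ∀ n → n ≡ ℓ → ∃[ z ] (x ⊕ y) ↑ n ≈ x ↑ n ⊕ y ↑ n ⊕ n · z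
        go zero    e = contradiction (subst (1 <_) (≡.sym e) 1<prime) λ ()
        go (suc n) e = z , (begin
          (x ⊕ y) ↑ suc n                                ≈⟨ theorem (suc n) x y ⟩
          t Fin.zero ⊕ sum (λ i → t (Fin.suc i))         ≈⟨ +-cong first (sum-init-last (λ i → t (Fin.suc i))) ⟩
          y ↑ suc n ⊕ (sum middle ⊕ t (Fin.suc (fromℕ n))) ≈⟨ +-congˡ (+-cong middle≈ last′) ⟩
          y ↑ suc n ⊕ (suc n · z ⊕ x ↑ suc n)            ≈⟨ +-congˡ (+-comm _ _) ⟩
          y ↑ suc n ⊕ (x ↑ suc n ⊕ suc n · z)            ≈⟨ +-assoc _ _ _ ⟨
          y ↑ suc n ⊕ x ↑ suc n ⊕ suc n · z              ≈⟨ +-congʳ (+-comm _ _) ⟩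
          x ↑ suc n ⊕ y ↑ suc n ⊕ suc n · z              ∎)
          where
          t : Fin (suc (suc n)) → Carrier
          t = binomialTerm x y (suc n)

          middle : Fin n → Carrier
          middle i = t (Fin.suc (inject₁ i))

          divisible : ∀ i → ∃[ w ] middle i ≈ suc n · w
          divisible i with subst (λ m → m ∣ m C toℕ (Fin.suc (inject₁ i))) (≡.sym e)
                             (prime∣C _ (s≤s z≤n) (subst (suc (toℕ (inject₁ i)) <_) e
                               (s≤s (subst (_< n) (≡.sym (Fin.toℕ-inject₁ i)) (Fin.toℕ<n i)))))
          ... | divides q eq = q · b , (begin
            middle i          ≈⟨ ×-congˡ {x = b} (≡.trans eq (ℕ.*-comm q (suc n))) ⟩
            (suc n * q) · b   ≈⟨ ×-assocˡ b (suc n) q ⟨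
            suc n · (q · b)   ∎)
            where b = binomial x y (suc n) (Fin.suc (inject₁ i))

          z : Carrier
          z = proj₁ (sum-divisible (suc n) n middle divisible)

          middle≈ : sum middle ≈ suc n · z
          middle≈ = proj₂ (sum-divisible (suc n) n middle divisible)

          first : t Fin.zero ≈ y ↑ suc n
          first = trans (×-homo-1 _) (*-identityˡ _)

          last′ : t (Fin.suc (fromℕ n)) ≈ x ↑ suc n
          last′ rewrite Fin.toℕ-fromℕ n | nCn≡1 (suc n) | ℕ.n∸n≡0 n = trans (×-homo-1 _) (*-identityʳ _)

  module _ {ℓ : ℕ} (ℓ-prime : Prime ℓ) where
    open FreshmansDream ℓ-prime ℤ.+-*-commutativeSemiring
    open import Algebra.Properties.Semiring.Mult ℤ.+-*-semiring using () renaming (_×_ to _·_)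

    ·≡* : ∀ n z → n · z ≡ + n ℤ.* z
    ·≡* zero    z = ≡.sym (ℤ.*-zeroˡ z)
    ·≡* (suc n) z = ≡.trans (cong (λ w → z ℤ.+ w) (·≡* n z)) (≡.sym (ℤ.suc-* (+ n) z))

    ℤ-0^ : ∀ n → .{{NonZero n}} → ℤ.0ℤ ^ℤ n ≡ ℤ.0ℤ
    ℤ-0^ (suc n) = ℤ.*-zeroˡ (ℤ.0ℤ ^ℤ n)

    ℤ-1^ : ∀ n → ℤ.1ℤ ^ℤ n ≡ ℤ.1ℤ
    ℤ-1^ zero    = ≡.refl
    ℤ-1^ (suc n) = ≡.trans (ℤ.*-identityˡ _) (ℤ-1^ n)

    0^ℓ : ℤ.0ℤ ^ℤ ℓ ≡ ℤ.0ℤ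
    0^ℓ = ℤ-0^ ℓ {{prime⇒nonZero ℓ-prime}}

    dream : ∀ x y → ∃[ z ] (x ℤ.+ y) ^ℤ ℓ ≡ x ^ℤ ℓ ℤ.+ y ^ℤ ℓ ℤ.+ + ℓ ℤ.* z
    dream x y = let z , e = freshmansDream x y in
      z , ≡.trans e (cong (λ w → x ^ℤ ℓ ℤ.+ y ^ℤ ℓ ℤ.+ w) (·≡* ℓ z))

    fermat⁺ : ∀ n → ∃[ h ] (+ n) ^ℤ ℓ ≡ + n ℤ.+ + ℓ ℤ.* h
    fermat⁺ zero = ℤ.0ℤ , ≡.trans 0^ℓ (≡.sym (≡.trans (ℤ.+-identityˡ _) (ℤ.*-zeroʳ (+ ℓ))))
    fermat⁺ (suc n) =
      let h , e = fermat⁺ n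
          z , e′ = dream ℤ.1ℤ (+ n)
      in h ℤ.+ z , ≡.trans e′ (≡.trans (cong₂ (λ u v → u ℤ.+ v ℤ.+ + ℓ ℤ.* z) (ℤ-1^ ℓ) e) (alg (+ n) (+ ℓ) h z))
      where
      alg : ∀ n l h z → ℤ.1ℤ ℤ.+ (n ℤ.+ l ℤ.* h) ℤ.+ l ℤ.* z ≡ ℤ.1ℤ ℤ.+ n ℤ.+ l ℤ.* (h ℤ.+ z)
      alg = solve-∀
    fermat : ∀ b → ∃[ h ] b ^ℤ ℓ ≡ b ℤ.+ + ℓ ℤ.* h
    fermat (+ n) = fermat⁺ n
    -- Expanding 0 = (-(n+1) + (n+1))^ℓ reduces to the positive case without looking at the parity
    -- of ℓ.
    fermat -[1+ n ] =
      let h , e = fermat⁺ (suc n)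
          z , e′ = dream -[1+ n ] (+ suc n)
          s = ≡.trans (≡.sym 0^ℓ) (≡.trans (cong (_^ℤ ℓ) (≡.sym (ℤ.+-inverseˡ (+ suc n)))) (≡.trans e′ (cong (λ w → -[1+ n ] ^ℤ ℓ ℤ.+ w ℤ.+ + ℓ ℤ.* z) e)))
      in ℤ.- h ℤ.- z , (begin
        -[1+ n ] ^ℤ ℓ                                 ≡⟨ alg (-[1+ n ] ^ℤ ℓ) (+ suc n) (+ ℓ) h z ⟩
        -[1+ n ] ^ℤ ℓ ℤ.+ (+ suc n ℤ.+ + ℓ ℤ.* h) ℤ.+ + ℓ ℤ.* z ℤ.+ r h z ≡⟨ cong (λ w → w ℤ.+ r h z) s ⟨
        ℤ.0ℤ ℤ.+ r h z                               ≡⟨ ℤ.+-identityˡ _ ⟩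
        r h z                                        ∎)
      where
      open ≡.≡-Reasoning
      r : ℤ → ℤ → ℤ
      r h z = ℤ.- (+ suc n) ℤ.+ + ℓ ℤ.* (ℤ.- h ℤ.- z)

      alg : ∀ x m l h z → x ≡ (x ℤ.+ (m ℤ.+ l ℤ.* h) ℤ.+ l ℤ.* z) ℤ.+ (ℤ.- m ℤ.+ l ℤ.* (ℤ.- h ℤ.- z))
      alg = solve-∀

  module _ {p : ℕ} (p-prime : Prime p) where

    private instance
      p≢0 : NonZero p
      p≢0 = prime⇒nonZero p-prime

    abstract
      p^≢0 : ∀ n → NonZero (p ^ n)
      p^≢0 n = ℕ.m^n≢0 p n

    p^∣-coprime : ∀ n x y → p ∤ y → p ^ n ∣ x * y → p ^ n ∣ x
    p^∣-coprime zero    x y p∤y d = ℕ∣.1∣ x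
    p^∣-coprime (suc n) x y p∤y d with euclidsLemma x y p-prime (ℕ∣.∣-trans (ℕ∣.m∣m*n (p ^ n)) d)
    ... | inj₂ e = contradiction e p∤y
    ... | inj₁ (divides x′ ≡.refl) = subst (_∣ x′ * p) (ℕ.*-comm (p ^ n) p)
      (ℕ∣.*-monoˡ-∣ p (p^∣-coprime n x′ y p∤y (ℕ∣.*-cancelˡ-∣ p (subst (p * p ^ n ∣_) (alg x′ p y) d))))
      where
      alg : ∀ x p y → x * p * y ≡ p * (x * y)
      alg = ℕ-solve-∀

    -- Every factor p of y uses up one of the b spare powers, and y runs out of such factors before
    -- b is exhausted.
    p^∣-cancel : ∀ a b x y → p ^ b ∤ y → p ^ (a + b) ∣ x * y → p ^ a ∣ x
    p^∣-cancel a zero    x y ∤y d = contradiction (ℕ∣.1∣ y) ∤y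
    p^∣-cancel a (suc b) x y ∤y d with p ℕ∣.∣? y
    ... | yes (divides y′ ≡.refl) = p^∣-cancel a b x y′
            (λ e → ∤y (subst (_∣ y′ * p) (ℕ.*-comm (p ^ b) p) (ℕ∣.*-monoˡ-∣ p e)))
            (ℕ∣.*-cancelˡ-∣ p (subst₂ _∣_ (cong (p ^_) (ℕ.+-suc a b)) (alg x p y′) d))
      where
      alg : ∀ x p y → x * (y * p) ≡ p * (x * y)
      alg = ℕ-solve-∀
    ... | no p∤y = p^∣-coprime a x y p∤y (ℕ∣.∣-trans (divides (p ^ suc b)
                     (≡.trans (ℕ.^-distribˡ-+-* p a (suc b)) (ℕ.*-comm (p ^ a) _))) d)

    p^-cancel-≤ : ∀ m n → p ^ m ∣ p ^ n → m ≤ n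
    p^-cancel-≤ m n d = ℕ.≮⇒≥ λ n<m → ℕ.<⇒≱ (ℕ.^-monoʳ-< p (1<prime p-prime) n<m) (ℕ∣.∣⇒≤ {{p^≢0 n}} d)

    expand : ∀ n x → ∃[ y ] (1 + x) ^ n ≡ 1 + n * x + x * x * y
    expand zero    x = 0 , cong suc (≡.sym (ℕ.*-zeroʳ (x * x)))
    expand (suc n) x = let y , e = expand n x in
      n + y + x * y , ≡.trans (cong ((1 + x) *_) e) (alg n x y)
      where
      alg : ∀ n x y → (1 + x) * (1 + n * x + x * x * y) ≡ 1 + (1 + n) * x + x * x * (n + y + x * y)
      alg = ℕ-solve-∀

    -- The p-adic valuation of q - 1 is m.
    ExactlyAt : ℕ → ℕ → Set
    ExactlyAt m q = ∃[ u ] (p ∤ u × q ≡ 1 + u * p ^ m)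

    -- In (1 + x)^p = 1 + p x + x² y with x = u p^m the last term is divisible by p^(2m). From 2 ≤ m
    -- follows 2m ≥ m + 2, so that p x alone decides the valuation, also for p = 2.
    lift-exponent : ∀ m q → 2 ≤ m → ExactlyAt m q → ExactlyAt (suc m) (q ^ p)
    lift-exponent (suc zero) q (s≤s ())
    lift-exponent (suc (suc m)) q _ (u , p∤u , ≡.refl) =
      let y , e = expand p (u * p ^ suc (suc m)) in
      p * (p ^ m * u * u * y) + u
      , (λ d → p∤u (ℕ∣.∣m+n∣m⇒∣n d (ℕ∣.m∣m*n _)))
      , ≡.trans e (cong suc (alg p u (p ^ m) y))
      where
      alg : ∀ p u P y → p * (u * (p * (p * P))) + u * (p * (p * P)) * (u * (p * (p * P))) * y
                        ≡ (p * (P * u * u * y) + u) * (p * (p * (p * P)))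
      alg = ℕ-solve-∀

    valuation : ∀ n → .{{NonZero n}} → ∃[ m ] ∃[ u ] (p ∤ u × n ≡ u * p ^ m)
    valuation n = go n n ℕ.≤-refl
      where
      go : ∀ fuel n → .{{NonZero n}} → n ≤ fuel → ∃[ m ] ∃[ u ] (p ∤ u × n ≡ u * p ^ m)
      go zero       n n≤f = contradiction n≤f (ℕ.<⇒≱ (ℕ.>-nonZero⁻¹ n))
      go (suc fuel) n n≤f with p ℕ∣.∣? n
      ... | no  p∤n = 0 , n , p∤n , ≡.sym (ℕ.*-identityʳ n)
      ... | yes (divides q ≡.refl) =
        let instance q≢0 = ℕ.m*n≢0⇒m≢0 q
            m , u , p∤u , e = go fuel q (ℕ.≤-pred (ℕ.<-≤-trans (ℕ.m<m*n q p (1<prime p-prime)) n≤f))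
        in suc m , u , p∤u , ≡.trans (cong (_* p) e) (alg u (p ^ m) p)
        where
        alg : ∀ u P p → u * P * p ≡ u * (p * P)
        alg = ℕ-solve-∀

    -- Powers of ℓ that are p-adically close to 1

    module PowersNearOne (ℓ : ℕ) (p∤ℓ : p ∤ ℓ) (1<ℓ : 1 < ℓ) where

      p∤ℓ^ : ∀ n → p ∤ ℓ ^ n
      p∤ℓ^ zero    d = prime∤1 p-prime d
      p∤ℓ^ (suc n) d with euclidsLemma ℓ (ℓ ^ n) p-prime d
      ... | inj₁ e = p∤ℓ e
      ... | inj₂ e = p∤ℓ^ n e

      -- Among the first pⁿ + 1 powers of ℓ two agree modulo pⁿ. The smaller one can be divided out
      -- because p does not divide it.
      period : ∀ n → ∃[ k ] (0 < k × p ^ n ∣ ℓ ^ k ∸ 1)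
      period n with Fin.pigeonhole (ℕ.n<1+n (p ^ n)) (λ i → fromℕ< (m%n<n (ℓ ^ toℕ i) (p ^ n) {{p^≢0 n}}))
      ... | i , j , i<j , e = toℕ j ∸ toℕ i , ℕ.m<n⇒0<n∸m i<j ,
        p^∣-coprime n _ (ℓ ^ toℕ i) (p∤ℓ^ (toℕ i)) (subst (p ^ n ∣_) split
          (%≡⇒∣∸ (ℕ.^-monoʳ-≤ ℓ {{ℕ.>-nonZero (ℕ.<⇒≤ 1<ℓ)}} (ℕ.<⇒≤ i<j)) (Fin.fromℕ<-injective _ _ _ _ e)))
        where
        instance _ = p^≢0 n

        %≡⇒∣∸ : ∀ {x y} → x ≤ y → x % p ^ n ≡ y % p ^ n → p ^ n ∣ y ∸ x
        %≡⇒∣∸ {x} {y} x≤y e = divides (y / p ^ n ∸ x / p ^ n) (begin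
          y ∸ x                                                        ≡⟨ cong₂ _∸_ (m≡m%n+[m/n]*n y (p ^ n)) (m≡m%n+[m/n]*n x (p ^ n)) ⟩
          y % p ^ n + y / p ^ n * p ^ n ∸ (x % p ^ n + x / p ^ n * p ^ n) ≡⟨ cong (λ z → y % p ^ n + y / p ^ n * p ^ n ∸ (z + x / p ^ n * p ^ n)) e ⟩
          y % p ^ n + y / p ^ n * p ^ n ∸ (y % p ^ n + x / p ^ n * p ^ n) ≡⟨ ℕ.[m+n]∸[m+o]≡n∸o (y % p ^ n) _ _ ⟩
          y / p ^ n * p ^ n ∸ x / p ^ n * p ^ n                        ≡⟨ ℕ.*-distribʳ-∸ (p ^ n) (y / p ^ n) (x / p ^ n) ⟨
          (y / p ^ n ∸ x / p ^ n) * p ^ n                              ∎)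
          where open ≡.≡-Reasoning

        split : ℓ ^ toℕ j ∸ ℓ ^ toℕ i ≡ (ℓ ^ (toℕ j ∸ toℕ i) ∸ 1) * ℓ ^ toℕ i
        split = begin
          ℓ ^ toℕ j ∸ ℓ ^ toℕ i                                   ≡⟨ cong (λ k → ℓ ^ k ∸ ℓ ^ toℕ i) (≡.sym (ℕ.m∸n+n≡m (ℕ.<⇒≤ i<j))) ⟩
          ℓ ^ (toℕ j ∸ toℕ i + toℕ i) ∸ ℓ ^ toℕ i                 ≡⟨ cong₂ _∸_ (ℕ.^-distribˡ-+-* ℓ (toℕ j ∸ toℕ i) (toℕ i)) (≡.sym (ℕ.*-identityˡ (ℓ ^ toℕ i))) ⟩
          ℓ ^ (toℕ j ∸ toℕ i) * ℓ ^ toℕ i ∸ 1 * ℓ ^ toℕ i         ≡⟨ ℕ.*-distribʳ-∸ (ℓ ^ toℕ i) (ℓ ^ (toℕ j ∸ toℕ i)) 1 ⟨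
          (ℓ ^ (toℕ j ∸ toℕ i) ∸ 1) * ℓ ^ toℕ i                   ∎
          where open ≡.≡-Reasoning

      -- Starting from a power of ℓ that is 1 modulo p² gives a level of at least 2, where
      -- `lift-exponent` begins to apply.
      firstLevel : ∃[ m ] (2 ≤ m × ∃[ k ] ExactlyAt m (ℓ ^ k))
      firstLevel with period 2
      ... | k@(suc k-1) , _ , d with valuation (ℓ ^ k ∸ 1) {{ℕ.>-nonZero (ℕ.m<n⇒0<n∸m (ℕ.<-≤-trans 1<ℓ (ℕ.m≤m*n ℓ (ℓ ^ k-1) {{ℕ.m^n≢0 ℓ k-1 {{ℕ.>-nonZero (ℕ.<⇒≤ 1<ℓ)}}}})))}}
      ... | m , u , p∤u , e = m ,
        p^-cancel-≤ 2 m (p^∣-coprime 2 (p ^ m) u p∤u (subst (p ^ 2 ∣_) (≡.trans e (ℕ.*-comm u _)) d)) ,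
        k , u , p∤u , ≡.trans (≡.sym (ℕ.m+[n∸m]≡n (ℕ.m^n>0 ℓ {{ℕ.>-nonZero (ℕ.<⇒≤ 1<ℓ)}} k))) (cong suc e)

      n₀ : ℕ
      n₀ = proj₁ firstLevel

      -- Iterated p-th powers. The power of ℓ found here generates the kernel, of order p, of
      -- reduction from units modulo p^(i+1+n₀) to units modulo p^(i+n₀).
      exactPower : ∀ i → ∃[ k ] ExactlyAt (i + n₀) (ℓ ^ k)
      exactPower zero = proj₂ (proj₂ firstLevel)
      exactPower (suc i) = let k , h = exactPower i in
        k * p , subst (ExactlyAt (suc i + n₀)) (ℕ.^-*-assoc ℓ k p)
          (lift-exponent (i + n₀) (ℓ ^ k) (ℕ.≤-trans (proj₁ (proj₂ firstLevel)) (ℕ.m≤n+m n₀ i)) h)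

  module _ {ℓ : ℕ} (ℓ-prime : Prime ℓ) where

    bézout : ∀ b → ¬ (ℓ ∣ ℤ.∣ b ∣) → ∃[ x ] ∃[ y ] x ℤ.* b ℤ.+ y ℤ.* + ℓ ≡ ℤ.1ℤ
    bézout (+ n) ℓ∤n with coprime-Bézout coprime
      where
      coprime : Coprime ℓ n
      coprime (c∣ℓ , c∣n) with prime⇒irreducible ℓ-prime c∣ℓ
      ... | inj₁ c≡1    = c≡1
      ... | inj₂ ≡.refl = contradiction c∣n ℓ∤n
    ... | Bézout.+- x y eq = ℤ.- (+ y) , + x ,
      ≡.trans (cong (λ w → ℤ.- (+ y) ℤ.* + n ℤ.+ w) (≡.trans (≡.sym (ℤ.pos-* x ℓ)) (≡.trans (cong +_ (≡.sym eq)) (cong (λ w → + 1 ℤ.+ w) (ℤ.pos-* y n)))))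
              (alg (+ y) (+ n))
      where
      alg : ∀ y n → ℤ.- y ℤ.* n ℤ.+ (ℤ.1ℤ ℤ.+ y ℤ.* n) ≡ ℤ.1ℤ
      alg = solve-∀
    ... | Bézout.-+ x y eq = + y , ℤ.- (+ x) ,
      ≡.trans (cong (λ w → w ℤ.+ ℤ.- (+ x) ℤ.* + ℓ) (≡.trans (≡.sym (ℤ.pos-* y n)) (≡.trans (cong +_ (≡.sym eq)) (cong (λ w → + 1 ℤ.+ w) (ℤ.pos-* x ℓ)))))
              (alg (+ x) (+ ℓ))
      where
      alg : ∀ x l → ℤ.1ℤ ℤ.+ x ℤ.* l ℤ.+ ℤ.- x ℤ.* l ≡ ℤ.1ℤ
      alg = solve-∀
    bézout -[1+ n ] ℓ∤ =
      let x , y , e = bézout (+ suc n) ℓ∤ in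
      ℤ.- x , y , ≡.trans (cong (λ w → w ℤ.+ y ℤ.* + ℓ) (alg x (+ suc n))) e
      where
      alg : ∀ x n → ℤ.- x ℤ.* (ℤ.- n) ≡ x ℤ.* n
      alg = solve-∀

open Arithmetic

-- Lower bounds for the valuation

<⇒≱ℚ : ∀ {x y} → x ℚ.< y → ¬ (y ℚ.≤ x)
<⇒≱ℚ x<y y≤x = ℚ.<-irrefl ≡.refl (ℚ.<-≤-trans x<y y≤x)

0≤1 : 0ℚ ℚ.≤ 1ℚ
0≤1 = ℚ.*≤* (ℤ.+≤+ ℕ.z≤n)

0<1 : 0ℚ ℚ.< 1ℚ
0<1 = ℚ.*<* (ℤ.+<+ (ℕ.s≤s ℕ.z≤n))

-- ⟪_⟫ is ℕ→ℚ, kept from unfolding to a normalised fraction during unification.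

abstract
  ⟪_⟫ : ℕ → ℚ
  ⟪_⟫ = ℕ→ℚ

  ⟪⟫≡ℕ→ℚ : ∀ n → ⟪ n ⟫ ≡ ℕ→ℚ n
  ⟪⟫≡ℕ→ℚ n = ≡.refl

  ⟪0⟫ : ⟪ 0 ⟫ ≡ 0ℚ
  ⟪0⟫ = ≡.refl

  ⟪1⟫ : ⟪ 1 ⟫ ≡ 1ℚ
  ⟪1⟫ = ≡.refl

  ⟪⟫-+ : ∀ m n → ⟪ m ℕ.+ n ⟫ ≡ ⟪ m ⟫ ℚ.+ ⟪ n ⟫
  ⟪⟫-+ m n = ℚ.toℚᵘ-injective (begin
    ℚ.toℚᵘ (ℕ→ℚ (m ℕ.+ n))                ≈⟨ ℚ.toℚᵘ-fromℚᵘ (ℚᵘ.mkℚᵘ (+ (m ℕ.+ n)) 0) ⟩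
    ℚᵘ.mkℚᵘ (+ (m ℕ.+ n)) 0               ≈⟨ ℚᵘ.*≡* (≡.cong₂ (λ x y → (x ℤ.+ y) ℤ.* ℤ.1ℤ) (≡.sym (ℤ.*-identityʳ (+ m))) (≡.sym (ℤ.*-identityʳ (+ n)))) ⟩
    ℚᵘ.mkℚᵘ (+ m) 0 ℚᵘ.+ ℚᵘ.mkℚᵘ (+ n) 0  ≈⟨ ℚᵘ.+-cong (ℚ.toℚᵘ-fromℚᵘ (ℚᵘ.mkℚᵘ (+ m) 0)) (ℚ.toℚᵘ-fromℚᵘ (ℚᵘ.mkℚᵘ (+ n) 0)) ⟨
    ℚ.toℚᵘ (ℕ→ℚ m) ℚᵘ.+ ℚ.toℚᵘ (ℕ→ℚ n)    ≈⟨ ℚ.toℚᵘ-homo-+ (ℕ→ℚ m) (ℕ→ℚ n) ⟨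
    ℚ.toℚᵘ (ℕ→ℚ m ℚ.+ ℕ→ℚ n)              ∎)
    where open ℚᵘ.≃-Reasoning

  ℕ-above : ∀ q → ∃[ n ] q ℚ.≤ ⟪ n ⟫
  ℕ-above q@(ℚ.mkℚ n d _) = ℤ.∣ n ∣ , ℚ.toℚᵘ-cancel-≤ (begin
    ℚ.toℚᵘ q                        ≤⟨ ℚᵘ.*≤* (bound n) ⟩
    ℚᵘ.mkℚᵘ (+ ℤ.∣ n ∣) 0           ≃⟨ ℚ.toℚᵘ-fromℚᵘ (ℚᵘ.mkℚᵘ (+ ℤ.∣ n ∣) 0) ⟨
    ℚ.toℚᵘ (ℕ→ℚ ℤ.∣ n ∣)            ∎)
    where
    open ℚᵘ.≤-Reasoning
    bound : ∀ n → n ℤ.* ℤ.1ℤ ℤ.≤ + ℤ.∣ n ∣ ℤ.* + suc d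
    bound (+ n)    = subst₂ ℤ._≤_ (≡.sym (ℤ.*-identityʳ (+ n))) (ℤ.pos-* n (suc d)) (ℤ.+≤+ (ℕ.m≤m*n n (suc d)))
    bound -[1+ n ] = subst₂ ℤ._≤_ (≡.sym (ℤ.*-identityʳ -[1+ n ])) (ℤ.pos-* (suc n) (suc d)) ℤ.-≤+

⟪⟫-suc : ∀ n → ⟪ suc n ⟫ ≡ 1ℚ ℚ.+ ⟪ n ⟫
⟪⟫-suc n = ≡.trans (⟪⟫-+ 1 n) (cong (ℚ._+ ⟪ n ⟫) ⟪1⟫)

⟪⟫-* : ∀ m n → ⟪ m ℕ.* n ⟫ ≡ ⟪ m ⟫ ℚ.* ⟪ n ⟫
⟪⟫-* zero    n = ≡.trans ⟪0⟫ (≡.trans (≡.sym (ℚ.*-zeroˡ ⟪ n ⟫)) (cong (ℚ._* ⟪ n ⟫) (≡.sym ⟪0⟫)))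
⟪⟫-* (suc m) n = ≡.trans (⟪⟫-+ n (m ℕ.* n)) (≡.trans
  (cong₂ ℚ._+_ (≡.sym (ℚ.*-identityˡ ⟪ n ⟫)) (⟪⟫-* m n))
  (≡.trans (≡.sym (ℚ.*-distribʳ-+ ⟪ n ⟫ 1ℚ ⟪ m ⟫)) (cong (ℚ._* ⟪ n ⟫) (≡.sym (⟪⟫-suc m)))))

⟪⟫-≤suc : ∀ n → ⟪ n ⟫ ℚ.≤ ⟪ suc n ⟫
⟪⟫-≤suc n = subst₂ ℚ._≤_ (ℚ.+-identityˡ ⟪ n ⟫) (≡.sym (⟪⟫-suc n)) (ℚ.+-monoˡ-≤ ⟪ n ⟫ 0≤1)

⟪⟫-mono : ∀ {m n} → m ℕ.≤ n → ⟪ m ⟫ ℚ.≤ ⟪ n ⟫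
⟪⟫-mono {m} m≤n with ℕ.≤⇒≤′ m≤n
... | ℕ.≤′-refl = ℚ.≤-refl
... | ℕ.≤′-step h = ℚ.≤-trans (⟪⟫-mono (ℕ.≤′⇒≤ h)) (⟪⟫-≤suc _)

0≤⟪⟫ : ∀ n → 0ℚ ℚ.≤ ⟪ n ⟫
0≤⟪⟫ n = subst (ℚ._≤ ⟪ n ⟫) ⟪0⟫ (⟪⟫-mono {0} {n} ℕ.z≤n)

module FieldLemmas {a r s : Level} (em : ExcludedMiddle (a ⊔ r ⊔ s)) (K : HeytingField a r s) where
  open CommutativeRing (fieldRing K)
  open import Relation.Binary.Reasoning.Setoid setoid
  open import Algebra.Properties.Ring ring using (-0#≈0#)
  private module K = HeytingField K

  dec : ∀ {i} {P : Set i} → Dec (Lift (a ⊔ r ⊔ s) P) → Dec P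
  dec = map′ lower lift

  _≈?_ : ∀ x y → Dec (x ≈ y)
  x ≈? y = map′ lower lift (em {Lift (a ⊔ s) (x ≈ y)})

  -- Tightness turns z ≉ 0 into apartness from 0 only up to double negation. Since x ≈ y is decided
  -- first, this suffices for using an inverse of z.
  *-cancelʳ-≉0 : ∀ {x y z} → z ≉ 0# → x * z ≈ y * z → x ≈ y
  *-cancelʳ-≉0 {x} {y} {z} z≉0 e with x ≈? y
  ... | yes x≈y = x≈y
  ... | no  x≉y = contradiction (proj₁ (K.tight z 0#) (λ z#0 → x≉y (go (K.#⇒invertible z#0)))) z≉0
    where
    go : (∃[ w ] (w * (z - 0#) ≈ 1# × (z - 0#) * w ≈ 1#)) → x ≈ y
    go (w , _ , e′) = begin
      x                   ≈⟨ *-identityʳ x ⟨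
      x * 1#              ≈⟨ *-congˡ e″ ⟨
      x * (z * w)         ≈⟨ *-assoc _ _ _ ⟨
      x * z * w           ≈⟨ *-congʳ e ⟩
      y * z * w           ≈⟨ *-assoc _ _ _ ⟩
      y * (z * w)         ≈⟨ *-congˡ e″ ⟩
      y * 1#              ≈⟨ *-identityʳ y ⟩
      y                   ∎
      where
      e″ : z * w ≈ 1#
      e″ = trans (*-congʳ (trans (sym (+-identityʳ z)) (+-congˡ (sym -0#≈0#)))) e′

  *-≉0 : ∀ {x y} → x ≉ 0# → y ≉ 0# → x * y ≉ 0#
  *-≉0 x≉0 y≉0 e = x≉0 (*-cancelʳ-≉0 y≉0 (trans e (sym (zeroˡ _))))

  *-≉0ˡ : ∀ {x y} → x * y ≉ 0# → x ≉ 0#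
  *-≉0ˡ xy≉0 e = xy≉0 (trans (*-congʳ e) (zeroˡ _))

  *-≉0ʳ : ∀ {x y} → x * y ≉ 0# → y ≉ 0#
  *-≉0ʳ xy≉0 e = xy≉0 (trans (*-congˡ e) (zeroʳ _))

module Valued {a r s : Level} (em : ExcludedMiddle (a ⊔ r ⊔ s))
  (ℓ : ℕ) (ℓ-prime : Prime ℓ) (K : HeytingField a r s)
  (closure : Closure.IsAlgebraicClosure ℓ ℓ-prime K)
  (v : Closure.Valuation ℓ ℓ-prime K closure) where

  open CommutativeRing (fieldRing K)
  open import Algebra.Properties.Semiring.Exp semiring using (_^_)
  open import Algebra.Properties.Ring ring using (-1*x≈-x)
  open FieldLemmas em K
  open Closure ℓ ℓ-prime K
  open IsAlgebraicClosure closure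
  open Valuation v
  private
    module P = Padic ℓ ℓ-prime
    module L = Localization P.ℤₚ-ring (P.ℤ→ℤₚ (+ ℓ)) P.ℤₚ-cancel
    module ι = IsRingMonomorphism ι-isRingMonomorphism

  int : ℤ → Carrier
  int = ℤ→K

  private
    ℤₚ≡⇒≈ : ∀ {x y} → (∀ n → P.seq x n ≡ P.seq y n) → x P.≈ᶻ y
    ℤₚ≡⇒≈ {x} {y} e = P.mk≈ λ n → ℤ∣.divides ℤ.0ℤ (≡.trans (cong (ℤ._- P.seq y n) (e n)) (ℤ.+-inverseʳ (P.seq y n)))

  int-+ : ∀ b c → int (b ℤ.+ c) ≈ int b + int c
  int-+ b c = trans (ι.⟦⟧-cong (L.cross (ℤₚ≡⇒≈ λ n → alg b c))) (ι.+-homo _ _)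
    where
    alg : ∀ b c → (b ℤ.+ c) ℤ.* ℤ.1ℤ ≡ (b ℤ.* ℤ.1ℤ ℤ.+ c ℤ.* ℤ.1ℤ) ℤ.* ℤ.1ℤ
    alg b c = cong (ℤ._* ℤ.1ℤ) (cong₂ ℤ._+_ (≡.sym (ℤ.*-identityʳ b)) (≡.sym (ℤ.*-identityʳ c)))

  int-* : ∀ b c → int (b ℤ.* c) ≈ int b * int c
  int-* b c = trans (ι.⟦⟧-cong (L.cross (ℤₚ≡⇒≈ λ n → ≡.refl))) (ι.*-homo _ _)

  int-0 : int ℤ.0ℤ ≈ 0#
  int-0 = ι.0#-homo

  int-1 : int ℤ.1ℤ ≈ 1#
  int-1 = ι.1#-homo

  int-neg : ∀ b → int (ℤ.- b) ≈ - int b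
  int-neg b = trans (ι.⟦⟧-cong (L.cross (ℤₚ≡⇒≈ λ n → ≡.refl))) (ι.-‿homo _)

  int-^ : ∀ b n → int (b ^ℤ n) ≈ int b ^ n
  int-^ b zero    = int-1
  int-^ b (suc n) = trans (int-* b _) (*-congˡ (int-^ b n))

  n<ℓ^n : ∀ n → n ℕ.< ℓ ℕ.^ n
  n<ℓ^n zero = ℕ.s≤s ℕ.z≤n
  n<ℓ^n (suc n) = ℕ.<-≤-trans (ℕ.s≤s (n<ℓ^n n)) (subst (suc (ℓ ℕ.^ n) ℕ.≤_) (ℕ.*-comm (ℓ ℕ.^ n) ℓ)
    (ℕ.m<m*n (ℓ ℕ.^ n) ℓ {{P.p^-nonZero n}} (1<prime ℓ-prime)))

  -- Vanishing in the ℓ-adic integers means that ℓⁿ divides b for every n. The choice n = |b| is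
  -- decisive, as |b| < ℓ^|b|.
  int-injective : ∀ b → int b ≈ 0# → b ≡ ℤ.0ℤ
  int-injective b e = ℤ.∣i∣≡0⇒i≡0 (small ℤ.∣ b ∣
    (subst (λ c → ℓ ℕ.^ ℤ.∣ b ∣ ℕ∣.∣ ℤ.∣ c ∣) simp
      (ℤ∣.∣⇒∣ᵤ (P.cong-mod (L.cross-eq (ι.injective (trans e (sym int-0)))) ℤ.∣ b ∣))))
    where
    simp : b ℤ.* ℤ.1ℤ ℤ.- ℤ.0ℤ ℤ.* ℤ.1ℤ ≡ b
    simp = ≡.trans (ℤ.+-identityʳ _) (ℤ.*-identityʳ b)

    small : ∀ n → ℓ ℕ.^ n ℕ∣.∣ n → n ≡ 0
    small zero    _ = ≡.refl
    small (suc n) d = contradiction (ℕ∣.∣⇒≤ d) (ℕ.<⇒≱ (n<ℓ^n (suc n)))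

  int≉0 : ∀ {b} → b ≢ ℤ.0ℤ → int b ≉ 0#
  int≉0 b≢0 e = b≢0 (int-injective _ e)

  nat : ℕ → Carrier
  nat n = int (+ n)

  nat≉0 : ∀ n → .{{NonZero n}} → nat n ≉ 0#
  nat≉0 (suc n) = int≉0 λ ()

  1≉0 : 1# ≉ 0#
  1≉0 e = nat≉0 1 (trans int-1 e)

  ord-1 : ord 1# 1≉0 ≡ 0ℚ
  ord-1 = ℚ-+-cancelˡ (ord 1# 1≉0) _ _ (≡.trans (≡.sym (ord-* 1≉0 1≉0 (*-≉0 1≉0 1≉0)))
    (≡.trans (ord-cong _ _ (*-identityˡ 1#)) (≡.sym (ℚ.+-identityʳ _))))

  -- "The valuation of x is at least q", where 0 has valuation ∞.
  _≼_ : ℚ → Carrier → Set r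
  q ≼ x = ∀ (x≉0 : x ≉ 0#) → q ℚ.≤ ord x x≉0
  infix 4 _≼_

  ≼-cong : ∀ {q x y} → x ≈ y → q ≼ x → q ≼ y
  ≼-cong x≈y h y≉0 = subst (_ ℚ.≤_) (ord-cong (λ e → y≉0 (trans (sym x≈y) e)) y≉0 x≈y) (h _)

  ≼-mono : ∀ {q q′ x} → q ℚ.≤ q′ → q′ ≼ x → q ≼ x
  ≼-mono q≤q′ h x≉0 = ℚ.≤-trans q≤q′ (h x≉0)

  ≼-≡ : ∀ {q q′ x} → q ≡ q′ → q ≼ x → q′ ≼ x
  ≼-≡ e h x≉0 = subst (ℚ._≤ ord _ x≉0) e (h x≉0)

  ≼-0 : ∀ {q x} → x ≈ 0# → q ≼ x
  ≼-0 e x≉0 = contradiction e x≉0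

  ≼-+ : ∀ {q x y} → q ≼ x → q ≼ y → q ≼ x + y
  ≼-+ {q} {x} {y} hx hy s≉0 with x ≈? 0# | y ≈? 0#
  ... | yes x≈0 | _       = ≼-cong (sym (trans (+-congʳ x≈0) (+-identityˡ y))) hy s≉0
  ... | no  x≉0 | yes y≈0 = ≼-cong (sym (trans (+-congˡ y≈0) (+-identityʳ x))) hx s≉0
  ... | no  x≉0 | no  y≉0 = ℚ.≤-trans (ℚ.⊓-glb (hx x≉0) (hy y≉0)) (ord-+ x≉0 y≉0 s≉0)

  ≼-* : ∀ {q q′ x y} → q ≼ x → q′ ≼ y → q ℚ.+ q′ ≼ x * y
  ≼-* hx hy xy≉0 = subst (_ ℚ.≤_) (≡.sym (ord-* (*-≉0ˡ xy≉0) (*-≉0ʳ xy≉0) xy≉0))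
    (ℚ.+-mono-≤ (hx (*-≉0ˡ xy≉0)) (hy (*-≉0ʳ xy≉0)))

  ≼-*ˡ : ∀ {q x y} → 0ℚ ≼ x → q ≼ y → q ≼ x * y
  ≼-*ˡ {q} hx hy = ≼-≡ (ℚ.+-identityˡ q) (≼-* hx hy)

  ≼-int : ∀ b → 0ℚ ≼ int b
  ≼-int b b≉0 = ord-ℤₗ (P.ℤ→ℤₚ b) b≉0

  ≼-1 : 0ℚ ≼ 1#
  ≼-1 = ≼-cong int-1 (≼-int ℤ.1ℤ)

  1-valuation : ∀ {q} → q ≼ 1# → q ℚ.≤ 0ℚ
  1-valuation h = subst (_ ℚ.≤_) ord-1 (h 1≉0)

  ≼-neg : ∀ {q x} → q ≼ x → q ≼ - x
  ≼-neg {q} {x} h = ≼-cong (trans (*-congʳ (trans (int-neg ℤ.1ℤ) (-‿cong int-1))) (-1*x≈-x x))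
    (≼-*ˡ (≼-int (ℤ.- ℤ.1ℤ)) h)

  ≼-^ : ∀ {x} n → 0ℚ ≼ x → 0ℚ ≼ x ^ n
  ≼-^ zero    h = ≼-1
  ≼-^ (suc n) h = ≼-*ˡ h (≼-^ n h)

  ≼-ℓ : 1ℚ ≼ nat ℓ
  ≼-ℓ ℓ≉0 = ℚ.≤-reflexive (≡.sym (ord-ℓ ℓ≉0))

  ℓ≉0 : nat ℓ ≉ 0#
  ℓ≉0 = nat≉0 ℓ {{prime⇒nonZero ℓ-prime}}

  ≼-ℓ-cancel : ∀ {q x} → 1ℚ ℚ.+ q ≼ nat ℓ * x → q ≼ x
  ≼-ℓ-cancel {q} {x} h x≉0 = ℚ.≤-trans (ℚ.≤-reflexive (≡.sym (c q))) (ℚ.≤-trans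
    (ℚ.+-monoʳ-≤ (ℚ.- 1ℚ) (subst (1ℚ ℚ.+ q ℚ.≤_) (≡.trans (ord-* ℓ≉0 x≉0 ℓx≉0) (cong (ℚ._+ ord x x≉0) (ord-ℓ ℓ≉0))) (h ℓx≉0)))
    (ℚ.≤-reflexive (c _)))
    where
    ℓx≉0 : nat ℓ * x ≉ 0#
    ℓx≉0 = *-≉0 ℓ≉0 x≉0

    c : ∀ q → ℚ.- 1ℚ ℚ.+ (1ℚ ℚ.+ q) ≡ q
    c q = ≡.trans (≡.sym (ℚ.+-assoc (ℚ.- 1ℚ) 1ℚ q)) (ℚ.+-identityˡ q)

  -- In a Bézout relation x b + y ℓ = 1, a positive lower bound q for ord b would give the positive
  -- lower bound min(q, 1) for ord 1 = 0.
  ℓ-unit : ∀ b → ¬ (ℓ ℕ∣.∣ ℤ.∣ b ∣) → ∀ {q} → q ≼ int b → q ℚ.≤ 0ℚ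
  ℓ-unit b ℓ∤b {q} h with q ℚ.≤? 0ℚ
  ... | yes q≤0 = q≤0
  ... | no  q≰0 =
    let x , y , e = bézout ℓ-prime b ℓ∤b
        m : ℚ
        m = q ℚ.⊓ 1ℚ
        one : int x * int b + int y * nat ℓ ≈ 1#
        one = trans (sym (trans (int-+ _ _) (+-cong (int-* x b) (int-* y (+ ℓ))))) (trans (reflexive (cong int e)) int-1)
        m≤0 = 1-valuation (≼-cong one (≼-+ (≼-*ˡ (≼-int x) (≼-mono (ℚ.p⊓q≤p q 1ℚ) h))
                                            (≼-*ˡ (≼-int y) (≼-mono (ℚ.p⊓q≤q q 1ℚ) ≼-ℓ))))
    in contradiction m≤0 (<⇒≱ℚ (<-⊓ (ℚ.≰⇒> q≰0) 0<1))
    where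
    <-⊓ : ∀ {x y z} → x ℚ.< y → x ℚ.< z → x ℚ.< y ℚ.⊓ z
    <-⊓ {x} {y} {z} x<y x<z with ℚ.⊓-sel y z
    ... | inj₁ e = subst (x ℚ.<_) (≡.sym e) x<y
    ... | inj₂ e = subst (x ℚ.<_) (≡.sym e) x<z

  ord-ℓ-unit : ∀ b → ¬ (ℓ ℕ∣.∣ ℤ.∣ b ∣) → ∀ b≉0 → ord (int b) b≉0 ≡ 0ℚ
  ord-ℓ-unit b ℓ∤b b≉0 = ℚ.≤-antisym
    (ℓ-unit b ℓ∤b (λ b≉0′ → ℚ.≤-reflexive (ord-cong b≉0 b≉0′ refl))) (≼-int b b≉0)

  -- Serves to remove the factor p that averaging over p conjugates produces.
  ≼-unit-cancel : ∀ b → ¬ (ℓ ℕ∣.∣ ℤ.∣ b ∣) → ∀ {q x} → q ≼ int b * x → q ≼ x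
  ≼-unit-cancel b ℓ∤b {q} {x} h x≉0 with int b ≈? 0#
  ... | yes b≈0 = contradiction (subst (λ c → ℓ ℕ∣.∣ ℤ.∣ c ∣) (≡.sym (int-injective b b≈0)) (ℓ ℕ∣.∣0)) ℓ∤b
  ... | no  b≉0 = subst (q ℚ.≤_) (≡.trans (ord-* b≉0 x≉0 (*-≉0 b≉0 x≉0))
        (≡.trans (cong (ℚ._+ ord x x≉0) (ord-ℓ-unit b ℓ∤b b≉0)) (ℚ.+-identityˡ _))) (h _)

  unit-power⇒≉0 : ∀ {x} n → .{{NonZero n}} → x ^ n ≈ 1# → x ≉ 0#
  unit-power⇒≉0 (suc n) e x≈0 = 1≉0 (trans (sym e) (trans (*-congʳ x≈0) (zeroˡ _)))

  -- A negative valuation of x would stay negative in all positive powers, whereas ord 1 = 0.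
  root-of-unity-integral : ∀ {x} n → .{{NonZero n}} → x ^ n ≈ 1# → 0ℚ ≼ x
  root-of-unity-integral {x} (suc n) e x≉0 with 0ℚ ℚ.≤? ord x x≉0
  ... | yes h = h
  ... | no  h = contradiction (ℚ.≤-reflexive (≡.trans (≡.sym ord-1) (ord-cong 1≉0 x^≉0 (sym e)))) (<⇒≱ℚ (negative n x^≉0))
    where
    x^≉0 : x ^ suc n ≉ 0#
    x^≉0 e′ = 1≉0 (trans (sym e) e′)

    negative : ∀ n (nz : x ^ suc n ≉ 0#) → ord (x ^ suc n) nz ℚ.< 0ℚ
    negative zero    nz = subst (ℚ._< 0ℚ) (ord-cong x≉0 nz (sym (*-identityʳ x))) (ℚ.≰⇒> h)
    negative (suc n) nz = subst₂ ℚ._<_ (≡.sym (ord-* x≉0 (*-≉0ʳ nz) nz)) (ℚ.+-identityˡ 0ℚ)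
      (ℚ.+-mono-< (ℚ.≰⇒> h) (negative n (*-≉0ʳ nz)))

-- Roots of unity

module Roots {a r s : Level} (em : ExcludedMiddle (a ⊔ r ⊔ s)) (K : HeytingField a r s) where
  open CommutativeRing (fieldRing K)
  open import Relation.Binary.Reasoning.Setoid setoid
  open import Algebra.Properties.Semiring.Exp semiring using (_^_; ^-congˡ; ^-congʳ; ^-assocʳ)
  open import Algebra.Properties.Semiring.Sum semiring using (sum; *-distribˡ-sum)
  open import Algebra.Properties.Semiring.Mult semiring using () renaming (_×_ to _·_)
  open import Algebra.Properties.CommutativeMonoid.Mult *-commutativeMonoid using () renaming (×-distrib-+ to ^-distrib-*)
  open FieldLemmas em K

  1^ : ∀ n → 1# ^ n ≈ 1#
  1^ zero    = refl
  1^ (suc n) = trans (*-identityˡ _) (1^ n)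

  ^-* : ∀ {x} m k → x ^ m ≈ 1# → x ^ (m ℕ.* k) ≈ 1#
  ^-* {x} m k e = trans (sym (^-assocʳ x m k)) (trans (^-congˡ k e) (1^ k))

  ^-*′ : ∀ {x} k m → x ^ m ≈ 1# → x ^ (k ℕ.* m) ≈ 1#
  ^-*′ {x} k m e = trans (^-congʳ x (ℕ.*-comm k m)) (^-* m k e)

  ^-∣ : ∀ {x m n} → m ℕ∣.∣ n → x ^ m ≈ 1# → x ^ n ≈ 1#
  ^-∣ {m = m} (ℕ∣.divides q ≡.refl) e = ^-*′ q m e

  ^-swap : ∀ x m n → (x ^ m) ^ n ≈ (x ^ n) ^ m
  ^-swap x m n = trans (^-assocʳ x m n) (trans (^-congʳ x (ℕ.*-comm m n)) (sym (^-assocʳ x n m)))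

  ^-root : ∀ {x} n k → x ^ n ≈ 1# → (x ^ k) ^ n ≈ 1#
  ^-root {x} n k e = trans (^-swap x k n) (trans (^-congˡ k e) (1^ k))

  *-root : ∀ {x y} n → x ^ n ≈ 1# → y ^ n ≈ 1# → (x * y) ^ n ≈ 1#
  *-root {x} {y} n e e′ = trans (^-distrib-* x y n) (trans (*-cong e e′) (*-identityˡ 1#))

  ^-period : ∀ {x} N c → x ^ N ≈ 1# → x ^ (1 ℕ.+ N ℕ.* c) ≈ x
  ^-period {x} N c e = trans (*-congˡ (^-* N c e)) (*-identityʳ x)

  geometric : ℕ → Carrier → Carrier
  geometric n y = sum {n} (λ i → y ^ toℕ i)

  geometric-suc : ∀ n y → geometric (suc n) y ≈ 1# + y * geometric n y
  geometric-suc n y = +-congˡ (sym (*-distribˡ-sum y (λ (i : Fin n) → y ^ toℕ i)))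

  geometric-suc′ : ∀ n y → geometric (suc n) y ≈ geometric n y + y ^ n
  geometric-suc′ zero    y = trans (+-identityʳ 1#) (sym (+-identityˡ 1#))
  geometric-suc′ (suc n) y = begin
    geometric (suc (suc n)) y               ≈⟨ geometric-suc (suc n) y ⟩
    1# + y * geometric (suc n) y            ≈⟨ +-congˡ (*-congˡ (geometric-suc′ n y)) ⟩
    1# + y * (geometric n y + y ^ n)        ≈⟨ +-congˡ (distribˡ _ _ _) ⟩
    1# + (y * geometric n y + y ^ suc n)    ≈⟨ +-assoc _ _ _ ⟨
    1# + y * geometric n y + y ^ suc n      ≈⟨ +-congʳ (geometric-suc n y) ⟨
    geometric (suc n) y + y ^ suc n         ∎

  -- Multiplication by y permutes the summands cyclically, so the sum g satisfies y g = g.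
  geometric≈0 : ∀ n {y} → y ^ n ≈ 1# → y ≉ 1# → geometric n y ≈ 0#
  geometric≈0 n {y} e y≉1 with geometric n y ≈? 0#
  ... | yes g≈0 = g≈0
  ... | no  g≉0 = contradiction (*-cancelʳ-≉0 g≉0 (trans y*g≈g (sym (*-identityˡ _)))) y≉1
    where
    open import Algebra.Properties.Ring ring using (+-cancelˡ)
    y*g≈g : y * geometric n y ≈ geometric n y
    y*g≈g = +-cancelˡ 1# _ _ (begin
      1# + y * geometric n y   ≈⟨ geometric-suc n y ⟨
      geometric (suc n) y      ≈⟨ geometric-suc′ n y ⟩
      geometric n y + y ^ n    ≈⟨ +-congˡ e ⟩
      geometric n y + 1#       ≈⟨ +-comm _ _ ⟩
      1# + geometric n y       ∎)

  geometric-1 : ∀ n {y} → y ≈ 1# → geometric n y ≈ n · 1#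
  geometric-1 zero    e = refl
  geometric-1 (suc n) {y} e = trans (geometric-suc n y)
    (+-congˡ (trans (*-cong e (geometric-1 n e)) (*-identityˡ _)))

  coprime-roots : ∀ {x} p u → Prime p → p ℕ∣.∤ u → x ^ p ≈ 1# → x ^ u ≈ 1# → x ≈ 1#
  coprime-roots {x} p u p-prime p∤u e e′ with coprime-Bézout coprime
    where
    coprime : Coprime p u
    coprime (c∣p , c∣u) with prime⇒irreducible p-prime c∣p
    ... | inj₁ c≡1    = c≡1
    ... | inj₂ ≡.refl = contradiction c∣u p∤u
  ... | Bézout.+- m n eq = trans (sym (trans (*-congˡ (^-*′ n u e′)) (*-identityʳ x))) (trans (^-congʳ x eq) (^-*′ m p e))
  ... | Bézout.-+ m n eq = trans (sym (trans (*-congˡ (^-*′ m p e)) (*-identityʳ x))) (trans (^-congʳ x eq) (^-*′ n u e′))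

-- Conjugation by ζ ↦ ζ^ℓ preserves lower bounds for the valuation

module Galois {a r s : Level} (em : ExcludedMiddle (a ⊔ r ⊔ s))
  (ℓ : ℕ) (ℓ-prime : Prime ℓ) (K : HeytingField a r s)
  (closure : Closure.IsAlgebraicClosure ℓ ℓ-prime K)
  (v : Closure.Valuation ℓ ℓ-prime K closure) where

  open CommutativeRing (fieldRing K)
  open import Relation.Binary.Reasoning.Setoid setoid
  open import Algebra.Properties.Semiring.Exp semiring using (_^_; ^-congˡ; ^-congʳ; ^-assocʳ)
  open import Algebra.Properties.CommutativeMonoid.Mult *-commutativeMonoid using () renaming (×-distrib-+ to ^-distrib-*)
  open import Algebra.Properties.Ring ring using (-1*x≈-x; xyx⁻¹≈y)
  open import Algebra.Solver.Ring.NaturalCoefficients.Default commutativeSemiring using (solve; _:+_; _:*_; _:=_)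
  open FieldLemmas em K
  open Valued em ℓ ℓ-prime K closure v
  open Roots em K
  open Closure ℓ ℓ-prime K
  open Valuation v

  -- An expression stands for the function sending j to its value after raising every root of unity to
  -- the j-th power; the conjugation ζ ↦ ζ^ℓ then is the substitution j ↦ ℓ j.

  module Expressions (N : ℕ) .{{N≢0 : NonZero N}} where

    infixl 6 _⊞_
    infixl 7 _⊠_
    infix  5 _at_

    data Expr : Set (a ⊔ r) where
      const : ℤ → Expr
      root  : ∀ ζ → ζ ^ N ≈ 1# → Expr
      _⊞_ _⊠_ : Expr → Expr → Expr

    _at_ : Expr → ℕ → Carrier
    const b  at j = int b
    root ζ _ at j = ζ ^ j
    (e ⊞ f)  at j = (e at j) + (f at j)
    (e ⊠ f)  at j = (e at j) * (f at j)

    -- Expressions count as equal when they define the same function of j, so the ring laws are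
    -- pulled back from functions ℕ → K. An equation in this ring holds for all conjugates
    -- simultaneously.
    exprRing : CommutativeRing (a ⊔ r) r
    exprRing = record
      { Carrier = Expr
      ; _≈_ = λ e f → ∀ j → (e at j) ≈ (f at j)
      ; _+_ = _⊞_
      ; _*_ = _⊠_
      ; -_  = const (ℤ.- ℤ.1ℤ) ⊠_
      ; 0#  = const ℤ.0ℤ
      ; 1#  = const ℤ.1ℤ
      ; isCommutativeRing = RingMonomorphism.isCommutativeRing isRingMonomorphism
          (CommutativeRing.isCommutativeRing functions)
      }
      where
      functions : CommutativeRing a r
      functions = Pointwise.commutativeRing ℕ (fieldRing K)

      isRingMonomorphism : IsRingMonomorphism _ (CommutativeRing.rawRing functions) _at_
      isRingMonomorphism = record
        { isRingHomomorphism = record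
          { isSemiringHomomorphism = record
            { isNearSemiringHomomorphism = record
              { +-isMonoidHomomorphism = record
                { isMagmaHomomorphism = record
                  { isRelHomomorphism = record { cong = λ h → h }
                  ; homo = λ e f j → refl
                  }
                ; ε-homo = λ j → int-0
                }
              ; *-homo = λ e f j → refl
              }
            ; 1#-homo = λ j → int-1
            }
          ; -‿homo = λ e j → trans (*-congʳ (trans (int-neg ℤ.1ℤ) (-‿cong int-1))) (-1*x≈-x (e at j))
          }
        ; injective = λ h → h
        }

    private
      module E = CommutativeRing exprRing
    open import Algebra.Properties.Semiring.Exp E.semiring using () renaming (_^_ to _^ᴱ_)
    open import Algebra.Properties.Semiring.Mult E.semiring using () renaming (_×_ to _·ᴱ_)
    open FreshmansDream ℓ-prime E.commutativeSemiring using (freshmansDream)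

    ^ᴱ-at : ∀ e n j → (e ^ᴱ n at j) ≈ (e at j) ^ n
    ^ᴱ-at e zero    j = int-1
    ^ᴱ-at e (suc n) j = *-congˡ (^ᴱ-at e n j)

    ·ᴱ-at : ∀ n e j → (n ·ᴱ e at j) ≈ nat n * (e at j)
    ·ᴱ-at zero    e j = trans int-0 (sym (trans (*-congʳ int-0) (zeroˡ _)))
    ·ᴱ-at (suc n) e j = begin
      (e at j) + (n ·ᴱ e at j)              ≈⟨ +-cong (sym (*-identityˡ _)) (·ᴱ-at n e j) ⟩
      1# * (e at j) + nat n * (e at j)      ≈⟨ distribʳ _ _ _ ⟨
      (1# + nat n) * (e at j)               ≈⟨ *-congʳ (trans (int-+ ℤ.1ℤ (+ n)) (+-congʳ int-1)) ⟨
      nat (suc n) * (e at j)                ∎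

    integral : ∀ e j → 0ℚ ≼ (e at j)
    integral (const b)  j = ≼-int b
    integral (root ζ h) j = ≼-^ j (root-of-unity-integral N h)
    integral (e ⊞ f)    j = ≼-+ (integral e j) (integral f j)
    integral (e ⊠ f)    j = ≼-*ˡ (integral e j) (integral f j)

    -- Makes the substitution j ↦ k j an operation on expressions; without it the remainders below,
    -- which involve conjugated values, would not be expressions.
    scale : ℕ → Expr → Expr
    scale k (const b)  = const b
    scale k (root ζ h) = root (ζ ^ k) (^-root N k h)
    scale k (e ⊞ f)    = scale k e ⊞ scale k f
    scale k (e ⊠ f)    = scale k e ⊠ scale k f

    scale-at : ∀ k e j → (scale k e at j) ≈ (e at (k ℕ.* j))
    scale-at k (const b)  j = refl
    scale-at k (root ζ h) j = ^-assocʳ ζ k j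
    scale-at k (e ⊞ f)    j = +-cong (scale-at k e j) (scale-at k f j)
    scale-at k (e ⊠ f)    j = *-cong (scale-at k e j) (scale-at k f j)

    periodic : ∀ e c j → (e at ((1 ℕ.+ N ℕ.* c) ℕ.* j)) ≈ (e at j)
    periodic (const b)  c j = refl
    periodic (root ζ h) c j = trans (sym (^-assocʳ ζ (1 ℕ.+ N ℕ.* c) j)) (^-congˡ j (^-period N c h))
    periodic (e ⊞ f)    c j = +-cong (periodic e c j) (periodic f c j)
    periodic (e ⊠ f)    c j = *-cong (periodic e c j) (periodic f c j)

    -- Constants are handled by Fermat, roots of unity are exact, sums need the freshman's dream. It
    -- matters that a single remainder h serves all j: h can then be conjugated in its turn.
    frobenius : ∀ e → ∃[ h ] (∀ j → (e at j) ^ ℓ ≈ (e at (ℓ ℕ.* j)) + nat ℓ * (h at j))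
    frobenius (const b) = let h , eq = fermat ℓ-prime b in const h , λ j → begin
      int b ^ ℓ                      ≈⟨ int-^ b ℓ ⟨
      int (b ^ℤ ℓ)                    ≈⟨ reflexive (cong int eq) ⟩
      int (b ℤ.+ + ℓ ℤ.* h)          ≈⟨ trans (int-+ _ _) (+-congˡ (int-* _ _)) ⟩
      int b + nat ℓ * int h          ∎
    frobenius (root ζ _) = const ℤ.0ℤ , λ j → begin
      (ζ ^ j) ^ ℓ                    ≈⟨ trans (^-assocʳ ζ j ℓ) (^-congʳ ζ (ℕ.*-comm j ℓ)) ⟩
      ζ ^ (ℓ ℕ.* j)                  ≈⟨ +-identityʳ _ ⟨
      ζ ^ (ℓ ℕ.* j) + 0#             ≈⟨ +-congˡ (trans (*-congˡ int-0) (zeroʳ _)) ⟨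
      ζ ^ (ℓ ℕ.* j) + nat ℓ * int ℤ.0ℤ ∎
    frobenius (e ⊞ f) =
      let h , eq = frobenius e
          h′ , eq′ = frobenius f
          z , dream = freshmansDream e f
      in h ⊞ h′ ⊞ z , λ j → begin
        ((e at j) + (f at j)) ^ ℓ
          ≈⟨ ^ᴱ-at (e ⊞ f) ℓ j ⟨
        ((e ⊞ f) ^ᴱ ℓ at j)
          ≈⟨ dream j ⟩
        (e ^ᴱ ℓ at j) + (f ^ᴱ ℓ at j) + (ℓ ·ᴱ z at j)
          ≈⟨ +-cong (+-cong (trans (^ᴱ-at e ℓ j) (eq j)) (trans (^ᴱ-at f ℓ j) (eq′ j))) (·ᴱ-at ℓ z j) ⟩
        (e at (ℓ ℕ.* j)) + nat ℓ * (h at j) + ((f at (ℓ ℕ.* j)) + nat ℓ * (h′ at j)) + nat ℓ * (z at j)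
          ≈⟨ solve 6 (λ E F l x y z → E :+ l :* x :+ (F :+ l :* y) :+ l :* z := E :+ F :+ l :* (x :+ y :+ z)) refl _ _ _ _ _ _ ⟩
        (e at (ℓ ℕ.* j)) + (f at (ℓ ℕ.* j)) + nat ℓ * ((h at j) + (h′ at j) + (z at j)) ∎
    frobenius (e ⊠ f) =
      let h , eq = frobenius e
          h′ , eq′ = frobenius f
      in scale ℓ e ⊠ h′ ⊞ h ⊠ scale ℓ f ⊞ const (+ ℓ) ⊠ (h ⊠ h′) , λ j → begin
        ((e at j) * (f at j)) ^ ℓ
          ≈⟨ ^-distrib-* _ _ ℓ ⟩
        (e at j) ^ ℓ * (f at j) ^ ℓ
          ≈⟨ *-cong (eq j) (eq′ j) ⟩
        ((e at (ℓ ℕ.* j)) + nat ℓ * (h at j)) * ((f at (ℓ ℕ.* j)) + nat ℓ * (h′ at j))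
          ≈⟨ solve 5 (λ E F l x y → (E :+ l :* x) :* (F :+ l :* y) := E :* F :+ l :* (E :* y :+ x :* F :+ l :* (x :* y))) refl _ _ _ _ _ ⟩
        (e at (ℓ ℕ.* j)) * (f at (ℓ ℕ.* j)) + nat ℓ * ((e at (ℓ ℕ.* j)) * (h′ at j) + (h at j) * (f at (ℓ ℕ.* j)) + nat ℓ * ((h at j) * (h′ at j)))
          ≈⟨ +-congˡ (*-congˡ (+-congʳ (+-cong (*-congʳ (scale-at ℓ e j)) (*-congˡ (scale-at ℓ f j))))) ⟨
        (e at (ℓ ℕ.* j)) * (f at (ℓ ℕ.* j)) + nat ℓ * ((scale ℓ e at j) * (h′ at j) + (h at j) * (scale ℓ f at j) + nat ℓ * ((h at j) * (h′ at j))) ∎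

    frobenius^ : ∀ t e → ∃[ h ] (∀ j → (e at j) ^ (ℓ ℕ.^ t) ≈ (e at ((ℓ ℕ.^ t) ℕ.* j)) + nat ℓ * (h at j))
    frobenius^ zero e = const ℤ.0ℤ , λ j → begin
      (e at j) * 1#                        ≈⟨ *-identityʳ _ ⟩
      (e at j)                             ≈⟨ reflexive (cong (e at_) (≡.sym (ℕ.*-identityˡ j))) ⟩
      (e at (1 ℕ.* j))                     ≈⟨ +-identityʳ _ ⟨
      (e at (1 ℕ.* j)) + 0#                ≈⟨ +-congˡ (trans (*-congˡ int-0) (zeroʳ _)) ⟨
      (e at (1 ℕ.* j)) + nat ℓ * int ℤ.0ℤ  ∎
    frobenius^ (suc t) e =
      let h , eq = frobenius^ t (e ^ᴱ ℓ)
          h′ , eq′ = frobenius e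
          q = ℓ ℕ.^ t
      in scale q h′ ⊞ h , λ j → begin
        (e at j) ^ (ℓ ℕ.* q)
          ≈⟨ ^-assocʳ _ ℓ q ⟨
        ((e at j) ^ ℓ) ^ q
          ≈⟨ ^-congˡ q (^ᴱ-at e ℓ j) ⟨
        (e ^ᴱ ℓ at j) ^ q
          ≈⟨ eq j ⟩
        (e ^ᴱ ℓ at (q ℕ.* j)) + nat ℓ * (h at j)
          ≈⟨ +-congʳ (trans (^ᴱ-at e ℓ (q ℕ.* j)) (eq′ (q ℕ.* j))) ⟩
        (e at (ℓ ℕ.* (q ℕ.* j))) + nat ℓ * (h′ at (q ℕ.* j)) + nat ℓ * (h at j)
          ≈⟨ +-congʳ (+-cong (reflexive (cong (e at_) (≡.sym (ℕ.*-assoc ℓ q j)))) (*-congˡ (sym (scale-at q h′ j)))) ⟩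
        (e at (ℓ ℕ.* q ℕ.* j)) + nat ℓ * (scale q h′ at j) + nat ℓ * (h at j)
          ≈⟨ solve 4 (λ E l x y → E :+ l :* x :+ l :* y := E :+ l :* (x :+ y)) refl _ _ _ _ ⟩
        (e at (ℓ ℕ.* q ℕ.* j)) + nat ℓ * ((scale q h′ at j) + (h at j)) ∎

    private
      isolate : ∀ {x y z} → x ≈ y + z → z ≈ x - y
      isolate {x} {y} {z} e = trans (sym (xyx⁻¹≈y y z)) (+-congʳ (sym e))

      isolateˡ : ∀ {x y z} → x ≈ y + z → y ≈ x - z
      isolateˡ e = isolate (trans e (+-comm _ _))

    module _ (t c : ℕ) (ℓ^t≡ : ℓ ℕ.^ suc t ≡ 1 ℕ.+ N ℕ.* c) where

      private
        M-2 : ℕ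
        M-2 = ℓ ℕ.^ suc t ℕ.∸ 2

        M≡ : ℓ ℕ.^ suc t ≡ 2 ℕ.+ M-2
        M≡ = ≡.sym (ℕ.m+[n∸m]≡n (ℕ.≤-trans (1<prime ℓ-prime)
          (ℕ.m≤m*n ℓ (ℓ ℕ.^ t) {{ℕ.m^n≢0 ℓ t {{prime⇒nonZero ℓ-prime}}}})))

      -- The exponent ℓ^(t+1) is 1 modulo N and fixes all N-th roots of unity, so this power of e is
      -- congruent to e itself and not to another conjugate.
      frobenius-fixed : ∀ e → ∃[ g ] (∀ j → (e at j) ^ (2 ℕ.+ M-2) ≈ (e at j) + nat ℓ * (g at j))
      frobenius-fixed e = let g , eq = frobenius^ (suc t) e in g , λ j →
        trans (^-congʳ (e at j) (≡.sym M≡)) (trans (eq j) (+-congʳ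
          (trans (reflexive (cong (λ k → e at (k ℕ.* j)) ℓ^t≡)) (periodic e c j))))

      -- Two factors carry a bound and the others are merely integral, which is why the exponent M =
      -- ℓ^(t+1) is written as 2 + `M-2`.
      ≼-power : ∀ {q q′ x} → 0ℚ ≼ x → q ≼ x → q′ ≼ x → q ℚ.+ q′ ≼ x ^ (2 ℕ.+ M-2)
      ≼-power {q} {q′} {x} h hq hq′ = ≼-* hq (≼-≡ (ℚ.+-identityʳ q′) (≼-* hq′ (≼-^ M-2 h)))

      -- Write x^M = x + ℓ g. If ord x ≥ k + 1, then ord g ≥ k, and by induction the conjugate of g
      -- has the same bound. The identity also holds at the conjugate x′ of x and leads back from g
      -- to x′, provided that ord x′ ≥ 1; this start comes from x^ℓ ≡ x′ modulo ℓ.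
      galois : ∀ k e j → ⟪ k ⟫ ≼ (e at j) → ⟪ k ⟫ ≼ (e at (ℓ ℕ.* j))
      galois zero    e j _ = ≼-≡ (≡.sym ⟪0⟫) (integral e (ℓ ℕ.* j))
      galois (suc k) e j h = climb (suc k) ℕ.≤-refl
        where
        g = proj₁ (frobenius-fixed e)
        eq = proj₂ (frobenius-fixed e)
        f = proj₁ (frobenius e)
        eqf = proj₂ (frobenius e)

        1≼ : ∀ {x} → ⟪ suc k ⟫ ≼ x → 1ℚ ≼ x
        1≼ = ≼-mono (subst (ℚ._≤ ⟪ suc k ⟫) ⟪1⟫ (⟪⟫-mono (ℕ.s≤s ℕ.z≤n)))

        ℓg : 1ℚ ℚ.+ ⟪ k ⟫ ≼ nat ℓ * (g at j)
        ℓg = ≼-≡ (⟪⟫-suc k) (≼-cong (sym (isolate (eq j)))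
          (≼-+ (≼-≡ (ℚ.+-identityʳ _) (≼-power (integral e j) h (integral e j))) (≼-neg h)))

        ℓg′ : ⟪ suc k ⟫ ≼ nat ℓ * (g at (ℓ ℕ.* j))
        ℓg′ = ≼-≡ (≡.sym (⟪⟫-suc k)) (≼-* ≼-ℓ (galois k g j (≼-ℓ-cancel ℓg)))

        1≼x^ℓ : 1ℚ ≼ (e at j) ^ ℓ
        1≼x^ℓ = ≼-cong (^-congʳ (e at j) (ℕ.suc-pred ℓ {{prime⇒nonZero ℓ-prime}}))
          (≼-≡ (ℚ.+-identityʳ 1ℚ) (≼-* (1≼ h) (≼-^ (ℕ.pred ℓ) (integral e j))))

        1≼x′ : 1ℚ ≼ (e at (ℓ ℕ.* j))
        1≼x′ = ≼-cong (sym (isolateˡ (eqf j))) (≼-+ 1≼x^ℓ (≼-neg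
          (≼-≡ (ℚ.+-identityʳ 1ℚ) (≼-* ≼-ℓ (integral f j)))))

        -- x′ = x′^M - ℓ g(x′) with M ≥ 2 and ord x′ ≥ 1: a lower bound i on the valuation of x′ improves
        -- to i + 1, as long as it stays below that of ℓ g(x′).
        climb : ∀ i → i ℕ.≤ suc k → ⟪ i ⟫ ≼ (e at (ℓ ℕ.* j))
        climb zero    _ = ≼-≡ (≡.sym ⟪0⟫) (integral e (ℓ ℕ.* j))
        climb (suc i) i<k = ≼-cong (sym (isolateˡ (eq (ℓ ℕ.* j)))) (≼-+
          (≼-≡ (≡.sym (⟪⟫-suc i)) (≼-power (integral e (ℓ ℕ.* j)) 1≼x′ (climb i (ℕ.<⇒≤ i<k))))
          (≼-neg (≼-mono (⟪⟫-mono i<k) ℓg′)))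

      galois^ : ∀ k e i → ⟪ k ⟫ ≼ (e at 1) → ⟪ k ⟫ ≼ (e at (ℓ ℕ.^ i))
      galois^ k e zero    h = h
      galois^ k e (suc i) h = galois k e (ℓ ℕ.^ i) (galois^ k e i h)

      -- For q = ord x the identity x = x^M - ℓ g with M ≥ 2 gives q ≥ min(2q, 1), which fails for 0
      -- < q < 1.
      gap : ∀ e j → ¬ (1ℚ ≼ (e at j)) → ∀ x≉0 → ord (e at j) x≉0 ≡ 0ℚ
      gap e j ¬1≼x x≉0 = ℚ.≤-antisym (ℚ.≮⇒≥ λ 0<q → case 0<q) (integral e j x≉0)
        where
        g = proj₁ (frobenius-fixed e)
        eq = proj₂ (frobenius-fixed e)
        q = ord (e at j) x≉0

        q≼x : q ≼ (e at j)
        q≼x x≉0′ = ℚ.≤-reflexive (ord-cong x≉0 x≉0′ refl)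

        q<1 : q ℚ.< 1ℚ
        q<1 = ℚ.≰⇒> λ 1≤q → ¬1≼x (≼-mono 1≤q q≼x)

        case : ¬ (0ℚ ℚ.< q)
        case 0<q = <⇒≱ℚ q<q+q⊓1 (≼-cong (sym (isolateˡ (eq j))) (≼-+
            (≼-mono (ℚ.p⊓q≤p (q ℚ.+ q) 1ℚ) (≼-power (integral e j) q≼x q≼x))
            (≼-neg (≼-mono (ℚ.p⊓q≤q (q ℚ.+ q) 1ℚ) (≼-≡ (ℚ.+-identityʳ 1ℚ) (≼-* ≼-ℓ (integral g j)))))) x≉0)
          where
          q<q+q : q ℚ.< q ℚ.+ q
          q<q+q = subst (ℚ._< q ℚ.+ q) (ℚ.+-identityʳ q) (ℚ.+-monoʳ-< q 0<q)

          q<q+q⊓1 : q ℚ.< (q ℚ.+ q) ℚ.⊓ 1ℚ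
          q<q+q⊓1 with ℚ.⊓-sel (q ℚ.+ q) 1ℚ
          ... | inj₁ e = subst (q ℚ.<_) (≡.sym e) q<q+q
          ... | inj₂ e = subst (q ℚ.<_) (≡.sym e) q<1

-- Primitive p-power roots of unity

module Cyclotomic {a r s : Level} (em : ExcludedMiddle (a ⊔ r ⊔ s))
  (p ℓ : ℕ) (p-prime : Prime p) (ℓ-prime : Prime ℓ) (K : HeytingField a r s)
  (closure : Closure.IsAlgebraicClosure ℓ ℓ-prime K)
  (v : Closure.Valuation ℓ ℓ-prime K closure) where

  open CommutativeRing (fieldRing K)
  open import Relation.Binary.Reasoning.Setoid setoid
  open import Algebra.Properties.Semiring.Exp semiring using (_^_; ^-congˡ; ^-congʳ; ^-homo-*; ^-assocʳ)
  open import Algebra.Properties.CommutativeMonoid.Mult *-commutativeMonoid using () renaming (×-distrib-+ to ^-distrib-*)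
  open import Algebra.Properties.Semiring.Sum semiring using (sum; sum-cong-≋; *-distribˡ-sum; sum-replicate-zero; ∑-comm)
  open import Algebra.Properties.Semiring.Mult semiring using () renaming (_×_ to _·_)
  open import Algebra.Properties.Ring ring using (x∙y⁻¹≈ε⇒x≈y)
  open FieldLemmas em K
  open Valued em ℓ ℓ-prime K closure v
  open Roots em K
  open Closure ℓ ℓ-prime K
  open IsAlgebraicClosure closure

  private instance
    p≢0 : NonZero p
    p≢0 = prime⇒nonZero p-prime

  nat≈· : ∀ n → nat n ≈ n · 1#
  nat≈· zero    = int-0
  nat≈· (suc n) = trans (int-+ ℤ.1ℤ (+ n)) (+-cong int-1 (nat≈· n))

  ·1≉0 : ∀ n → .{{NonZero n}} → n · 1# ≉ 0#
  ·1≉0 n e = nat≉0 n (trans (nat≈· n) e)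

  IsPrimitive : ℕ → Carrier → Set r
  IsPrimitive N z = z ^ N ≈ 1# × (∀ k → z ^ k ≈ 1# → N ℕ∣.∣ k)

  sum-zero : ∀ {n} (f : Fin n → Carrier) → (∀ i → f i ≈ 0#) → sum f ≈ 0#
  sum-zero {n} f h = trans (sum-cong-≋ h) (sum-replicate-zero n)

  module _ {N : ℕ} .{{_ : NonZero N}} {z : Carrier} (prim : IsPrimitive N z) where

    private
      z≉0 : z ≉ 0#
      z≉0 = unit-power⇒≉0 N (proj₁ prim)

      ^≉0 : ∀ k → z ^ k ≉ 0#
      ^≉0 zero    = 1≉0
      ^≉0 (suc k) = *-≉0 z≉0 (^≉0 k)

    primitive-≡ : ∀ {i j} → i ℕ.≤ j → z ^ i ≈ z ^ j → N ℕ∣.∣ j ℕ.∸ i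
    primitive-≡ {i} {j} i≤j e = proj₂ prim _ (sym (*-cancelʳ-≉0 (^≉0 i) (begin
      1# * z ^ i                 ≈⟨ *-identityˡ _ ⟩
      z ^ i                      ≈⟨ e ⟩
      z ^ j                      ≈⟨ ^-congʳ z (ℕ.m∸n+n≡m i≤j) ⟨
      z ^ (j ℕ.∸ i ℕ.+ i)        ≈⟨ ^-homo-* z (j ℕ.∸ i) i ⟩
      z ^ (j ℕ.∸ i) * z ^ i      ∎)))

    private
      w : Carrier
      w = z ^ ℕ.pred N

      z*w≈1 : z * w ≈ 1#
      z*w≈1 = trans (^-congʳ z (ℕ.suc-pred N)) (proj₁ prim)

      z^*w^≈1 : ∀ k → z ^ k * w ^ k ≈ 1#
      z^*w^≈1 k = trans (sym (^-distrib-* z w k)) (trans (^-congˡ k z*w≈1) (1^ k))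

      w^N≈1 : w ^ N ≈ 1#
      w^N≈1 = ^-root N (ℕ.pred N) (proj₁ prim)

      w^k≉1 : ∀ k → 0 ℕ.< k → k ℕ.< N → w ^ k ≉ 1#
      w^k≉1 k 0<k k<N e = ℕ.<⇒≱ k<N (ℕ∣.∣⇒≤ {{ℕ.>-nonZero 0<k}} (proj₂ prim k
        (trans (sym (*-identityʳ _)) (trans (*-congˡ (sym e)) (z^*w^≈1 k)))))

    -- If x were none of the zⁱ, every geometric sum of x z⁻ⁱ would vanish; but these sums add up to N.
    primitive-generates : ∀ x → x ^ N ≈ 1# → ∃[ i ] x ≈ z ^ toℕ {N} i
    primitive-generates x x^N≈1 with Fin.any? (λ i → x ≈? (z ^ toℕ {N} i))
    ... | yes h = h
    ... | no  h = contradiction (trans (sym (trans swapped (onlyFirst N ℕ.≤-refl))) vanishing) (·1≉0 N)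
      where
      y : Fin N → Carrier
      y i = x * w ^ toℕ i

      y≉1 : ∀ i → y i ≉ 1#
      y≉1 i e = h (i , (begin
        x                              ≈⟨ *-identityʳ x ⟨
        x * 1#                         ≈⟨ *-congˡ (trans (*-comm _ _) (z^*w^≈1 (toℕ i))) ⟨
        x * (w ^ toℕ i * z ^ toℕ i)    ≈⟨ *-assoc _ _ _ ⟨
        y i * z ^ toℕ i                ≈⟨ *-congʳ e ⟩
        1# * z ^ toℕ i                 ≈⟨ *-identityˡ _ ⟩
        z ^ toℕ i                      ∎))

      vanishing : sum (λ i → geometric N (y i)) ≈ 0#
      vanishing = sum-zero _ λ i → geometric≈0 N
        (*-root N x^N≈1 (^-root N (toℕ i) w^N≈1)) (y≉1 i)

      swapped : sum (λ i → geometric N (y i)) ≈ sum {N} (λ k → x ^ toℕ k * geometric N (w ^ toℕ k))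
      swapped = begin
        sum {N} (λ i → sum {N} (λ k → y i ^ toℕ k))
          ≈⟨ sum-cong-≋ (λ (i : Fin N) → sum-cong-≋ (λ (k : Fin N) → trans (^-distrib-* x _ (toℕ k)) (*-congˡ (^-swap w (toℕ i) (toℕ k))))) ⟩
        sum {N} (λ i → sum {N} (λ k → x ^ toℕ k * (w ^ toℕ k) ^ toℕ i))
          ≈⟨ ∑-comm {N} {N} (λ i k → x ^ toℕ k * (w ^ toℕ k) ^ toℕ i) ⟩
        sum {N} (λ k → sum {N} (λ i → x ^ toℕ k * (w ^ toℕ k) ^ toℕ i))
          ≈⟨ sum-cong-≋ (λ (k : Fin N) → *-distribˡ-sum (x ^ toℕ k) (λ (i : Fin N) → (w ^ toℕ k) ^ toℕ i)) ⟨
        sum {N} (λ k → x ^ toℕ k * geometric N (w ^ toℕ k)) ∎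

      onlyFirst : ∀ M → M ℕ.≤ N → .{{NonZero M}} → sum {M} (λ k → x ^ toℕ k * geometric N (w ^ toℕ k)) ≈ N · 1#
      onlyFirst (suc M) M<N = begin
        1# * geometric N 1# + sum {M} (λ k → x ^ suc (toℕ k) * geometric N (w ^ suc (toℕ k)))
          ≈⟨ +-cong (trans (*-identityˡ _) (geometric-1 N refl)) (sum-zero {M} _ λ k →
               trans (*-congˡ (geometric≈0 N (^-root N (suc (toℕ k)) w^N≈1)
                 (w^k≉1 (suc (toℕ k)) (ℕ.s≤s ℕ.z≤n) (ℕ.≤-trans (ℕ.s≤s (Fin.toℕ<n k)) M<N)))) (zeroʳ _)) ⟩
        N · 1# + 0#
          ≈⟨ +-identityʳ _ ⟩
        N · 1# ∎

  evalPoly-ones : ∀ n x → evalPoly (fieldRing K) (replicate n 1#) x ≈ geometric n x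
  evalPoly-ones zero    x = refl
  evalPoly-ones (suc n) x = trans (+-congˡ (*-congˡ (evalPoly-ones n x))) (sym (geometric-suc n x))

  evalPoly-monomial : ∀ n x → evalPoly (fieldRing K) (replicate n 0# ++ 1# ∷ []) x ≈ x ^ n
  evalPoly-monomial zero    x = trans (+-congˡ (zeroʳ x)) (+-identityʳ 1#)
  evalPoly-monomial (suc n) x = trans (+-identityˡ _) (*-congˡ (evalPoly-monomial n x))

  -- A root z of 1 + X + ... + X^(p-1) satisfies z^p = 1, and z = 1 would make p vanish in K.
  primitive-p : ∃[ z ] IsPrimitive p z
  primitive-p = go p ≡.refl
    where
    go : ∀ n → n ≡ p → ∃[ z ] IsPrimitive p z
    go zero          e = contradiction (subst (1 ℕ.<_) (≡.sym e) (1<prime p-prime)) λ ()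
    go (suc zero)    e = contradiction (subst (1 ℕ.<_) (≡.sym e) (1<prime p-prime)) λ { (ℕ.s≤s ()) }
    go (suc (suc n)) e with algebraicallyClosed 1# (replicate (suc n) 1#) (Any.here 1≉0)
    ... | z , root = z , z^p≈1 , λ k z^k≈1 → divides k z^k≈1
      where
      g≈0 : geometric p z ≈ 0#
      g≈0 = trans (reflexive (cong (λ n → geometric n z) (≡.sym e))) (trans (sym (evalPoly-ones (suc (suc n)) z)) root)

      z^p≈1 : z ^ p ≈ 1#
      z^p≈1 = begin
        z ^ p                   ≈⟨ +-identityˡ _ ⟨
        0# + z ^ p              ≈⟨ +-congʳ g≈0 ⟨
        geometric p z + z ^ p   ≈⟨ geometric-suc′ p z ⟨
        geometric (suc p) z     ≈⟨ geometric-suc p z ⟩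
        1# + z * geometric p z  ≈⟨ +-congˡ (trans (*-congˡ g≈0) (zeroʳ z)) ⟩
        1# + 0#                 ≈⟨ +-identityʳ 1# ⟩
        1#                      ∎

      z≉1 : z ≉ 1#
      z≉1 z≈1 = ·1≉0 p (trans (sym (geometric-1 p z≈1)) g≈0)

      divides : ∀ k → z ^ k ≈ 1# → p ℕ∣.∣ k
      divides k z^k≈1 with p ℕ∣.∣? k
      ... | yes p∣k = p∣k
      ... | no  p∤k = contradiction (coprime-roots p k p-prime p∤k z^p≈1 z^k≈1) z≉1

  -- Any root y of X^p - z will do. From y^k = 1 follows z^k = 1, hence p divides k because the
  -- order of z is a positive power of p; then z^(k/p) = y^k = 1 as well.
  primitive-suc : ∀ n {z} → IsPrimitive (p ℕ.^ suc n) z → ∃[ y ] IsPrimitive (p ℕ.^ suc (suc n)) y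
  primitive-suc n {z} (z^≈1 , prim) with algebraicallyClosed (- z) (replicate (ℕ.pred p) 0# ++ 1# ∷ [])
                                     (Any.++⁺ʳ (replicate (ℕ.pred p) 0#) (Any.here 1≉0))
  ... | y , root = y , trans (sym (^-assocʳ y p (p ℕ.^ suc n))) (trans (^-congˡ (p ℕ.^ suc n) y^p≈z) z^≈1) , divides
    where
    y^p≈z : y ^ p ≈ z
    y^p≈z = x∙y⁻¹≈ε⇒x≈y _ _ (trans (+-comm _ _) (trans (+-congˡ (trans (^-congʳ y (≡.sym (ℕ.suc-pred p))) (*-congˡ (sym (evalPoly-monomial (ℕ.pred p) y))))) root))

    divides : ∀ k → y ^ k ≈ 1# → p ℕ.^ suc (suc n) ℕ∣.∣ k
    divides k y^k≈1 with prim k (trans (^-congˡ k (sym y^p≈z)) (^-root k p y^k≈1))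
    ... | ℕ∣.divides q ≡.refl = go (q ℕ.* p ℕ.^ n) (alg q p (p ℕ.^ n)) y^k≈1
      where
      alg : ∀ q p P → q ℕ.* (p ℕ.* P) ≡ p ℕ.* (q ℕ.* P)
      alg = ℕ-solve-∀

      go : ∀ k′ {k} → k ≡ p ℕ.* k′ → y ^ k ≈ 1# → p ℕ.^ suc (suc n) ℕ∣.∣ k
      go k′ ≡.refl e = ℕ∣.*-monoʳ-∣ p (prim k′ (trans (^-congˡ k′ (sym y^p≈z)) (trans (^-assocʳ y p k′) e)))

  primitiveRoot : ∀ n → ∃[ z ] IsPrimitive (p ℕ.^ n) z
  primitiveRoot zero = 1# , *-identityˡ 1# , λ k _ → ℕ∣.1∣ k
  primitiveRoot (suc zero) with primitive-p
  ... | z , h = z , subst (λ q → IsPrimitive q z) (≡.sym (ℕ.*-identityʳ p)) h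
  primitiveRoot (suc (suc n)) = primitive-suc n (proj₂ (primitiveRoot (suc n)))

-- Coset sums

maximum : ∀ {n} → (Fin n → ℕ) → ℕ
maximum {zero}  f = 0
maximum {suc n} f = f Fin.zero ℕ.⊔ maximum (λ i → f (Fin.suc i))

≤-maximum : ∀ {n} (f : Fin n → ℕ) i → f i ℕ.≤ maximum f
≤-maximum f Fin.zero    = ℕ.m≤m⊔n _ _
≤-maximum f (Fin.suc i) = ℕ.≤-trans (≤-maximum (λ i → f (Fin.suc i)) i) (ℕ.m≤n⊔m (f Fin.zero) _)

module RootSums {a r s : Level} (em : ExcludedMiddle (a ⊔ r ⊔ s))
  (p ℓ : ℕ) (p-prime : Prime p) (ℓ-prime : Prime ℓ) (p≢ℓ : p ≢ ℓ) (K : HeytingField a r s)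
  (closure : Closure.IsAlgebraicClosure ℓ ℓ-prime K)
  (v : Closure.Valuation ℓ ℓ-prime K closure) where

  open CommutativeRing (fieldRing K)
  open import Relation.Binary.Reasoning.Setoid setoid
  open import Algebra.Properties.Semiring.Exp semiring using (_^_; ^-congˡ; ^-congʳ; ^-assocʳ)
  open import Algebra.Properties.CommutativeMonoid.Mult *-commutativeMonoid using () renaming (×-distrib-+ to ^-distrib-*)
  open import Algebra.Properties.Semiring.Sum semiring using (sum; sum-cong-≋; *-distribˡ-sum; ∑-distrib-+)
  open import Algebra.Solver.Ring.NaturalCoefficients.Default commutativeSemiring using (solve; _:+_; _:*_; _:=_)
  open FieldLemmas em K
  open Valued em ℓ ℓ-prime K closure v
  open Roots em K
  open Galois em ℓ ℓ-prime K closure v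
  open Cyclotomic em p ℓ p-prime ℓ-prime K closure v
  open Closure ℓ ℓ-prime K
  open Valuation v

  private instance
    p≢0 : NonZero p
    p≢0 = prime⇒nonZero p-prime

  prime∤prime : ∀ {p q} → Prime p → Prime q → p ≢ q → p ℕ∣.∤ q
  prime∤prime p-prime q-prime p≢q p∣q with prime⇒irreducible q-prime p∣q
  ... | inj₁ p≡1 = ℕ.<⇒≢ (1<prime p-prime) (≡.sym p≡1)
  ... | inj₂ p≡q = p≢q p≡q

  abstract
    p∤ℓ : p ℕ∣.∤ ℓ
    p∤ℓ = prime∤prime p-prime ℓ-prime p≢ℓ

  ℓ∤p : ℓ ℕ∣.∤ p
  ℓ∤p = prime∤prime ℓ-prime p-prime (λ e → p≢ℓ (≡.sym e))

  open PowersNearOne p-prime ℓ p∤ℓ (1<prime ℓ-prime) using (n₀; firstLevel; exactPower)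

  -- Every element of 1 + W ℤ_p is a p-adic limit of powers of ℓ.
  W : ℕ
  W = p ℕ.^ n₀

  N : ℕ → ℕ
  N i = p ℕ.^ (i ℕ.+ n₀)

  N≢0 : ∀ i → NonZero (N i)
  N≢0 i = p^≢0 p-prime (i ℕ.+ n₀)

  Terms : Set a
  Terms = List (ℤ × Carrier)

  total : Terms → Carrier
  total []            = 0#
  total ((b , ζ) ∷ L) = int b * ζ + total L

  addIf : ∀ {P : Set r} → Dec P → Carrier → Carrier → Carrier
  addIf (yes _) x y = x + y
  addIf (no _)  x y = y

  addIf-yes : ∀ {P : Set r} (d : Dec P) {x y} → P → addIf d x y ≈ x + y
  addIf-yes (yes _) h = refl
  addIf-yes (no ¬h) h = contradiction h ¬h

  addIf-no : ∀ {P : Set r} (d : Dec P) {x y} → ¬ P → addIf d x y ≈ y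
  addIf-no (yes h) ¬h = contradiction h ¬h
  addIf-no (no _)  ¬h = refl

  -- Only the trivial coset, the terms with ζ in μ_k, is summed; `twist` brings the other cosets
  -- into this position.
  part : ℕ → Terms → Carrier
  part k []            = 0#
  part k ((b , ζ) ∷ L) = addIf ((ζ ^ k) ≈? 1#) (int b * ζ) (part k L)

  part-all : ∀ k L → All (λ t → proj₂ t ^ k ≈ 1#) L → part k L ≈ total L
  part-all k [] [] = refl
  part-all k ((b , ζ) ∷ L) (h ∷ hs) = trans (addIf-yes ((ζ ^ k) ≈? 1#) h) (+-congˡ (part-all k L hs))

  part-none : ∀ k L → All (λ t → ¬ (proj₂ t ^ k ≈ 1#)) L → part k L ≈ 0#
  part-none k [] [] = refl
  part-none k ((b , ζ) ∷ L) (h ∷ hs) = trans (addIf-no ((ζ ^ k) ≈? 1#) h) (part-none k L hs)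

  ≼-sum : ∀ {q n} (f : Fin n → Carrier) → (∀ i → q ≼ f i) → q ≼ sum f
  ≼-sum {n = zero}  f h = ≼-0 refl
  ≼-sum {n = suc n} f h = ≼-+ (h Fin.zero) (≼-sum (λ i → f (Fin.suc i)) (λ i → h (Fin.suc i)))

  -- One step of the averaging, from μ_(pP) down to μ_P. The maps ζ ↦ ζ^(Q^k) for k < p are the
  -- automorphisms of μ_(pP) that are trivial on μ_P, so their sum is a trace.
  module Descent (i : ℕ) where

    private
      P = N i
      instance
        N≢0′ : NonZero (N (suc i))
        N≢0′ = N≢0 (suc i)

      Q-power = proj₁ (exactPower i)
      u = proj₁ (proj₂ (exactPower i))
      p∤u = proj₁ (proj₂ (proj₂ (exactPower i)))

      Q : ℕ
      Q = 1 ℕ.+ u ℕ.* P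

      Q≡ : ℓ ℕ.^ Q-power ≡ Q
      Q≡ = proj₂ (proj₂ (proj₂ (exactPower i)))

      p∣P : p ℕ∣.∣ P
      p∣P with n₀ | proj₁ (proj₂ firstLevel)
      ... | suc n | _ = subst (λ k → p ℕ∣.∣ p ℕ.^ k) (≡.sym (ℕ.+-suc i n)) (ℕ∣.m∣m*n (p ℕ.^ (i ℕ.+ n)))

    open Expressions (N (suc i))

    -- Taken from the power of ℓ at the next level. Its exponent is not 0, since ℓ⁰ - 1 = 0 does not
    -- have an exact p-adic valuation.
    fixing : ∃[ t ] ∃[ c ] ℓ ℕ.^ suc t ≡ 1 ℕ.+ N (suc i) ℕ.* c
    fixing = go (proj₁ (exactPower (suc i))) (proj₂ (exactPower (suc i)))
      where
      go : ∀ k → ExactlyAt p-prime (suc i ℕ.+ n₀) (ℓ ℕ.^ k) → ∃[ t ] ∃[ c ] ℓ ℕ.^ suc t ≡ 1 ℕ.+ N (suc i) ℕ.* c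
      go (suc t) (c , _ , e)   = t , c , ≡.trans e (cong suc (ℕ.*-comm c (N (suc i))))
      go zero    (c , p∤c , e) = contradiction (subst (p ℕ∣.∣_) (≡.sym c≡0) (p ℕ∣.∣0)) p∤c
        where
        c≡0 : c ≡ 0
        c≡0 = ℕ.m*n≡0⇒m≡0 c (N (suc i)) (≡.sym (ℕ.suc-injective e))

    select : ∀ b {ζ} → Dec (ζ ^ N (suc i) ≈ 1#) → Expr → Expr
    select b (yes h) e = const b ⊠ root _ h ⊞ e
    select b (no _)  e = e

    -- The subsum over μ_(pP) as an expression. Terms outside μ_(pP) cannot be entered as roots and
    -- are left out before conjugating.
    selected : Terms → Expr
    selected []            = const ℤ.0ℤ
    selected ((b , ζ) ∷ L) = select b ((ζ ^ N (suc i)) ≈? 1#) (selected L)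

    selected-at-1 : ∀ L → (selected L at 1) ≈ part (N (suc i)) L
    selected-at-1 []            = int-0
    selected-at-1 ((b , ζ) ∷ L) = go ((ζ ^ N (suc i)) ≈? 1#)
      where
      go : ∀ d → (select b {ζ} d (selected L) at 1) ≈ addIf d (int b * ζ) (part (N (suc i)) L)
      go (yes _) = +-cong (*-congˡ (*-identityʳ ζ)) (selected-at-1 L)
      go (no _)  = selected-at-1 L

    private
      -- This is ζ^(Q-1), the factor that ζ acquires under ζ ↦ ζ^Q. It is a p-th root of unity and
      -- is itself fixed by the Q-th power because p divides P, so repeated conjugation multiplies
      -- by it each time.
      ξ : Carrier → Carrier
      ξ ζ = ζ ^ (u ℕ.* P)

      ξ^p≈1 : ∀ {ζ} → ζ ^ N (suc i) ≈ 1# → ξ ζ ^ p ≈ 1#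
      ξ^p≈1 {ζ} h = trans (^-assocʳ ζ (u ℕ.* P) p) (trans (^-congʳ ζ (≡.trans (ℕ.*-assoc u P p) (cong (u ℕ.*_) (ℕ.*-comm P p)))) (^-*′ u (N (suc i)) h))

      conjugate : ∀ {ζ} → ζ ^ N (suc i) ≈ 1# → ∀ k → ζ ^ (Q ℕ.^ k) ≈ ζ * ξ ζ ^ k
      conjugate {ζ} h zero    = refl
      conjugate {ζ} h (suc k) = begin
        ζ ^ (Q ℕ.* Q ℕ.^ k)          ≈⟨ trans (^-congʳ ζ (ℕ.*-comm Q (Q ℕ.^ k))) (sym (^-assocʳ ζ (Q ℕ.^ k) Q)) ⟩
        (ζ ^ (Q ℕ.^ k)) ^ Q          ≈⟨ ^-congˡ Q (conjugate h k) ⟩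
        (ζ * ξ ζ ^ k) ^ Q            ≈⟨ ^-distrib-* ζ (ξ ζ ^ k) Q ⟩
        ζ ^ Q * (ξ ζ ^ k) ^ Q        ≈⟨ *-congˡ (trans (^-swap (ξ ζ) k Q) (^-congˡ k ξ^Q≈ξ)) ⟩
        ζ * ξ ζ * ξ ζ ^ k            ≈⟨ *-assoc _ _ _ ⟩
        ζ * (ξ ζ * ξ ζ ^ k)          ∎
        where
        ξ^Q≈ξ : ξ ζ ^ Q ≈ ξ ζ
        ξ^Q≈ξ = trans (*-congˡ (^-∣ (ℕ∣.∣n⇒∣m*n u p∣P) (ξ^p≈1 h))) (*-identityʳ _)

      rootSum-in : ∀ {ζ} → ζ ^ N (suc i) ≈ 1# → ζ ^ P ≈ 1# → sum {p} (λ k → ζ ^ (Q ℕ.^ toℕ k)) ≈ nat p * ζ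
      rootSum-in {ζ} h h′ = begin
        sum {p} (λ k → ζ ^ (Q ℕ.^ toℕ k))   ≈⟨ sum-cong-≋ (λ (k : Fin p) → conjugate h (toℕ k)) ⟩
        sum {p} (λ k → ζ * ξ ζ ^ toℕ k)     ≈⟨ *-distribˡ-sum ζ (λ (k : Fin p) → ξ ζ ^ toℕ k) ⟨
        ζ * geometric p (ξ ζ)               ≈⟨ *-congˡ (trans (geometric-1 p (^-*′ u P h′)) (sym (nat≈· p))) ⟩
        ζ * nat p                           ≈⟨ *-comm _ _ ⟩
        nat p * ζ                           ∎

      -- Here ζ^P is a p-th root of unity other than 1, and so is its u-th power ξ ζ because p does
      -- not divide u. The geometric sum over a full period vanishes.
      rootSum-out : ∀ {ζ} → ζ ^ N (suc i) ≈ 1# → ¬ (ζ ^ P ≈ 1#) → sum {p} (λ k → ζ ^ (Q ℕ.^ toℕ k)) ≈ 0#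
      rootSum-out {ζ} h h′ = begin
        sum {p} (λ k → ζ ^ (Q ℕ.^ toℕ k))   ≈⟨ sum-cong-≋ (λ (k : Fin p) → conjugate h (toℕ k)) ⟩
        sum {p} (λ k → ζ * ξ ζ ^ toℕ k)     ≈⟨ *-distribˡ-sum ζ (λ (k : Fin p) → ξ ζ ^ toℕ k) ⟨
        ζ * geometric p (ξ ζ)               ≈⟨ *-congˡ (geometric≈0 p (ξ^p≈1 h) ξ≉1) ⟩
        ζ * 0#                              ≈⟨ zeroʳ ζ ⟩
        0#                                  ∎
        where
        ξ≉1 : ξ ζ ≉ 1#
        ξ≉1 e = h′ (coprime-roots p u p-prime p∤u
          (trans (^-assocʳ ζ P p) (trans (^-congʳ ζ (ℕ.*-comm P p)) h))
          (trans (^-assocʳ ζ P u) (trans (^-congʳ ζ (ℕ.*-comm P u)) e)))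

      *-distrib-rootSum : ∀ b ζ → sum {p} (λ k → int b * ζ ^ (Q ℕ.^ toℕ k)) ≈ int b * sum {p} (λ k → ζ ^ (Q ℕ.^ toℕ k))
      *-distrib-rootSum b ζ = sym (*-distribˡ-sum (int b) (λ (k : Fin p) → ζ ^ (Q ℕ.^ toℕ k)))

    average : ∀ L → sum {p} (λ k → selected L at (Q ℕ.^ toℕ k)) ≈ nat p * part P L
    average [] = trans (sum-zero {p} _ (λ _ → int-0)) (sym (zeroʳ _))
    average ((b , ζ) ∷ L) = go ((ζ ^ N (suc i)) ≈? 1#) ((ζ ^ P) ≈? 1#)
      where
      cons : ∀ h {x} → sum {p} (λ k → ζ ^ (Q ℕ.^ toℕ k)) ≈ x →
             sum {p} (λ k → select b {ζ} (yes h) (selected L) at (Q ℕ.^ toℕ k)) ≈ int b * x + nat p * part P L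
      cons h {x} e = begin
        sum {p} (λ k → int b * ζ ^ (Q ℕ.^ toℕ k) + (selected L at (Q ℕ.^ toℕ k)))
          ≈⟨ ∑-distrib-+ {p} _ _ ⟩
        sum {p} (λ k → int b * ζ ^ (Q ℕ.^ toℕ k)) + sum {p} (λ k → selected L at (Q ℕ.^ toℕ k))
          ≈⟨ +-cong (trans (*-distrib-rootSum b ζ) (*-congˡ e)) (average L) ⟩
        int b * x + nat p * part P L ∎

      go : ∀ d d′ → sum {p} (λ k → select b {ζ} d (selected L) at (Q ℕ.^ toℕ k))
                    ≈ nat p * addIf {ζ ^ P ≈ 1#} d′ (int b * ζ) (part P L)
      go (yes h) (yes h′) = trans (cons h (rootSum-in h h′))
        (solve 4 (λ b n z x → b :* (n :* z) :+ n :* x := n :* (b :* z :+ x)) refl _ _ _ _)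
      go (yes h) (no h′)  = trans (cons h (rootSum-out h h′)) (trans (+-congʳ (zeroʳ _)) (+-identityˡ _))
      go (no h)  (yes h′) = contradiction (^-*′ p P h′) h
      go (no h)  (no h′)  = average L

    descent : ∀ k L → ⟪ k ⟫ ≼ part (N (suc i)) L → ⟪ k ⟫ ≼ part P L
    descent k L h = ≼-unit-cancel (+ p) ℓ∤p (≼-cong (average L) (≼-sum {n = p} _ λ j →
      ≼-cong (reflexive (cong (selected L at_) (Q^≡ (toℕ j))))
        (galois^ t c e k (selected L) (Q-power ℕ.* toℕ j) (≼-cong (sym (selected-at-1 L)) h))))
      where
      t = proj₁ fixing
      c = proj₁ (proj₂ fixing)
      e = proj₂ (proj₂ fixing)

      Q^≡ : ∀ j → ℓ ℕ.^ (Q-power ℕ.* j) ≡ Q ℕ.^ j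
      Q^≡ j = ≡.trans (≡.sym (ℕ.^-*-assoc ℓ Q-power j)) (cong (ℕ._^ j) Q≡)

  total-gap : ∀ i L → All (λ t → proj₂ t ^ N (suc i) ≈ 1#) L → ¬ (1ℚ ≼ total L) →
              ∀ L≉0 → ord (total L) L≉0 ≡ 0ℚ
  total-gap i L hs ¬1≼ L≉0 = ≡.trans (ord-cong L≉0 e≉0 (sym same)) (gap t c eq (selected L) 1 (λ h → ¬1≼ (≼-cong same h)) e≉0)
    where
    instance N≢0′ = N≢0 (suc i)
    open Descent i
    open Expressions (N (suc i))
    t = proj₁ fixing
    c = proj₁ (proj₂ fixing)
    eq = proj₂ (proj₂ fixing)

    same : (selected L at 1) ≈ total L
    same = trans (selected-at-1 L) (part-all (N (suc i)) L hs)

    e≉0 : (selected L at 1) ≉ 0#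
    e≉0 e = L≉0 (trans (sym same) e)

  total-integral : ∀ i L → All (λ t → proj₂ t ^ N i ≈ 1#) L → 0ℚ ≼ total L
  total-integral i [] [] = ≼-0 refl
  total-integral i ((b , ζ) ∷ L) (h ∷ hs) =
    ≼-+ (≼-*ˡ (≼-int b) (root-of-unity-integral (N i) {{N≢0 i}} h)) (total-integral i L hs)

  descent* : ∀ i k L → ⟪ k ⟫ ≼ part (N i) L → ⟪ k ⟫ ≼ part W L
  descent* zero    k L h = h
  descent* (suc i) k L h = descent* i k L (Descent.descent i k L h)

  -- Multiplication by w moves the coset of the inverse of w onto μ_W itself.
  twist : Carrier → Terms → Terms
  twist w = map (λ (b , ζ) → b , ζ * w)

  total-twist : ∀ w L → total (twist w L) ≈ total L * w
  total-twist w [] = sym (zeroˡ w)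
  total-twist w ((b , ζ) ∷ L) = trans (+-cong (sym (*-assoc _ _ _)) (total-twist w L)) (sym (distribʳ _ _ _))

  twist-roots : ∀ k {w} L → w ^ k ≈ 1# → All (λ t → proj₂ t ^ k ≈ 1#) L → All (λ t → proj₂ t ^ k ≈ 1#) (twist w L)
  twist-roots k L h hs = All.map⁺ (All.map (λ h′ → *-root k h′ h) hs)

  ≼-part : ∀ i k {w} L → w ^ N i ≈ 1# → All (λ t → proj₂ t ^ N i ≈ 1#) L →
           ⟪ k ⟫ ≼ total L → ⟪ k ⟫ ≼ part W (twist w L)
  ≼-part i k {w} L hw hs h = descent* i k (twist w L) (≼-cong (sym (trans
      (part-all (N i) (twist w L) (twist-roots (N i) L hw hs)) (trans (total-twist w L) (*-comm _ _))))
    (≼-*ˡ (root-of-unity-integral (N i) {{N≢0 i}} hw) h))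

  -- Σ bⱼ ηⱼ over a sublist of the coefficients bs, with ηⱼ ∈ μ_W.
  data Value : List ℤ → Carrier → Set (a ⊔ r) where
    []   : Value [] 0#
    skip : ∀ {b bs y} → Value bs y → Value (b ∷ bs) y
    take : ∀ {b bs y η} → η ^ W ≈ 1# → Value bs y → Value (b ∷ bs) (int b * η + y)

  private
    instance
      W≢0 : NonZero W
      W≢0 = p^≢0 p-prime n₀

    z : Carrier
    z = proj₁ (primitiveRoot n₀)

    z-prim : IsPrimitive W z
    z-prim = proj₂ (primitiveRoot n₀)

  BoundedBy : ℕ → Carrier → Set r
  BoundedBy C x = ∀ x≉0 → ord x x≉0 ℚ.≤ ⟪ C ⟫

  bounded-cong : ∀ {C x y} → x ≈ y → BoundedBy C x → BoundedBy C y
  bounded-cong x≈y h y≉0 = subst (ℚ._≤ _) (ord-cong _ y≉0 x≈y) (h (λ e → y≉0 (trans (sym x≈y) e)))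

  bounded-mono : ∀ {C D x} → C ℕ.≤ D → BoundedBy C x → BoundedBy D x
  bounded-mono C≤D h x≉0 = ℚ.≤-trans (h x≉0) (⟪⟫-mono C≤D)

  bound : ∀ x → ∃[ C ] BoundedBy C x
  bound x with x ≈? 0#
  ... | yes x≈0 = 0 , λ x≉0 → contradiction x≈0 x≉0
  ... | no  x≉0 = let C , h = ℕ-above (ord x x≉0) in
    C , λ x≉0′ → subst (ℚ._≤ ⟪ C ⟫) (ord-cong x≉0 x≉0′ refl) h

  -- The accumulator x holds the terms chosen so far. Each coefficient branches into leaving it out
  -- or taking one of the W roots of unity, and only the largest bound is kept. A value 0 satisfies
  -- `BoundedBy` vacuously.
  values-bounded : ∀ bs x → ∃[ C ] (∀ {y} → Value bs y → BoundedBy C (x + y))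
  values-bounded [] x = let C , h = bound (x + 0#) in C , λ { [] → h }
  values-bounded (b ∷ bs) x = C ℕ.⊔ maximum D , λ where
      (skip y) → bounded-mono (ℕ.m≤m⊔n C _) (h y)
      (take {y = y} {η} η∈ y∈) → let i , η≈ = primitive-generates z-prim η η∈ in
        bounded-mono (ℕ.≤-trans (≤-maximum D i) (ℕ.m≤n⊔m C _))
          (bounded-cong (trans (+-assoc x _ y) (+-congˡ (+-congʳ (*-congˡ (sym η≈))))) (proj₂ (E i) y∈))
    where
    C = proj₁ (values-bounded bs x)
    h : ∀ {y} → Value bs y → BoundedBy C (x + y)
    h = proj₂ (values-bounded bs x)

    E : ∀ i → ∃[ C ] (∀ {y} → Value bs y → BoundedBy C (x + int b * z ^ toℕ {W} i + y))
    E i = values-bounded bs (x + int b * z ^ toℕ i)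

    D : Fin W → ℕ
    D i = proj₁ (E i)

  value-⊆ : ∀ {bs cs y} → bs ⊆ cs → Value bs y → Value cs y
  value-⊆ []          y          = y
  value-⊆ (c ∷ʳ τ)    y          = skip (value-⊆ τ y)
  value-⊆ (≡.refl ∷ τ) (skip y)   = skip (value-⊆ τ y)
  value-⊆ (≡.refl ∷ τ) (take η y) = take η (value-⊆ τ y)

  part-value : ∀ L → ∃[ y ] (Value (map proj₁ L) y × part W L ≈ y)
  part-value [] = 0# , [] , refl
  part-value ((b , ζ) ∷ L) = go ((ζ ^ W) ≈? 1#) (part-value L)
    where
    go : ∀ (d : Dec (ζ ^ W ≈ 1#)) → ∃[ y ] (Value (map proj₁ L) y × part W L ≈ y) →
         ∃[ y ] (Value (b ∷ map proj₁ L) y × addIf d (int b * ζ) (part W L) ≈ y)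
    go (yes h) (y , y∈ , e) = int b * ζ + y , take h y∈ , +-congˡ e
    go (no _)  (y , y∈ , e) = y , skip y∈ , e

  consIfNot : ∀ {P : Set r} → Dec P → ℤ × Carrier → Terms → Terms
  consIfNot (yes _) t L = L
  consIfNot (no _)  t L = t ∷ L

  outside : Carrier → Terms → Terms
  outside w []            = []
  outside w ((b , ζ) ∷ L) = consIfNot (((ζ * w) ^ W) ≈? 1#) (b , ζ) (outside w L)

  outside-⊆ : ∀ w L → outside w L ⊆ L
  outside-⊆ w []            = []
  outside-⊆ w ((b , ζ) ∷ L) = go (((ζ * w) ^ W) ≈? 1#)
    where
    go : ∀ {P} (d : Dec P) → consIfNot d (b , ζ) (outside w L) ⊆ (b , ζ) ∷ L
    go (yes _) = _ ∷ʳ outside-⊆ w L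
    go (no _)  = ≡.refl ∷ outside-⊆ w L

  split-total : ∀ {w w′} L → w * w′ ≈ 1# → total L ≈ part W (twist w L) * w′ + total (outside w L)
  split-total [] e = sym (trans (+-identityʳ _) (zeroˡ _))
  split-total {w} {w′} ((b , ζ) ∷ L) e = go (((ζ * w) ^ W) ≈? 1#)
    where
    go : ∀ {P} (d : Dec P) → total ((b , ζ) ∷ L) ≈
           addIf d (int b * (ζ * w)) (part W (twist w L)) * w′ + total (consIfNot d (b , ζ) (outside w L))
    go (yes _) = begin
      int b * ζ + total L
        ≈⟨ +-cong (*-congˡ (trans (sym (*-identityʳ ζ)) (trans (*-congˡ (sym e)) (sym (*-assoc ζ w w′))))) (split-total L e) ⟩
      int b * (ζ * w * w′) + (part W (twist w L) * w′ + total (outside w L))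
        ≈⟨ solve 5 (λ b z w x y → b :* (z :* w) :+ (x :* w :+ y) := (b :* z :+ x) :* w :+ y) refl _ _ _ _ _ ⟩
      (int b * (ζ * w) + part W (twist w L)) * w′ + total (outside w L) ∎
    go (no _) = begin
      int b * ζ + total L
        ≈⟨ +-congˡ (split-total L e) ⟩
      int b * ζ + (part W (twist w L) * w′ + total (outside w L))
        ≈⟨ solve 3 (λ x y z → x :+ (y :+ z) := y :+ (x :+ z)) refl _ _ _ ⟩
      part W (twist w L) * w′ + (int b * ζ + total (outside w L)) ∎

  -- Tate–Voloch for p-power roots of unity: split off one coset of μ_W at a time; the first
  -- non-zero coset sum takes one of finitely many values and bounds the valuation.
  module Bounded (bs : List ℤ) where

    C : ℕ
    C = proj₁ (values-bounded bs 0#)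

    coset-bounded : ∀ w L → map proj₁ L ⊆ bs → BoundedBy C (part W (twist w L))
    coset-bounded w L L⊆ = let y , y∈ , e = part-value (twist w L) in
      bounded-cong (trans (+-identityˡ y) (sym e))
        (proj₂ (values-bounded bs 0#) (value-⊆ (subst (_⊆ bs) (coefficients L) L⊆) y∈))
      where
      coefficients : ∀ L → map proj₁ L ≡ map proj₁ (twist w L)
      coefficients []      = ≡.refl
      coefficients (_ ∷ L) = cong (_ ∷_) (coefficients L)

    total-bounded : ∀ i k n L → length L ℕ.≤ n → All (λ t → proj₂ t ^ N i ≈ 1#) L → map proj₁ L ⊆ bs →
                    total L ≉ 0# → ⟪ k ⟫ ≼ total L → ⟪ k ⟫ ℚ.≤ ⟪ C ⟫
    total-bounded i k n       []            _   _  _  L≉0 h = contradiction refl L≉0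
    total-bounded i k (suc n) L@((b , ζ) ∷ L′) L≤n hs@(hζ ∷ _) L⊆ L≉0 h = go (part W (twist w L) ≈? 0#)
      where
      instance N≢0′ = N≢0 i

      -- The inverse of ζ: the coset to be split off is that of the head term, so `outside w L` is
      -- strictly shorter than L.
      w : Carrier
      w = ζ ^ ℕ.pred (N i)

      w^N≈1 : w ^ N i ≈ 1#
      w^N≈1 = ^-root (N i) (ℕ.pred (N i)) hζ

      w*ζ≈1 : w * ζ ≈ 1#
      w*ζ≈1 = trans (*-comm w ζ) (trans (^-congʳ ζ (ℕ.suc-pred (N i))) hζ)

      h′ : ⟪ k ⟫ ≼ part W (twist w L)
      h′ = ≼-part i k L w^N≈1 hs h

      split : total L ≈ part W (twist w L) * ζ + total (outside w L)
      split = split-total L w*ζ≈1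

      shorter : length (outside w L) ℕ.≤ n
      shorter = ℕ.≤-trans (go′ (((ζ * w) ^ W) ≈? 1#)) (ℕ.≤-pred L≤n)
        where
        go′ : ∀ (d : Dec ((ζ * w) ^ W ≈ 1#)) → length (consIfNot d (b , ζ) (outside w L′)) ℕ.≤ length L′
        go′ (yes _) = Sublist.length-mono-≤ (outside-⊆ w L′)
        go′ (no ¬h) = contradiction (trans (^-congˡ W (trans (*-comm ζ w) w*ζ≈1)) (1^ W)) ¬h

      go : Dec (part W (twist w L) ≈ 0#) → ⟪ k ⟫ ℚ.≤ ⟪ C ⟫
      go (no  ≉0) = ℚ.≤-trans (h′ ≉0) (coset-bounded w L L⊆ ≉0)
      go (yes ≈0) = total-bounded i k n (outside w L) shorter
          (Sublist.All-resp-⊆ (outside-⊆ w L) hs) (⊆-trans (Sublist.map⁺ proj₁ (outside-⊆ w L)) L⊆)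
          (λ e → L≉0 (trans same e)) (≼-cong same h)
        where
        same : total L ≈ total (outside w L)
        same = trans split (trans (+-congʳ (trans (*-congʳ ≈0) (zeroˡ ζ))) (+-identityˡ _))

    -- `total-bounded` deals with integer bounds only. Its case k = C + 1 rules out a valuation
    -- above C + 1, hence the successor.
    ord-bounded : ∀ i L → All (λ t → proj₂ t ^ N i ≈ 1#) L → map proj₁ L ⊆ bs →
                  ∀ L≉0 → ord (total L) L≉0 ℚ.≤ ⟪ suc C ⟫
    ord-bounded i L hs L⊆ L≉0 = ℚ.≮⇒≥ λ C+1<ord → <⇒≱ℚ C<C+1
      (total-bounded i (suc C) (length L) L ℕ.≤-refl hs L⊆ L≉0
        (λ L≉0′ → ℚ.≤-trans (ℚ.<⇒≤ C+1<ord) (ℚ.≤-reflexive (ord-cong L≉0 L≉0′ refl))))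
      where
      C<C+1 : ⟪ C ⟫ ℚ.< ⟪ suc C ⟫
      C<C+1 = subst₂ ℚ._<_ (ℚ.+-identityˡ ⟪ C ⟫) (≡.sym (⟪⟫-suc C)) (ℚ.+-monoˡ-< ⟪ C ⟫ 0<1)

  -- Without a second term in the coset of ζ₀, the twisted coset sum would be b₀ alone, a unit at ℓ,
  -- although it inherits the bound 1 from the total.
  coset-collision : ∀ i b₀ ζ₀ L → ζ₀ ^ N i ≈ 1# → All (λ t → proj₂ t ^ N i ≈ 1#) L → ¬ (ℓ ℕ∣.∣ ℤ.∣ b₀ ∣) →
                    1ℚ ≼ total ((b₀ , ζ₀) ∷ L) → Any (λ t → proj₂ t ^ W ≈ ζ₀ ^ W) L
  coset-collision i b₀ ζ₀ L h₀ hs ℓ∤b₀ h = go (Any.any? (λ t → (proj₂ t ^ W) ≈? (ζ₀ ^ W)) L)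
    where
    instance N≢0′ = N≢0 i

    w : Carrier
    w = ζ₀ ^ ℕ.pred (N i)

    ζ₀*w≈1 : ζ₀ * w ≈ 1#
    ζ₀*w≈1 = trans (^-congʳ ζ₀ (ℕ.suc-pred (N i))) h₀

    h′ : 1ℚ ≼ part W (twist w ((b₀ , ζ₀) ∷ L))
    h′ = ≼-≡ ⟪1⟫ (≼-part i 1 ((b₀ , ζ₀) ∷ L) (^-root (N i) (ℕ.pred (N i)) h₀) (h₀ ∷ hs) (≼-≡ (≡.sym ⟪1⟫) h))

    collide : ∀ {ζ} → (ζ * w) ^ W ≈ 1# → ζ ^ W ≈ ζ₀ ^ W
    collide {ζ} e = begin
      ζ ^ W                ≈⟨ ^-congˡ W (trans (sym (*-identityʳ ζ)) (trans (*-congˡ (trans (sym ζ₀*w≈1) (*-comm ζ₀ w))) (sym (*-assoc ζ w ζ₀)))) ⟩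
      (ζ * w * ζ₀) ^ W     ≈⟨ ^-distrib-* (ζ * w) ζ₀ W ⟩
      (ζ * w) ^ W * ζ₀ ^ W ≈⟨ trans (*-congʳ e) (*-identityˡ _) ⟩
      ζ₀ ^ W               ∎

    go : Dec (Any (λ t → proj₂ t ^ W ≈ ζ₀ ^ W) L) → Any (λ t → proj₂ t ^ W ≈ ζ₀ ^ W) L
    go (yes found) = found
    go (no  none)  = contradiction (ℓ-unit b₀ ℓ∤b₀ (≼-cong single h′)) (<⇒≱ℚ 0<1)
      where
      single : part W (twist w ((b₀ , ζ₀) ∷ L)) ≈ int b₀
      single = begin
        part W (twist w ((b₀ , ζ₀) ∷ L))          ≈⟨ addIf-yes (((ζ₀ * w) ^ W) ≈? 1#) (trans (^-congˡ W ζ₀*w≈1) (1^ W)) ⟩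
        int b₀ * (ζ₀ * w) + part W (twist w L)    ≈⟨ +-cong (*-congˡ ζ₀*w≈1) (part-none W (twist w L) (All.map⁺ (All.map (λ ¬c e → ¬c (collide e)) (All.¬Any⇒All¬ L none)))) ⟩
        int b₀ * 1# + 0#                          ≈⟨ trans (+-identityʳ _) (*-identityʳ _) ⟩
        int b₀                                    ∎

-- Residues of p-adic integers

∣+a-+b∣≡∣a-b∣ : ∀ a b → ℤ.∣ + a ℤ.- + b ∣ ≡ ℕ.∣ a - b ∣
∣+a-+b∣≡∣a-b∣ a b with ℕ.≤-total a b
... | inj₁ a≤b = ≡.trans (cong ℤ.∣_∣ (ℤ.m-n≡m⊖n a b)) (≡.trans (ℤ.∣⊖∣-≤ a≤b) (≡.sym (ℕ.m≤n⇒∣m-n∣≡n∸m a≤b)))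
... | inj₂ b≤a = ≡.trans (cong ℤ.∣_∣ (ℤ.m-n≡m⊖n a b)) (≡.trans (ℤ.∣m⊖n∣≡∣n⊖m∣ a b) (≡.trans (ℤ.∣⊖∣-≤ b≤a) (≡.sym (ℕ.m≤n⇒∣n-m∣≡n∸m b≤a))))

-- If y = x + k D, then the quotients by D differ by exactly k.
quotient-≡-≤ : ∀ {D x y} .{{_ : NonZero D}} → x ℕ.≤ y → D ℕ∣.∣ y ℕ.∸ x → x / D ≡ y / D → x ≡ y
quotient-≡-≤ {D} {x} {y} x≤y (ℕ∣.divides k y∸x≡kD) e = begin
  x                   ≡⟨ ℕ.+-identityʳ x ⟨
  x ℕ.+ 0 ℕ.* D       ≡⟨ cong (λ k → x ℕ.+ k ℕ.* D) k≡0 ⟨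
  x ℕ.+ k ℕ.* D       ≡⟨ y≡x+kD ⟨
  y                   ∎
  where
  open ≡.≡-Reasoning

  y≡x+kD : y ≡ x ℕ.+ k ℕ.* D
  y≡x+kD = ≡.trans (≡.sym (ℕ.m+[n∸m]≡n x≤y)) (cong (x ℕ.+_) y∸x≡kD)

  k≡0 : k ≡ 0
  k≡0 = ℕ.+-cancelˡ-≡ (x / D) k 0 (begin
    x / D ℕ.+ k                 ≡⟨ cong (x / D ℕ.+_) (≡.sym (m*n/n≡m k D)) ⟩
    x / D ℕ.+ k ℕ.* D / D       ≡⟨ +-distrib-/-∣ʳ x (ℕ∣.divides k ≡.refl) ⟨
    (x ℕ.+ k ℕ.* D) / D         ≡⟨ cong (_/ D) y≡x+kD ⟨
    y / D                       ≡⟨ e ⟨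
    x / D                       ≡⟨ ℕ.+-identityʳ _ ⟨
    x / D ℕ.+ 0                 ∎)

quotient-≡ : ∀ {D x y} .{{_ : NonZero D}} → D ℕ∣.∣ ℕ.∣ x - y ∣ → x / D ≡ y / D → x ≡ y
quotient-≡ {D} {x} {y} d e with ℕ.≤-total x y
... | inj₁ x≤y = quotient-≡-≤ x≤y (subst (D ℕ∣.∣_) (ℕ.m≤n⇒∣m-n∣≡n∸m x≤y) d) e
... | inj₂ y≤x = ≡.sym (quotient-≡-≤ y≤x (subst (D ℕ∣.∣_) (ℕ.m≤n⇒∣n-m∣≡n∸m y≤x) d) (≡.sym e))

module Congruence (k : ℤ) where

  infix 4 _≡ₖ_
  _≡ₖ_ : ℤ → ℤ → Set
  a ≡ₖ b = k ℤ∣.∣ a ℤ.- b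

  ≡ₖ-reflexive : ∀ {a b} → a ≡ b → a ≡ₖ b
  ≡ₖ-reflexive {a} ≡.refl = ℤ∣.divides ℤ.0ℤ (ℤ.+-inverseʳ a)

  ≡ₖ-sym : ∀ a b → a ≡ₖ b → b ≡ₖ a
  ≡ₖ-sym a b h = subst (k ℤ∣.∣_) (alg a b) (ℤ∣.∣m⇒∣-m h)
    where
    alg : ∀ a b → ℤ.- (a ℤ.- b) ≡ b ℤ.- a
    alg = solve-∀

  ≡ₖ-trans : ∀ a b c → a ≡ₖ b → b ≡ₖ c → a ≡ₖ c
  ≡ₖ-trans a b c h h′ = subst (k ℤ∣.∣_) (alg a b c) (ℤ∣.∣m∣n⇒∣m+n h h′)
    where
    alg : ∀ a b c → (a ℤ.- b) ℤ.+ (b ℤ.- c) ≡ a ℤ.- c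
    alg = solve-∀

  ≡ₖ-+ : ∀ a b c d → a ≡ₖ b → c ≡ₖ d → a ℤ.+ c ≡ₖ b ℤ.+ d
  ≡ₖ-+ a b c d h h′ = subst (k ℤ∣.∣_) (alg a b c d) (ℤ∣.∣m∣n⇒∣m+n h h′)
    where
    alg : ∀ a b c d → (a ℤ.- b) ℤ.+ (c ℤ.- d) ≡ (a ℤ.+ c) ℤ.- (b ℤ.+ d)
    alg = solve-∀

  ≡ₖ-multiple : ∀ a c → a ℤ.+ k ℤ.* c ≡ₖ a
  ≡ₖ-multiple a c = ℤ∣.divides c (alg a c k)
    where
    alg : ∀ a c k → (a ℤ.+ k ℤ.* c) ℤ.- a ≡ c ℤ.* k
    alg = solve-∀

module Residues (p : ℕ) (p-prime : Prime p) where
  open Padic p p-prime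

  residue : ℕ → ℤₚ → ℕ
  residue n α = ℤ._%ℕ_ (seq α n) (p ℕ.^ n) {{p^-nonZero n}}

  open Congruence using (≡ₖ-reflexive; ≡ₖ-sym; ≡ₖ-trans; ≡ₖ-multiple)

  infix 4 _≅[_]_
  _≅[_]_ : ℤ → ℕ → ℤ → Set
  a ≅[ n ] b = p^ n ℤ∣.∣ a ℤ.- b

  residue-≡ : ∀ n α → seq α n ≅[ n ] + residue n α
  residue-≡ n α = subst (λ a → a ≅[ n ] + residue n α) (≡.sym (a≡a%ℕn+[a/ℕn]*n (seq α n) (p ℕ.^ n) {{p^-nonZero n}}))
    (subst (λ q → + residue n α ℤ.+ q ≅[ n ] + residue n α) (ℤ.*-comm (p^ n) (ℤ._/ℕ_ (seq α n) (p ℕ.^ n) {{p^-nonZero n}}))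
      (≡ₖ-multiple (p^ n) (+ residue n α) (ℤ._/ℕ_ (seq α n) (p ℕ.^ n) {{p^-nonZero n}})))

  residue-dist : ∀ n α b → seq α n ≅[ n ] + b → p ℕ.^ n ℕ∣.∣ ℕ.∣ residue n α - b ∣
  residue-dist n α b h = subst (p ℕ.^ n ℕ∣.∣_) (∣+a-+b∣≡∣a-b∣ (residue n α) b) (ℤ∣.∣⇒∣ᵤ
    (≡ₖ-trans (p^ n) (+ residue n α) (seq α n) (+ b) (≡ₖ-sym (p^ n) (seq α n) (+ residue n α) (residue-≡ n α)) h))

  coherent+ : ∀ α n m → seq α (m ℕ.+ n) ≅[ n ] seq α n
  coherent+ α n zero    = ≡ₖ-reflexive (p^ n) {seq α n} ≡.refl
  coherent+ α n (suc m) = ≡ₖ-trans (p^ n) (seq α (suc m ℕ.+ n)) (seq α (m ℕ.+ n)) (seq α n)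
    (ℤ∣.∣-trans (ℤ∣.∣ᵤ⇒∣ (ℕ∣.divides (p ℕ.^ m) (ℕ.^-distribˡ-+-* p m n))) (coherent α (m ℕ.+ n))) (coherent+ α n m)

  -- (α - residue) / pⁿ
  module _ (n : ℕ) (α : ℤₚ) where
    private
      dividend : ∀ m → seq α (m ℕ.+ n) ≅[ n ] + residue n α
      dividend m = ≡ₖ-trans (p^ n) (seq α (m ℕ.+ n)) (seq α n) (+ residue n α) (coherent+ α n m) (residue-≡ n α)

    p^n*[_] : ∀ m → seq α (m ℕ.+ n) ℤ.- + residue n α ≡ ℤ∣.quotient (dividend m) ℤ.* p^ n
    p^n*[ m ] = ℤ∣._∣_.equality (dividend m)

    quotientₚ : ℤₚ
    quotientₚ = mkℤₚ (λ m → ℤ∣.quotient (dividend m)) coh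
      where
      alg : ∀ a b r → (a ℤ.- r) ℤ.- (b ℤ.- r) ≡ a ℤ.- b
      alg = solve-∀

      factor : ∀ a b c → a ℤ.* c ℤ.- b ℤ.* c ≡ (a ℤ.- b) ℤ.* c
      factor = solve-∀

      coh : ∀ m → p^ m ℤ∣.∣ ℤ∣.quotient (dividend (suc m)) ℤ.- ℤ∣.quotient (dividend m)
      coh m = ℤ∣.*-cancelʳ-∣ (p^ n) {{p^-nonZero n}} (subst₂ ℤ∣._∣_
        (≡.trans (cong +_ (ℕ.^-distribˡ-+-* p m n)) (ℤ.pos-* (p ℕ.^ m) (p ℕ.^ n)))
        (≡.trans (≡.sym (alg (seq α (suc m ℕ.+ n)) (seq α (m ℕ.+ n)) (+ residue n α)))
          (≡.trans (cong₂ ℤ._-_ p^n*[ suc m ] p^n*[ m ]) (factor (ℤ∣.quotient (dividend (suc m))) (ℤ∣.quotient (dividend m)) (p^ n))))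
        (coherent α (m ℕ.+ n)))

  separated : ∀ α β → ¬ (α ≈ᶻ β) → (∀ {P : Set} → Dec P) → ∃[ m ] ¬ (seq α m ≅[ m ] seq β m)
  separated α β α≉β em = go em
    where
    go : Dec (∃[ m ] ¬ (seq α m ≅[ m ] seq β m)) → ∃[ m ] ¬ (seq α m ≅[ m ] seq β m)
    go (yes h) = h
    go (no ¬h) = contradiction (mk≈ λ m → decidable-stable (p^ m ℤ∣.∣? _) (λ h → ¬h (m , h))) α≉β

  -- The residue at level n determines the class modulo p^m for all m ≤ n, and α and β already
  -- differ there.
  residues-separated : ∀ {α β m k} n → k ℕ.≤ n → m ℕ.≤ k → ¬ (seq α m ≅[ m ] seq β m) →
                       ¬ (p ℕ.^ k ℕ∣.∣ ℕ.∣ residue n α - residue n β ∣)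
  residues-separated {α} {β} {m} {k} n k≤n m≤k ¬h d = ¬h
    (≡ₖ-trans (p^ m) (seq α m) (+ residue n α) (seq β m) (level α)
      (≡ₖ-trans (p^ m) (+ residue n α) (+ residue n β) (seq β m)
        (ℤ∣.∣ᵤ⇒∣ (subst (p ℕ.^ m ℕ∣.∣_) (≡.sym (∣+a-+b∣≡∣a-b∣ (residue n α) (residue n β))) (ℕ∣.∣-trans (p^∣p^ m≤k) d)))
        (≡ₖ-sym (p^ m) (seq β m) (+ residue n β) (level β))))
    where
    p^∣p^ : ∀ {i j} → i ℕ.≤ j → p ℕ.^ i ℕ∣.∣ p ℕ.^ j
    p^∣p^ {i} {j} i≤j = ℕ∣.divides (p ℕ.^ (j ℕ.∸ i)) (≡.trans (cong (p ℕ.^_) (≡.sym (ℕ.m∸n+n≡m i≤j))) (ℕ.^-distribˡ-+-* p (j ℕ.∸ i) i))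

    m≤n : m ℕ.≤ n
    m≤n = ℕ.≤-trans m≤k k≤n

    level : ∀ α → seq α m ≅[ m ] + residue n α
    level α = ≡ₖ-trans (p^ m) (seq α m) (seq α n) (+ residue n α)
      (≡ₖ-sym (p^ m) (seq α n) (seq α m) (subst (λ j → seq α j ≅[ m ] seq α m) (ℕ.m∸n+n≡m m≤n) (coherent+ α m (n ℕ.∸ m))))
      (ℤ∣.∣-trans (ℤ∣.∣ᵤ⇒∣ (p^∣p^ m≤n)) (residue-≡ n α))

-- Characters of Γ/ n

module _ {c e} (M : CommutativeMonoid c e) where
  open CommutativeMonoid M
  open import Algebra.Properties.CommutativeMonoid.Sum M using (sum; sum-cong-≋; sum-replicate-zero)

  sum-only : ∀ {n} (f : Fin n → Carrier) j → (∀ i → i ≢ j → f i ≈ ε) → sum f ≈ f j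
  sum-only {suc n} f Fin.zero    h = trans (∙-congˡ (trans (sum-cong-≋ (λ i → h (Fin.suc i) λ ())) (sum-replicate-zero n))) (identityʳ _)
  sum-only {suc n} f (Fin.suc j) h = trans (∙-cong (h Fin.zero λ ()) (sum-only (λ i → f (Fin.suc i)) j
    λ i i≢j → h (Fin.suc i) (λ e → i≢j (Fin.suc-injective e)))) (identityˡ _)

-- Allows two equations between powers of a root of unity to be divided by one another with natural
-- exponents; see `collision`.
cross-difference : ∀ x y A B → ℕ.∣ x ℕ.* A ℕ.+ y ℕ.* B - x ℕ.* B ℕ.+ y ℕ.* A ∣ ≡ ℕ.∣ x - y ∣ ℕ.* ℕ.∣ A - B ∣
cross-difference x y A B = begin
  ℕ.∣ x ℕ.* A ℕ.+ y ℕ.* B - x ℕ.* B ℕ.+ y ℕ.* A ∣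
    ≡⟨ ∣+a-+b∣≡∣a-b∣ (x ℕ.* A ℕ.+ y ℕ.* B) (x ℕ.* B ℕ.+ y ℕ.* A) ⟨
  ℤ.∣ (+ (x ℕ.* A) ℤ.+ + (y ℕ.* B)) ℤ.- (+ (x ℕ.* B) ℤ.+ + (y ℕ.* A)) ∣
    ≡⟨ cong ℤ.∣_∣ (cong₂ ℤ._-_ (cong₂ ℤ._+_ (ℤ.pos-* x A) (ℤ.pos-* y B)) (cong₂ ℤ._+_ (ℤ.pos-* x B) (ℤ.pos-* y A))) ⟩
  ℤ.∣ (+ x ℤ.* + A ℤ.+ + y ℤ.* + B) ℤ.- (+ x ℤ.* + B ℤ.+ + y ℤ.* + A) ∣
    ≡⟨ cong ℤ.∣_∣ (alg (+ x) (+ y) (+ A) (+ B)) ⟩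
  ℤ.∣ (+ x ℤ.- + y) ℤ.* (+ A ℤ.- + B) ∣
    ≡⟨ ℤ.abs-* (+ x ℤ.- + y) (+ A ℤ.- + B) ⟩
  ℤ.∣ + x ℤ.- + y ∣ ℕ.* ℤ.∣ + A ℤ.- + B ∣
    ≡⟨ cong₂ ℕ._*_ (∣+a-+b∣≡∣a-b∣ x y) (∣+a-+b∣≡∣a-b∣ A B) ⟩
  ℕ.∣ x - y ∣ ℕ.* ℕ.∣ A - B ∣ ∎
  where
  open ≡.≡-Reasoning

  alg : ∀ x y A B → (x ℤ.* A ℤ.+ y ℤ.* B) ℤ.- (x ℤ.* B ℤ.+ y ℤ.* A) ≡ (x ℤ.- y) ℤ.* (A ℤ.- B)
  alg = solve-∀

module Enumeration {a r s : Level} (em : ExcludedMiddle (a ⊔ r ⊔ s))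
  (p ℓ : ℕ) (p-prime : Prime p) (ℓ-prime : Prime ℓ) (d′ : ℕ) (K : HeytingField a r s)
  (closure : Closure.IsAlgebraicClosure ℓ ℓ-prime K)
  (v : Closure.Valuation ℓ ℓ-prime K closure) (n : ℕ) where

  open CommutativeRing (fieldRing K)
  open import Relation.Binary.Reasoning.Setoid setoid
  open import Algebra.Properties.Semiring.Exp semiring using (_^_; ^-congˡ; ^-congʳ; ^-homo-*; ^-assocʳ)
  open import Algebra.Properties.CommutativeMonoid.Mult *-commutativeMonoid using () renaming (×-distrib-+ to ^-distrib-*)
  open import Algebra.Properties.CommutativeMonoid.Sum *-commutativeMonoid using ()
    renaming (sum to product; sum-cong-≋ to product-cong; sum-remove to product-remove; ∑-distrib-+ to product-*; sum-replicate-zero to product-1)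
  open import Algebra.Solver.Ring.NaturalCoefficients.Default commutativeSemiring using (solve; _:*_; _:=_)
  open FieldLemmas em K
  open Valued em ℓ ℓ-prime K closure v
  open Roots em K
  open Cyclotomic em p ℓ p-prime ℓ-prime K closure v
  open Residues p p-prime
  open Congruence using (≡ₖ-reflexive; ≡ₖ-sym; ≡ₖ-trans; ≡ₖ-+; ≡ₖ-multiple)
  open Padic p p-prime
  open Gamma p p-prime (suc d′)
  open Characters p ℓ p-prime ℓ-prime (suc d′) K closure v

  d : ℕ
  d = suc d′

  P : ℕ
  P = p ℕ.^ n

  private instance
    P≢0 : NonZero P
    P≢0 = p^≢0 p-prime n

  private
    z : Carrier
    z = proj₁ (primitiveRoot n)

    z-prim : IsPrimitive P z
    z-prim = proj₂ (primitiveRoot n)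

    z-root : ∀ k → (z ^ k) ^ P ≈ 1#
    z-root k = ^-root P k (proj₁ z-prim)

  root-mod : ∀ {ζ a b} → ζ ^ P ≈ 1# → P ℕ∣.∣ ℕ.∣ a - b ∣ → ζ ^ a ≈ ζ ^ b
  root-mod {ζ} {a} {b} e h with ℕ.≤-total a b
  ... | inj₁ a≤b = sym (go a≤b (subst (P ℕ∣.∣_) (ℕ.m≤n⇒∣m-n∣≡n∸m a≤b) h))
    where
    go : ∀ {a b} → a ℕ.≤ b → P ℕ∣.∣ b ℕ.∸ a → ζ ^ b ≈ ζ ^ a
    go {a} {b} a≤b h = trans (^-congʳ ζ (≡.sym (ℕ.m+[n∸m]≡n a≤b))) (trans (^-homo-* ζ a (b ℕ.∸ a)) (trans (*-congˡ (^-∣ h e)) (*-identityʳ _)))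
  ... | inj₂ b≤a = trans (^-congʳ ζ (≡.sym (ℕ.m+[n∸m]≡n b≤a))) (trans (^-homo-* ζ b (a ℕ.∸ b))
          (trans (*-congˡ (^-∣ (subst (P ℕ∣.∣_) (ℕ.m≤n⇒∣n-m∣≡n∸m b≤a) h) e)) (*-identityʳ _)))

  residue-power : ∀ {ζ} α b → ζ ^ P ≈ 1# → seq α n ≅[ n ] + b → ζ ^ residue n α ≈ ζ ^ b
  residue-power α b e h = root-mod {a = residue n α} {b} e (residue-dist n α b h)

  product-root : ∀ {m} (f : Fin m → Carrier) → (∀ i → f i ^ P ≈ 1#) → product f ^ P ≈ 1#
  product-root {zero}  f h = 1^ P
  product-root {suc m} f h = *-root P (h Fin.zero) (product-root (λ i → f (Fin.suc i)) (λ i → h (Fin.suc i)))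

  monomial : (Fin d → ℕ) → ∣Γ∣ → Carrier
  monomial x α = product (λ i → (z ^ x i) ^ residue n (α i))

  monomial-root : ∀ x α → monomial x α ^ P ≈ 1#
  monomial-root x α = product-root _ (λ i → ^-root P (residue n (α i)) (z-root (x i)))

  private
    module Γ = AbelianGroup Γ

    infixr 8 _·_
    _·_ : ℕ → ∣Γ∣ → ∣Γ∣
    _·_ = Multiple._×_ Γ.rawMonoid

    sumΓ : ∀ {m} → (Fin m → ∣Γ∣) → ∣Γ∣
    sumΓ = Multiple.sum Γ.rawMonoid

    open import Algebra.Properties.CommutativeMonoid.Sum ℤ.+-0-commutativeMonoid using () renaming (sum to sumℤ)

    seq-· : ∀ k g i m → seq ((k · g) i) m ≡ + k ℤ.* seq (g i) m
    seq-· zero    g i m = ≡.sym (ℤ.*-zeroˡ (seq (g i) m))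
    seq-· (suc k) g i m = ≡.trans (cong (λ q → seq (g i) m ℤ.+ q) (seq-· k g i m)) (≡.sym (ℤ.suc-* (+ k) (seq (g i) m)))

    seq-sum : ∀ {l} (f : Fin l → ∣Γ∣) j m → seq (sumΓ f j) m ≡ sumℤ (λ i → seq (f i j) m)
    seq-sum {zero}  f j m = ≡.refl
    seq-sum {suc l} f j m = cong (λ q → seq (f Fin.zero j) m ℤ.+ q) (seq-sum (λ i → f (Fin.suc i)) j m)

    γ-same : ∀ i m → seq (γ i i) m ≡ ℤ.1ℤ
    γ-same i m with i Fin.≟ i
    ... | yes _  = ≡.refl
    ... | no i≢i = contradiction ≡.refl i≢i

    γ-other : ∀ {i j} → i ≢ j → ∀ m → seq (γ i j) m ≡ ℤ.0ℤ
    γ-other {i} {j} i≢j m with i Fin.≟ j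
    ... | yes i≡j = contradiction i≡j i≢j
    ... | no _    = ≡.refl

  character : (Fin d → ℕ) → Γ/ n ∨
  character x = record
    { ⟦_⟧ = monomial x
    ; isMonoidHomomorphism = record
      { isMagmaHomomorphism = record
        { isRelHomomorphism = record { cong = respects }
        ; homo = homo
        }
      ; ε-homo = trans (product-cong (λ i → residue-power (ℤ→ℤₚ ℤ.0ℤ) 0 (z-root (x i)) (≡ₖ-reflexive (p^ n) {ℤ.0ℤ} ≡.refl))) (product-1 d)
      }
    }
    where
    respects : ∀ {g h} → PowerQuotient._≈/_ Γ P g h → monomial x g ≈ monomial x h
    respects {g} {h} (PowerQuotient.differBy root e) = product-cong λ i →
      residue-power (g i) (residue n (h i)) (z-root (x i)) (≡ₖ-trans (p^ n) (seq (g i) n) (seq (h i) n) (+ residue n (h i))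
        (≡ₖ-trans (p^ n) (seq (g i) n) (seq (h i) n ℤ.+ p^ n ℤ.* seq (root i) n) (seq (h i) n)
          (subst (λ q → seq (g i) n ≅[ n ] seq (h i) n ℤ.+ q) (seq-· P root i n) (cong-mod (e i) n))
          (≡ₖ-multiple (p^ n) (seq (h i) n) (seq (root i) n)))
        (residue-≡ n (h i)))

    homo : ∀ g h → monomial x (g Γ.∙ h) ≈ monomial x g * monomial x h
    homo g h = trans (product-cong λ i → trans
        (residue-power (g i +ᶻ h i) (residue n (g i) ℕ.+ residue n (h i)) (z-root (x i))
          (≡ₖ-+ (p^ n) (seq (g i) n) (+ residue n (g i)) (seq (h i) n) (+ residue n (h i)) (residue-≡ n (g i)) (residue-≡ n (h i))))
        (^-homo-* (z ^ x i) (residue n (g i)) (residue n (h i))))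
      (product-* (λ i → (z ^ x i) ^ residue n (g i)) (λ i → (z ^ x i) ^ residue n (h i)))

  character-γ : ∀ x i → ⟦ character x ⟧ (γ i) ≈ z ^ x i
  character-γ x i = trans
    (sum-only *-commutativeMonoid (λ j → (z ^ x j) ^ residue n (γ i j)) i λ j j≢i →
      residue-power (γ i j) 0 (z-root (x j)) (≡ₖ-reflexive (p^ n) (γ-other (λ i≡j → j≢i (≡.sym i≡j)) n)))
    (trans (residue-power (γ i i) 1 (z-root (x i)) (≡ₖ-reflexive (p^ n) (γ-same i n))) (*-identityʳ _))

  evalMonomial-character : ∀ x α → evalMonomial n (character x) α ≈ monomial x α
  evalMonomial-character x α = product-cong λ i → ^-congˡ (residue n (α i)) (character-γ x i)

  character-injective : ∀ {x y} → (∀ i → x i ℕ.< P) → (∀ i → y i ℕ.< P) →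
                        (∀ g → ⟦ character x ⟧ g ≈ ⟦ character y ⟧ g) → ∀ i → x i ≡ y i
  character-injective {x} {y} x<P y<P e i = small (x<P i) (y<P i) (trans (sym (character-γ x i)) (trans (e (γ i)) (character-γ y i)))
    where
    small-≤ : ∀ {i j} → j ℕ.< P → i ℕ.≤ j → z ^ i ≈ z ^ j → i ≡ j
    small-≤ {i} {j} j<P i≤j e = ≡.trans (≡.sym (ℕ.+-identityʳ i)) (≡.trans (cong (i ℕ.+_) (≡.sym (j∸i≡0 (j ℕ.∸ i) ≡.refl))) (ℕ.m+[n∸m]≡n i≤j))
      where
      j∸i≡0 : ∀ k → k ≡ j ℕ.∸ i → j ℕ.∸ i ≡ 0
      j∸i≡0 zero    e′ = ≡.sym e′
      j∸i≡0 (suc k) e′ = contradiction (ℕ∣.∣⇒≤ (subst (P ℕ∣.∣_) (≡.sym e′) (primitive-≡ z-prim i≤j e)))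
        (ℕ.<⇒≱ (ℕ.≤-<-trans (subst (ℕ._≤ j) (≡.sym e′) (ℕ.m∸n≤m j i)) j<P))

    small : ∀ {i j} → i ℕ.< P → j ℕ.< P → z ^ i ≈ z ^ j → i ≡ j
    small {i} {j} i<P j<P e with ℕ.≤-total i j
    ... | inj₁ i≤j = small-≤ j<P i≤j e
    ... | inj₂ j≤i = ≡.sym (small-≤ i<P j≤i (sym e))

  -- Every element of Γ is congruent to Σ (aᵢ mod pⁿ) γᵢ modulo pⁿ-th powers.
  module _ (ω : Γ/ n ∨) where
    private module ω = MonoidHomomorphism ω

    ω-· : ∀ k g → ⟦ ω ⟧ (k · g) ≈ ⟦ ω ⟧ g ^ k
    ω-· zero    g = ω.ε-homo
    ω-· (suc k) g = trans (ω.homo g (k · g)) (*-congˡ (ω-· k g))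

    ω-sum : ∀ {l} (f : Fin l → ∣Γ∣) → ⟦ ω ⟧ (sumΓ f) ≈ product (λ i → ⟦ ω ⟧ (f i))
    ω-sum {zero}  f = ω.ε-homo
    ω-sum {suc l} f = trans (ω.homo _ _) (*-congˡ (ω-sum (λ i → f (Fin.suc i))))

    ω-γ-root : ∀ i → ⟦ ω ⟧ (γ i) ^ P ≈ 1#
    ω-γ-root i = trans (sym (ω-· P (γ i))) (trans (ω.⟦⟧-cong (PowerQuotient.differBy (γ i) (Γ.sym (Γ.identityˡ (P · γ i))))) ω.ε-homo)

    ω-expand : ∀ g → ⟦ ω ⟧ g ≈ product (λ i → ⟦ ω ⟧ (γ i) ^ residue n (g i))
    ω-expand g = trans (ω.⟦⟧-cong (PowerQuotient.differBy h λ j → mk≈ (decompose j)))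
      (trans (ω-sum f) (product-cong λ i → ω-· (residue n (g i)) (γ i)))
      where
      f : Fin d → ∣Γ∣
      f i = residue n (g i) · γ i

      h : ∣Γ∣
      h j = quotientₚ n (g j)

      seq-f : ∀ j m → seq (sumΓ f j) m ≡ + residue n (g j)
      seq-f j m = ≡.trans (seq-sum f j m) (≡.trans
        (sum-only ℤ.+-0-commutativeMonoid (λ i → seq (f i j) m) j λ i i≢j →
          ≡.trans (seq-· (residue n (g i)) (γ i) j m) (≡.trans (cong (λ q → + residue n (g i) ℤ.* q) (γ-other i≢j m)) (ℤ.*-zeroʳ (+ residue n (g i)))))
        (≡.trans (seq-· (residue n (g j)) (γ j) j m) (≡.trans (cong (λ q → + residue n (g j) ℤ.* q) (γ-same j m)) (ℤ.*-identityʳ _))))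

      restore : ∀ r s → r ℤ.+ (s ℤ.- r) ≡ s
      restore = solve-∀

      value : ∀ j m → seq (sumΓ f j) m ℤ.+ seq ((P · h) j) m ≡ seq (g j) (m ℕ.+ n)
      value j m = ≡.trans (cong₂ ℤ._+_ (seq-f j m) (≡.trans (seq-· P h j m)
          (≡.trans (ℤ.*-comm (p^ n) (seq (h j) m)) (≡.sym (p^n*[_] n (g j) m)))))
        (restore (+ residue n (g j)) (seq (g j) (m ℕ.+ n)))

      -- The quotient by pⁿ is read off n levels higher, so the sum reproduces g at level m + n,
      -- which agrees with level m modulo p^m.
      decompose : ∀ j m → seq (g j) m ≅[ m ] seq (sumΓ f j) m ℤ.+ seq ((P · h) j) m
      decompose j m = subst (λ q → seq (g j) m ≅[ m ] q) (≡.sym (≡.trans (value j m) (cong (seq (g j)) (ℕ.+-comm m n))))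
        (≡ₖ-sym (p^ m) (seq (g j) (n ℕ.+ m)) (seq (g j) m) (coherent+ (g j) m n))

    exponents : Fin d → Fin P
    exponents i = proj₁ (primitive-generates z-prim (⟦ ω ⟧ (γ i)) (ω-γ-root i))

    character-surjective : ∀ x → (∀ i → x i ≡ toℕ (exponents i)) → ∀ g → ⟦ character x ⟧ g ≈ ⟦ ω ⟧ g
    character-surjective x e g = sym (trans (ω-expand g) (product-cong λ i →
      ^-congˡ (residue n (g i)) (trans (proj₂ (primitive-generates z-prim (⟦ ω ⟧ (γ i)) (ω-γ-root i))) (^-congʳ z (≡.sym (e i))))))

  module _ (x y : Fin d → ℕ) (c : Fin d) (agree : ∀ i → x (punchIn c i) ≡ y (punchIn c i)) (α β : ∣Γ∣) (W : ℕ) where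
    private
      A = residue n (α c)
      B = residue n (β c)

      rest : (Fin d → ℕ) → ∣Γ∣ → Carrier
      rest x α = product (removeAt (λ i → (z ^ x i) ^ residue n (α i)) c)

      rest≉0 : ∀ α → rest x α ^ W ≉ 0#
      rest≉0 α = unit-power⇒≉0 P (^-root P W (product-root _ (λ i → ^-root P (residue n (α (punchIn c i))) (z-root (x (punchIn c i))))))

      rest-agree : ∀ α → rest y α ≈ rest x α
      rest-agree α = product-cong λ i → ^-congˡ (residue n (α (punchIn c i))) (^-congʳ z (≡.sym (agree i)))

      factor : ∀ y α → rest y α ≈ rest x α → monomial y α ^ W ≈ z ^ (y c ℕ.* (residue n (α c) ℕ.* W)) * rest x α ^ W
      factor y α e = begin
        monomial y α ^ W
          ≈⟨ ^-congˡ W (trans (product-remove {i = c} (λ i → (z ^ y i) ^ residue n (α i))) (*-congˡ e)) ⟩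
        ((z ^ y c) ^ residue n (α c) * rest x α) ^ W
          ≈⟨ ^-distrib-* _ _ W ⟩
        ((z ^ y c) ^ residue n (α c)) ^ W * rest x α ^ W
          ≈⟨ *-congʳ (trans (^-assocʳ (z ^ y c) (residue n (α c)) W) (^-assocʳ z (y c) _)) ⟩
        z ^ (y c ℕ.* (residue n (α c) ℕ.* W)) * rest x α ^ W ∎

    -- The characters x and y agree off the coordinate c. Dividing the equation for x by the one for
    -- y therefore cancels all other coordinates and leaves z^((x c - y c) W (A - B)) = 1, where z
    -- has order P.
    collision : monomial x α ^ W ≈ monomial x β ^ W → monomial y α ^ W ≈ monomial y β ^ W →
                P ℕ∣.∣ ℕ.∣ x c - y c ∣ ℕ.* W ℕ.* ℕ.∣ A - B ∣
    collision hx hy = subst (P ℕ∣.∣_) scaled (dist {x c ℕ.* (A ℕ.* W) ℕ.+ y c ℕ.* (B ℕ.* W)} {x c ℕ.* (B ℕ.* W) ℕ.+ y c ℕ.* (A ℕ.* W)} (*-cancelʳ-≉0 (*-≉0 (rest≉0 α) (rest≉0 β)) cross))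
      where
      hx′ = trans (sym (factor x α refl)) (trans hx (factor x β refl))
      hy′ = trans (sym (factor y α (rest-agree α))) (trans hy (factor y β (rest-agree β)))

      -- The division is carried out by multiplying the equation for x with the reversed equation
      -- for y; the common factors cancel because they are roots of unity and hence non-zero.
      cross : z ^ (x c ℕ.* (A ℕ.* W) ℕ.+ y c ℕ.* (B ℕ.* W)) * (rest x α ^ W * rest x β ^ W)
            ≈ z ^ (x c ℕ.* (B ℕ.* W) ℕ.+ y c ℕ.* (A ℕ.* W)) * (rest x α ^ W * rest x β ^ W)
      cross = begin
        z ^ (x c ℕ.* (A ℕ.* W) ℕ.+ y c ℕ.* (B ℕ.* W)) * (rest x α ^ W * rest x β ^ W)
          ≈⟨ *-congʳ (^-homo-* z (x c ℕ.* (A ℕ.* W)) (y c ℕ.* (B ℕ.* W))) ⟩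
        z ^ (x c ℕ.* (A ℕ.* W)) * z ^ (y c ℕ.* (B ℕ.* W)) * (rest x α ^ W * rest x β ^ W)
          ≈⟨ solve 4 (λ a b r s → a :* b :* (r :* s) := (a :* r) :* (b :* s)) refl _ _ _ _ ⟩
        z ^ (x c ℕ.* (A ℕ.* W)) * rest x α ^ W * (z ^ (y c ℕ.* (B ℕ.* W)) * rest x β ^ W)
          ≈⟨ *-cong hx′ (sym hy′) ⟩
        z ^ (x c ℕ.* (B ℕ.* W)) * rest x β ^ W * (z ^ (y c ℕ.* (A ℕ.* W)) * rest x α ^ W)
          ≈⟨ solve 4 (λ a b r s → (a :* s) :* (b :* r) := a :* b :* (r :* s)) refl _ _ _ _ ⟩
        z ^ (x c ℕ.* (B ℕ.* W)) * z ^ (y c ℕ.* (A ℕ.* W)) * (rest x α ^ W * rest x β ^ W)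
          ≈⟨ *-congʳ (^-homo-* z (x c ℕ.* (B ℕ.* W)) (y c ℕ.* (A ℕ.* W))) ⟨
        z ^ (x c ℕ.* (B ℕ.* W) ℕ.+ y c ℕ.* (A ℕ.* W)) * (rest x α ^ W * rest x β ^ W) ∎

      dist : ∀ {i j} → z ^ i ≈ z ^ j → P ℕ∣.∣ ℕ.∣ i - j ∣
      dist {i} {j} e with ℕ.≤-total i j
      ... | inj₁ i≤j = subst (P ℕ∣.∣_) (≡.sym (ℕ.m≤n⇒∣m-n∣≡n∸m i≤j)) (primitive-≡ z-prim i≤j e)
      ... | inj₂ j≤i = subst (P ℕ∣.∣_) (≡.sym (ℕ.m≤n⇒∣n-m∣≡n∸m j≤i)) (primitive-≡ z-prim j≤i (sym e))

      reorder : ∀ u w v → u ℕ.* (v ℕ.* w) ≡ u ℕ.* w ℕ.* v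
      reorder = ℕ-solve-∀

      scaled : ℕ.∣ x c ℕ.* (A ℕ.* W) ℕ.+ y c ℕ.* (B ℕ.* W) - x c ℕ.* (B ℕ.* W) ℕ.+ y c ℕ.* (A ℕ.* W) ∣
                ≡ ℕ.∣ x c - y c ∣ ℕ.* W ℕ.* ℕ.∣ A - B ∣
      scaled = ≡.trans (cross-difference (x c) (y c) (A ℕ.* W) (B ℕ.* W))
        (≡.trans (cong (ℕ.∣ x c - y c ∣ ℕ.*_) (≡.sym (ℕ.*-distribʳ-∣-∣ W A B))) (reorder ℕ.∣ x c - y c ∣ W ℕ.∣ A - B ∣))

-- Counting and summation

module _ {i} {A : Set i} where

  lookup-injective : ∀ {xs : List A} → AllPairs _≢_ xs → ∀ j k → List.lookup xs j ≡ List.lookup xs k → j ≡ k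
  lookup-injective (_ ∷ _)   Fin.zero    Fin.zero    e = ≡.refl
  lookup-injective (x≢ ∷ _)  Fin.zero    (Fin.suc k) e = contradiction e (All.lookup x≢ (∈-lookup k))
  lookup-injective (x≢ ∷ _)  (Fin.suc j) Fin.zero    e = contradiction (≡.sym e) (All.lookup x≢ (∈-lookup j))
  lookup-injective (_ ∷ xs!) (Fin.suc j) (Fin.suc k) e = cong Fin.suc (lookup-injective xs! j k e)

  length-≤ : ∀ {xs : List A} {m} → AllPairs _≢_ xs → (f : ∀ {x} → x ∈ xs → Fin m) →
             (∀ {x y} (x∈ : x ∈ xs) (y∈ : y ∈ xs) → f x∈ ≡ f y∈ → x ≡ y) → length xs ℕ.≤ m
  length-≤ xs! f f-injective = Fin.injective⇒≤ {f = λ j → f (∈-lookup j)}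
    λ {j} {k} e → lookup-injective xs! j k (f-injective (∈-lookup j) (∈-lookup k) e)

funToFin-cong : ∀ {m n} {f g : Fin m → Fin n} → (∀ i → f i ≡ g i) → funToFin f ≡ funToFin g
funToFin-cong {zero}  e = ≡.refl
funToFin-cong {suc m} e = cong₂ combine (e Fin.zero) (funToFin-cong (λ i → e (Fin.suc i)))

finToFun-injective : ∀ {m n} (j k : Fin (n ℕ.^ m)) → (∀ i → finToFun {n} {m} j i ≡ finToFun k i) → j ≡ k
finToFun-injective {m} {n} j k e = ≡.trans (≡.sym (Fin.funToFin-finToFin {m} {n} j))
  (≡.trans (funToFin-cong e) (Fin.funToFin-finToFin {m} {n} k))

funToFin-injective : ∀ {m n} (f g : Fin m → Fin n) → funToFin f ≡ funToFin g → ∀ i → f i ≡ g i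
funToFin-injective f g e i = ≡.trans (≡.sym (Fin.finToFun-funToFin f i)) (≡.trans (cong (λ k → finToFun k i) e) (Fin.finToFun-funToFin g i))

⟪⟫-suc-* : ∀ m q → ⟪ suc m ⟫ ℚ.* q ≡ q ℚ.+ ⟪ m ⟫ ℚ.* q
⟪⟫-suc-* m q = ≡.trans (cong (ℚ._* q) (⟪⟫-suc m)) (≡.trans (ℚ.*-distribʳ-+ q 1ℚ ⟪ m ⟫) (cong (ℚ._+ ⟪ m ⟫ ℚ.* q) (ℚ.*-identityˡ q)))

sumℚ : List ℚ → ℚ
sumℚ = foldr ℚ._+_ 0ℚ

module _ {i b} {A : Set i} {Bad : Pred A b} (bad? : Decidable Bad) (f : A → ℚ) (μ C : ℚ)
  (good : ∀ x → ¬ Bad x → f x ≡ μ) (bounded : ∀ x → ℚ.∣ f x ℚ.- μ ∣ ℚ.≤ C) where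

  private
    split : ∀ y S m → y ℚ.+ S ℚ.- ⟪ suc m ⟫ ℚ.* μ ≡ (y ℚ.- μ) ℚ.+ (S ℚ.- ⟪ m ⟫ ℚ.* μ)
    split y S m = begin
      y ℚ.+ S ℚ.- ⟪ suc m ⟫ ℚ.* μ                    ≡⟨ cong (λ q → y ℚ.+ S ℚ.- q) (⟪⟫-suc-* m μ) ⟩
      y ℚ.+ S ℚ.- (μ ℚ.+ ⟪ m ⟫ ℚ.* μ)                ≡⟨ cong (λ q → y ℚ.+ S ℚ.+ q) (ℚ.neg-distrib-+ μ (⟪ m ⟫ ℚ.* μ)) ⟩
      y ℚ.+ S ℚ.+ (ℚ.- μ ℚ.+ ℚ.- (⟪ m ⟫ ℚ.* μ))      ≡⟨ interchange y S (ℚ.- μ) (ℚ.- (⟪ m ⟫ ℚ.* μ)) ⟩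
      (y ℚ.- μ) ℚ.+ (S ℚ.- ⟪ m ⟫ ℚ.* μ)              ∎
      where open ≡.≡-Reasoning

  sum-deviation : ∀ xs → ℚ.∣ sumℚ (map f xs) ℚ.- ⟪ length xs ⟫ ℚ.* μ ∣ ℚ.≤ ⟪ length (List.filter bad? xs) ⟫ ℚ.* C
  sum-deviation [] = ℚ.≤-reflexive (≡.trans
    (cong (λ q → ℚ.∣ 0ℚ ℚ.- q ∣) (≡.trans (cong (ℚ._* μ) ⟪0⟫) (ℚ.*-zeroˡ μ)))
    (≡.sym (≡.trans (cong (ℚ._* C) ⟪0⟫) (ℚ.*-zeroˡ C))))
  sum-deviation (x ∷ xs) with bad? x
  ... | yes _ = begin
      ℚ.∣ f x ℚ.+ S ℚ.- ⟪ suc (length xs) ⟫ ℚ.* μ ∣           ≡⟨ cong ℚ.∣_∣ (split (f x) S (length xs)) ⟩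
      ℚ.∣ (f x ℚ.- μ) ℚ.+ (S ℚ.- ⟪ length xs ⟫ ℚ.* μ) ∣       ≤⟨ ℚ.∣p+q∣≤∣p∣+∣q∣ (f x ℚ.- μ) _ ⟩
      ℚ.∣ f x ℚ.- μ ∣ ℚ.+ ℚ.∣ S ℚ.- ⟪ length xs ⟫ ℚ.* μ ∣     ≤⟨ ℚ.+-mono-≤ (bounded x) (sum-deviation xs) ⟩
      C ℚ.+ ⟪ length (List.filter bad? xs) ⟫ ℚ.* C             ≡⟨ ⟪⟫-suc-* (length (List.filter bad? xs)) C ⟨
      ⟪ suc (length (List.filter bad? xs)) ⟫ ℚ.* C             ∎
    where
    open ℚ.≤-Reasoning
    S = sumℚ (map f xs)
  ... | no ¬bad = begin
      ℚ.∣ f x ℚ.+ S ℚ.- ⟪ suc (length xs) ⟫ ℚ.* μ ∣           ≡⟨ cong ℚ.∣_∣ (split (f x) S (length xs)) ⟩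
      ℚ.∣ (f x ℚ.- μ) ℚ.+ (S ℚ.- ⟪ length xs ⟫ ℚ.* μ) ∣       ≡⟨ cong (λ y → ℚ.∣ (y ℚ.- μ) ℚ.+ (S ℚ.- ⟪ length xs ⟫ ℚ.* μ) ∣) (good x ¬bad) ⟩
      ℚ.∣ (μ ℚ.- μ) ℚ.+ (S ℚ.- ⟪ length xs ⟫ ℚ.* μ) ∣         ≡⟨ cong ℚ.∣_∣ (≡.trans (cong (ℚ._+ (S ℚ.- ⟪ length xs ⟫ ℚ.* μ)) (ℚ.+-inverseʳ μ)) (ℚ.+-identityˡ _)) ⟩
      ℚ.∣ S ℚ.- ⟪ length xs ⟫ ℚ.* μ ∣                         ≤⟨ sum-deviation xs ⟩
      ⟪ length (List.filter bad? xs) ⟫ ℚ.* C                   ∎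
    where
    open ℚ.≤-Reasoning
    S = sumℚ (map f xs)

-- The power of ℓ in the content of a formal sum

module Content {ℓ : ℕ} (ℓ-prime : Prime ℓ) {x} {X : Set x} where

  private instance
    ℓ≢0 : NonZero ℓ
    ℓ≢0 = prime⇒nonZero ℓ-prime

  scale : ℕ → ℤ × X → ℤ × X
  scale c (b , a) = + c ℤ.* b , a

  divide : ∀ F → All (λ t → ℓ ℕ∣.∣ ℤ.∣ proj₁ t ∣) F → ∃[ G ] F ≡ map (scale ℓ) G
  divide [] [] = [] , ≡.refl
  divide ((b , a) ∷ F) (ℓ∣b ∷ h) with ℤ∣.∣ᵤ⇒∣ {+ ℓ} {b} ℓ∣b | divide F h
  ... | ℤ∣.divides q e | G , e′ = (q , a) ∷ G , cong₂ _∷_ (cong (_, a) (≡.trans e (ℤ.*-comm q (+ ℓ)))) e′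

  map-scale-1 : ∀ F → F ≡ map (scale 1) F
  map-scale-1 [] = ≡.refl
  map-scale-1 ((b , a) ∷ F) = cong₂ _∷_ (cong (_, a) (≡.sym (ℤ.*-identityˡ b))) (map-scale-1 F)

  map-scale-* : ∀ c d F → map (scale c) (map (scale d) F) ≡ map (scale (c ℕ.* d)) F
  map-scale-* c d [] = ≡.refl
  map-scale-* c d ((b , a) ∷ F) = cong₂ _∷_
    (cong (_, a) (≡.trans (≡.sym (ℤ.*-assoc (+ c) (+ d) b)) (cong (ℤ._* b) (≡.sym (ℤ.pos-* c d))))) (map-scale-* c d F)

  -- Divide by ℓ as long as all coefficients permit it. One non-zero coefficient is followed through
  -- the divisions, and its shrinking absolute value bounds their number.
  content : ∀ F {t} → t ∈ F → proj₁ t ≢ ℤ.0ℤ →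
            ∃[ m ] ∃[ G ] F ≡ map (scale (ℓ ℕ.^ m)) G × (∃[ t ] (t ∈ G × ¬ (ℓ ℕ∣.∣ ℤ.∣ proj₁ t ∣)))
  content F {t} t∈F t≢0 = go ℤ.∣ proj₁ t ∣ F t∈F t≢0 ℕ.≤-refl
    where
    go : ∀ fuel F {t} → t ∈ F → proj₁ t ≢ ℤ.0ℤ → ℤ.∣ proj₁ t ∣ ℕ.≤ fuel →
         ∃[ m ] ∃[ G ] F ≡ map (scale (ℓ ℕ.^ m)) G × (∃[ t ] (t ∈ G × ¬ (ℓ ℕ∣.∣ ℤ.∣ proj₁ t ∣)))
    go zero       F t∈F t≢0 t≤ = contradiction (ℤ.∣i∣≡0⇒i≡0 (ℕ.n≤0⇒n≡0 t≤)) t≢0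
    go (suc fuel) F t∈F t≢0 t≤ with All.all? (λ t → ℓ ℕ∣.∣? ℤ.∣ proj₁ t ∣) F
    ... | no ¬all =
      let t , t∈ , h = find (All.¬All⇒Any¬ (λ t → ℓ ℕ∣.∣? ℤ.∣ proj₁ t ∣) F ¬all)
      in 0 , F , map-scale-1 F , t , t∈ , h
    ... | yes all with divide F all
    ...   | G , ≡.refl with ∈-map⁻ (scale ℓ) t∈F
    ...     | (b , a) , t∈G , ≡.refl =
      let m , H , e , h = go fuel G t∈G b≢0 (ℕ.≤-pred (ℕ.<-≤-trans smaller t≤))
      in suc m , H , ≡.trans (cong (map (scale ℓ)) e) (map-scale-* ℓ (ℓ ℕ.^ m) H) , h
      where
      b≢0 : b ≢ ℤ.0ℤ
      b≢0 ≡.refl = t≢0 (ℤ.*-zeroʳ (+ ℓ))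

      instance
        ∣b∣≢0 : NonZero ℤ.∣ b ∣
        ∣b∣≢0 = ℕ.≢-nonZero (λ e → b≢0 (ℤ.∣i∣≡0⇒i≡0 e))

      smaller : ℤ.∣ b ∣ ℕ.< ℤ.∣ + ℓ ℤ.* b ∣
      smaller = subst (ℤ.∣ b ∣ ℕ.<_) (≡.trans (ℕ.*-comm ℤ.∣ b ∣ ℓ) (≡.sym (ℤ.abs-* (+ ℓ) b))) (ℕ.m<m*n ℤ.∣ b ∣ ℓ (1<prime ℓ-prime))

-- The asymptotic formula

module Assembly {a r s : Level} (em : ExcludedMiddle (a ⊔ r ⊔ s))
  (p ℓ : ℕ) (p-prime : Prime p) (ℓ-prime : Prime ℓ) (p≢ℓ : p ≢ ℓ) (d′ : ℕ) (K : HeytingField a r s)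
  (closure : Closure.IsAlgebraicClosure ℓ ℓ-prime K)
  (v : Closure.Valuation ℓ ℓ-prime K closure) where

  open CommutativeRing (fieldRing K)
  open import Algebra.Properties.Semiring.Exp semiring using (_^_)
  open import Algebra.Properties.AbelianGroup ℚ.+-0-abelianGroup using (xyx⁻¹≈y)
  open import Algebra.Solver.Ring.NaturalCoefficients.Default commutativeSemiring using (solve; _:+_; _:=_)
  open FieldLemmas em K
  open Valued em ℓ ℓ-prime K closure v
  open Roots em K
  open RootSums em p ℓ p-prime ℓ-prime p≢ℓ K closure v
  open Residues p p-prime
  open Padic p p-prime using (_≈ᶻ_; seq)
  open Gamma p p-prime (suc d′)
  open Characters p ℓ p-prime ℓ-prime (suc d′) K closure v
  open Closure ℓ ℓ-prime K
  open Valuation v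
  open PowersNearOne p-prime ℓ p∤ℓ (1<prime ℓ-prime) using (n₀)
  open Content ℓ-prime {X = ∣Γ∣} using (scale)
  private module Γ = AbelianGroup Γ

  d : ℕ
  d = suc d′

  nonzero-coefficient : ∀ F → ¬ (F ≈Φ 0Φ) → ∃[ t ] (t ∈ F × coefficient t ≢ ℤ.0ℤ)
  nonzero-coefficient F F≉0 = go (Any.any? (λ t → ¬? (coefficient t ℤ.≟ ℤ.0ℤ)) F)
    where
    zero-coefficients : ∀ F → ¬ Any (λ t → coefficient t ≢ ℤ.0ℤ) F → F ≈Φ 0Φ
    zero-coefficients []            none = ≈-refl
    zero-coefficients ((b , a) ∷ F) none =
      ≈-trans (≡.subst (λ c → ((b , a) ∷ F) ≈Φ ((c , a) ∷ F)) b≡0 ≈-refl)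
        (≈-trans ≈-zero (zero-coefficients F (λ h → none (there h))))
      where
      b≡0 : b ≡ ℤ.0ℤ
      b≡0 = decidable-stable (b ℤ.≟ ℤ.0ℤ) (λ h → none (here h))

    go : Dec (Any (λ t → coefficient t ≢ ℤ.0ℤ) F) → ∃[ t ] (t ∈ F × coefficient t ≢ ℤ.0ℤ)
    go (yes h) = find h
    go (no ¬h) = contradiction (zero-coefficients F ¬h) F≉0

  bring-to-front : ∀ {t} G → DistinctExponents G → t ∈ G →
    ∃[ rest ] (All (λ u → ¬ (exponent u ≈Γ exponent t)) rest × (∀ n ω → eval n ω G ≈ eval n ω (t ∷ rest)))
  bring-to-front (u ∷ G) (u≉ ∷ G!) (here ≡.refl) = G , All.map (λ h e → h (λ i → Γ.sym e i)) u≉ , λ n ω → refl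
  bring-to-front (u ∷ G) (u≉ ∷ G!) (there t∈G) =
    let rest , distinct , e = bring-to-front G G! t∈G in
    u ∷ rest , All.lookup u≉ t∈G ∷ distinct , λ n ω → trans (+-congˡ (e n ω))
      (solve 3 (λ x y z → x :+ (y :+ z) := y :+ (x :+ z)) refl _ _ _)

  eval-scale : ∀ c n ω G → eval n ω (map (scale c) G) ≈ nat c * eval n ω G
  eval-scale c n ω []            = sym (zeroʳ _)
  eval-scale c n ω ((b , a) ∷ G) = trans (+-cong (trans (*-congʳ (int-* (+ c) b)) (*-assoc _ _ _)) (eval-scale c n ω G)) (sym (distribˡ _ _ _))

  nat-ℓ^≉0 : ∀ m → nat (ℓ ℕ.^ m) ≉ 0#
  nat-ℓ^≉0 m = nat≉0 (ℓ ℕ.^ m) {{p^≢0 ℓ-prime m}}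

  ord-ℓ^ : ∀ m nz → ord (nat (ℓ ℕ.^ m)) nz ≡ ⟪ m ⟫
  ord-ℓ^ zero    nz = ≡.trans (ord-cong nz 1≉0 int-1) (≡.trans ord-1 (≡.sym ⟪0⟫))
  ord-ℓ^ (suc m) nz = ≡.trans (ord-cong nz (*-≉0 ℓ≉0 (nat-ℓ^≉0 m)) (trans (reflexive (cong int (ℤ.pos-* ℓ (ℓ ℕ.^ m)))) (int-* (+ ℓ) (+ (ℓ ℕ.^ m)))))
    (≡.trans (ord-* ℓ≉0 (nat-ℓ^≉0 m) _) (≡.trans (cong₂ ℚ._+_ (ord-ℓ ℓ≉0) (ord-ℓ^ m (nat-ℓ^≉0 m))) (≡.sym (⟪⟫-suc m))))

  ord-scaled : ∀ m {x y} (x≉0 : x ≉ 0#) (y≉0 : y ≉ 0#) → x ≈ nat (ℓ ℕ.^ m) * y → ord x x≉0 ≡ ⟪ m ⟫ ℚ.+ ord y y≉0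
  ord-scaled m x≉0 y≉0 e = ≡.trans (ord-cong x≉0 (*-≉0 (nat-ℓ^≉0 m) y≉0) e)
    (≡.trans (ord-* (nat-ℓ^≉0 m) y≉0 _) (cong (ℚ._+ ord _ y≉0) (ord-ℓ^ m (nat-ℓ^≉0 m))))

  module AtLevel (n : ℕ) where
    module E = Enumeration em p ℓ p-prime ℓ-prime d′ K closure v n
    open E using (P; character; monomial)

    private instance
      P≢0 : NonZero P
      P≢0 = p^≢0 p-prime n

    Index : Set
    Index = Fin (P ℕ.^ d)

    -- The digits of the index in base pⁿ; the i-th digit is the exponent, with respect to a fixed
    -- primitive root, of the value at `γ i`.
    coordinates : Index → Fin d → ℕ
    coordinates k i = toℕ (finToFun {P} {d} k i)

    χ : Index → Γ/ n ∨
    χ k = character (coordinates k)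

    χ-injective : ∀ {j k} → (∀ g → ⟦ χ j ⟧ g ≈ ⟦ χ k ⟧ g) → j ≡ k
    χ-injective {j} {k} e = finToFun-injective {d} {P} j k λ i → Fin.toℕ-injective
      (E.character-injective (λ i → Fin.toℕ<n (finToFun {P} {d} j i)) (λ i → Fin.toℕ<n (finToFun {P} {d} k i)) e i)

    χ-surjective : ∀ ω → ∃[ k ] (∀ g → ⟦ χ k ⟧ g ≈ ⟦ ω ⟧ g)
    χ-surjective ω = funToFin (E.exponents ω) , E.character-surjective ω _
      (λ i → cong toℕ (Fin.finToFun-funToFin (E.exponents ω) i))

    terms : Index → Φ → Terms
    terms k = map (λ (b , a) → b , monomial (coordinates k) a)

    eval-terms : ∀ k G → eval n (χ k) G ≈ total (terms k G)
    eval-terms k []            = refl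
    eval-terms k ((b , a) ∷ G) = +-cong (*-congˡ (E.evalMonomial-character (coordinates k) a)) (eval-terms k G)

    monomial-root : ∀ i k a → n ℕ.≤ i ℕ.+ n₀ → monomial (coordinates k) a ^ N i ≈ 1#
    monomial-root i k a n≤ = ^-∣ (ℕ∣.divides (p ℕ.^ (i ℕ.+ n₀ ℕ.∸ n)) (≡.trans (cong (p ℕ.^_) (≡.sym (ℕ.m∸n+n≡m n≤)))
      (ℕ.^-distribˡ-+-* p (i ℕ.+ n₀ ℕ.∸ n) n))) (E.monomial-root (coordinates k) a)

    terms-roots : ∀ i k G → n ℕ.≤ i ℕ.+ n₀ → All (λ t → proj₂ t ^ N i ≈ 1#) (terms k G)
    terms-roots i k []            n≤ = []
    terms-roots i k ((b , a) ∷ G) n≤ = monomial-root i k a n≤ ∷ terms-roots i k G n≤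

    n≤n+ : n ℕ.≤ n ℕ.+ n₀
    n≤n+ = ℕ.m≤m+n n n₀

    eval-integral : ∀ k G → 0ℚ ≼ eval n (χ k) G
    eval-integral k G = ≼-cong (sym (eval-terms k G)) (total-integral n (terms k G) (terms-roots n k G n≤n+))

    eval-gap : ∀ k G → ¬ (1ℚ ≼ eval n (χ k) G) → ∀ nz → ord (eval n (χ k) G) nz ≡ 0ℚ
    eval-gap k G ¬1≼ nz = ≡.trans (ord-cong nz nz′ (eval-terms k G))
      (total-gap n (terms k G) (terms-roots (suc n) k G (ℕ.m≤n⇒m≤1+n n≤n+)) (λ h → ¬1≼ (≼-cong (sym (eval-terms k G)) h)) nz′)
      where
      nz′ : total (terms k G) ≉ 0#
      nz′ e = nz (trans (eval-terms k G) e)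

    eval-bounded : ∀ k G nz → ord (eval n (χ k) G) nz ℚ.≤ ⟪ suc (Bounded.C (map proj₁ G)) ⟫
    eval-bounded k G nz = subst (ℚ._≤ ⟪ suc (Bounded.C (map proj₁ G)) ⟫) (ord-cong nz′ nz (sym (eval-terms k G)))
      (Bounded.ord-bounded (map proj₁ G) n (terms k G) (terms-roots n k G n≤n+)
        (subst (λ bs → bs ⊆ map proj₁ G) (coefficients G) ⊆-refl) nz′)
      where
      nz′ : total (terms k G) ≉ 0#
      nz′ e = nz (trans (eval-terms k G) e)

      coefficients : ∀ G → map proj₁ G ≡ map proj₁ (terms k G)
      coefficients []      = ≡.refl
      coefficients (_ ∷ G) = cong (_ ∷_) (coefficients G)

    Collision : Index → ∣Γ∣ → ∣Γ∣ → Set r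
    Collision k α β = monomial (coordinates k) α ^ W ≈ monomial (coordinates k) β ^ W

    eval-collision : ∀ k b₀ a₀ G → ¬ (ℓ ℕ∣.∣ ℤ.∣ b₀ ∣) → 1ℚ ≼ eval n (χ k) ((b₀ , a₀) ∷ G) →
                     Any (λ t → Collision k (proj₂ t) a₀) G
    eval-collision k b₀ a₀ G ℓ∤b₀ h = Any.map⁻ (coset-collision n b₀ (monomial (coordinates k) a₀) (terms k G)
      (monomial-root n k a₀ n≤n+) (terms-roots n k G n≤n+) ℓ∤b₀ (≼-cong (eval-terms k ((b₀ , a₀) ∷ G)) h))

    module Counting (m k′ : ℕ) (n≡ : n ≡ m ℕ.+ n₀ ℕ.+ k′) (c : Fin d) (α β : ∣Γ∣)
      {l : ℕ} (l≤k′ : l ℕ.≤ k′) (separated-c : ¬ (seq (α c) l ≅[ l ] seq (β c) l)) where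

      private
        D : ℕ
        D = p ℕ.^ m

        instance
          D≢0 : NonZero D
          D≢0 = p^≢0 p-prime m

        P≡ : P ≡ p ℕ.^ (n₀ ℕ.+ k′) ℕ.* D
        P≡ = ≡.trans (cong (p ℕ.^_) (≡.trans n≡ (≡.trans (ℕ.+-assoc m n₀ k′) (ℕ.+-comm m (n₀ ℕ.+ k′))))) (ℕ.^-distribˡ-+-* p (n₀ ℕ.+ k′) m)

        quotient<  : ∀ k → coordinates k c / D ℕ.< p ℕ.^ (n₀ ℕ.+ k′)
        quotient< k = m<n*o⇒m/o<n (subst (coordinates k c ℕ.<_) P≡ (Fin.toℕ<n (finToFun {P} {d} k c)))

        others : Index → Fin d′ → Fin P
        others k i = finToFun {P} {d} k (punchIn c i)

      -- The digits other than the c-th are kept. Of the c-th only the quotient by p^m is recorded,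
      -- since a collision determines the rest; it takes p^(n₀+k′) values, independently of n.
      code : Index → Fin (P ℕ.^ d′ ℕ.* p ℕ.^ (n₀ ℕ.+ k′))
      code k = combine (funToFin (others k)) (fromℕ< (quotient< k))

      -- By `collision`, pⁿ divides (x - y) W (A - B) for the c-th digits x and y. Here W = p^n₀ and
      -- p^k′ does not divide A - B, so with n = m + n₀ + k′ there remains x ≡ y modulo p^m, and
      -- equal quotients by p^m finish.
      code-injective : ∀ j k → Collision j α β → Collision k α β → code j ≡ code k → j ≡ k
      code-injective j k hj hk e = finToFun-injective {d} {P} j k λ i → Fin.toℕ-injective (same i)
        where
        split = Fin.combine-injective (funToFin (others j)) (fromℕ< (quotient< j)) (funToFin (others k)) (fromℕ< (quotient< k)) e

        agree : ∀ i → coordinates j (punchIn c i) ≡ coordinates k (punchIn c i)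
        agree i = cong toℕ (funToFin-injective (others j) (others k) (proj₁ split) i)

        divides : p ℕ.^ m ℕ∣.∣ ℕ.∣ coordinates j c - coordinates k c ∣
        divides = ℕ∣.*-cancelʳ-∣ W {{p^≢0 p-prime n₀}} (subst (ℕ∣._∣ ℕ.∣ coordinates j c - coordinates k c ∣ ℕ.* W) (ℕ.^-distribˡ-+-* p m n₀)
          (p^∣-cancel p-prime (m ℕ.+ n₀) k′ _ _
            (residues-separated {α c} {β c} n (subst (k′ ℕ.≤_) (≡.sym n≡) (ℕ.m≤n+m k′ (m ℕ.+ n₀))) l≤k′ separated-c)
            (subst (λ q → p ℕ.^ q ℕ∣.∣ ℕ.∣ coordinates j c - coordinates k c ∣ ℕ.* W ℕ.* ℕ.∣ residue n (α c) - residue n (β c) ∣) n≡ (E.collision (coordinates j) (coordinates k) c agree α β W hj hk))))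

        same-c : coordinates j c ≡ coordinates k c
        same-c = quotient-≡ divides (Fin.fromℕ<-injective _ _ (quotient< j) (quotient< k) (proj₂ split))

        same : ∀ i → coordinates j i ≡ coordinates k i
        same i = go (c Fin.≟ i)
          where
          go : Dec (c ≡ i) → coordinates j i ≡ coordinates k i
          go (yes ≡.refl) = same-c
          go (no c≢i)     = subst (λ i → coordinates j i ≡ coordinates k i) (Fin.punchIn-punchOut c≢i) (agree (Fin.punchOut c≢i))

  eval-cong : ∀ n (ω χ : Γ/ n ∨) → (∀ g → ⟦ ω ⟧ g ≈ ⟦ χ ⟧ g) → ∀ F → eval n ω F ≈ eval n χ F
  eval-cong n ω χ e []            = refl
  eval-cong n ω χ e ((b , α) ∷ F) = +-cong (*-congˡ (product-cong λ i →
      ^-congˡ (residue n (α i)) (e (γ i)))) (eval-cong n ω χ e F)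
    where
    open import Algebra.Properties.Semiring.Exp semiring using (^-congˡ)
    open import Algebra.Properties.CommutativeMonoid.Sum *-commutativeMonoid using () renaming (sum-cong-≋ to product-cong)

  -- Summation over the support

  module Support (n : ℕ) (F : Φ) where
    open AtLevel n
    open Setoid (Supp n F) using () renaming (Carrier to Supported; _≈_ to _≈ˢ_)

    -- The default 0 outside the support lets the sum run over all characters, whose number is
    -- exactly p^(nd).
    contribution : ∀ ω → Dec (eval n ω F ≈ 0#) → ℚ
    contribution ω (yes _) = 0ℚ
    contribution ω (no nz) = ord (eval n ω F) nz

    consSupported : ∀ ω → Dec (eval n ω F ≈ 0#) → List Supported → List Supported
    consSupported ω (yes _) xs = xs
    consSupported ω (no nz) xs = (ω , nz) ∷ xs

    isZero? : ∀ k → Dec (eval n (χ k) F ≈ 0#)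
    isZero? k = eval n (χ k) F ≈? 0#

    supported : List Index → List Supported
    supported []       = []
    supported (k ∷ ks) = consSupported (χ k) (isZero? k) (supported ks)

    sum-supported : ∀ ks → sumℚ (map (ordSupp n F) (supported ks)) ≡ sumℚ (map (λ k → contribution (χ k) (isZero? k)) ks)
    sum-supported []       = ≡.refl
    sum-supported (k ∷ ks) = go (isZero? k)
      where
      go : ∀ z → sumℚ (map (ordSupp n F) (consSupported (χ k) z (supported ks)))
                 ≡ contribution (χ k) z ℚ.+ sumℚ (map (λ k → contribution (χ k) (isZero? k)) ks)
      go (yes _) = ≡.trans (sum-supported ks) (≡.sym (ℚ.+-identityˡ _))
      go (no nz) = cong (λ q → ord (eval n (χ k) F) nz ℚ.+ q) (sum-supported ks)

    supported-complete : ∀ (x : Supported) {k} ks → k ∈ ks → (∀ g → ⟦ χ k ⟧ g ≈ ⟦ proj₁ x ⟧ g) → Any (x ≈ˢ_) (supported ks)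
    supported-complete x {k} (_ ∷ ks) (here ≡.refl) e = go (isZero? k)
      where
      go : ∀ z → Any (x ≈ˢ_) (consSupported (χ k) z (supported ks))
      go (yes z) = contradiction (trans (sym (eval-cong n (χ k) (proj₁ x) e F)) z) (proj₂ x)
      go (no nz) = here (λ g → sym (e g))
    supported-complete x {k} (j ∷ ks) (there k∈ks) e = go (isZero? j)
      where
      go : ∀ z → Any (x ≈ˢ_) (consSupported (χ j) z (supported ks))
      go (yes _) = supported-complete x ks k∈ks e
      go (no _)  = there (supported-complete x ks k∈ks e)

    supported-unique : ∀ {ks} → AllPairs _≢_ ks → AllPairs (λ x y → ¬ (x ≈ˢ y)) (supported ks)
    supported-unique [] = []
    supported-unique {k ∷ ks} (k≢ ∷ ks!) = go (isZero? k)
      where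
      distinct : ∀ {ks} → All (k ≢_) ks → All (λ y → ¬ (∀ g → ⟦ χ k ⟧ g ≈ ⟦ proj₁ y ⟧ g)) (supported ks)
      distinct [] = []
      distinct {j ∷ js} (k≢j ∷ k≢) = go (isZero? j)
        where
        go : ∀ z → All (λ y → ¬ (∀ g → ⟦ χ k ⟧ g ≈ ⟦ proj₁ y ⟧ g)) (consSupported (χ j) z (supported js))
        go (yes _) = distinct k≢
        go (no _)  = (λ e → k≢j (χ-injective {k} {j} e)) ∷ distinct k≢

      go : ∀ z → AllPairs (λ x y → ¬ (x ≈ˢ y)) (consSupported (χ k) z (supported ks))
      go (yes _) = supported-unique ks!
      go (no _)  = distinct k≢ ∷ supported-unique ks!

    hasSum : HasSum (Supp n F) (ordSupp n F) (sumℚ (map (ordSupp n F) (supported (allFin _))))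
    hasSum = supported (allFin _) , supported-unique (Unique.allFin⁺ _)
           , (λ x → let k , e = χ-surjective (proj₁ x) in supported-complete x (allFin _) (∈-allFin k) e)
           , ≡.refl

  module _ (μ : ℕ) (G : Φ) {t₀ : Term} (t₀∈G : t₀ ∈ G) (ℓ∤b₀ : ¬ (ℓ ℕ∣.∣ ℤ.∣ coefficient t₀ ∣))
    (G! : DistinctExponents G) where

    private
      F : Φ
      F = map (scale (ℓ ℕ.^ μ)) G

      b₀ = coefficient t₀
      a₀ = exponent t₀
      rest = proj₁ (bring-to-front G G! t₀∈G)

      rest-distinct : All (λ u → ¬ (exponent u ≈Γ a₀)) rest
      rest-distinct = proj₁ (proj₂ (bring-to-front G G! t₀∈G))

      front : ∀ n ω → eval n ω G ≈ eval n ω (t₀ ∷ rest)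
      front = proj₂ (proj₂ (bring-to-front G G! t₀∈G))

    isMu : IsMu F ⟪ μ ⟫
    isMu = record
      { attained = scale (ℓ ℕ.^ μ) t₀ , scaled≉0 , ∈-map⁺ (scale (ℓ ℕ.^ μ)) t₀∈G
                 , ≡.trans (ord-scaled μ scaled≉0 b₀≉0 (int-* (+ (ℓ ℕ.^ μ)) b₀))
                     (≡.trans (cong (λ q → ⟪ μ ⟫ ℚ.+ q) (ord-ℓ-unit b₀ ℓ∤b₀ b₀≉0)) (ℚ.+-identityʳ _))
      ; lowerBound = λ t b≉0 t∈F → μ≤ord b≉0 (∈-map⁻ (scale (ℓ ℕ.^ μ)) t∈F)
      }
      where
      b₀≉0 : int b₀ ≉ 0#
      b₀≉0 = int≉0 λ e → ℓ∤b₀ (subst (λ b → ℓ ℕ∣.∣ ℤ.∣ b ∣) (≡.sym e) (ℓ ℕ∣.∣0))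

      scaled≉0 : int (+ (ℓ ℕ.^ μ) ℤ.* b₀) ≉ 0#
      scaled≉0 e = *-≉0 (nat-ℓ^≉0 μ) b₀≉0 (trans (sym (int-* (+ (ℓ ℕ.^ μ)) b₀)) e)

      μ≤ord : ∀ {t} (b≉0 : int (coefficient t) ≉ 0#) → ∃[ u ] (u ∈ G × t ≡ scale (ℓ ℕ.^ μ) u) →
              ⟪ μ ⟫ ℚ.≤ ord (int (coefficient t)) b≉0
      μ≤ord b≉0 ((b , a) , _ , ≡.refl) = subst₂ ℚ._≤_ (ℚ.+-identityʳ ⟪ μ ⟫)
        (≡.sym (ord-scaled μ b≉0 nz (int-* (+ (ℓ ℕ.^ μ)) b))) (ℚ.+-monoʳ-≤ ⟪ μ ⟫ (≼-int b nz))
        where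
        nz : int b ≉ 0#
        nz e = b≉0 (trans (int-* (+ (ℓ ℕ.^ μ)) b) (trans (*-congˡ e) (zeroʳ _)))

    private
      B : ℕ
      B = suc (Bounded.C (map proj₁ G))

      -- Two distinct exponent vectors differ in some coordinate, and there already at a finite
      -- level. Both choices precede n, so their maximum `k′` may enter the implied constant.
      separation : ∀ j → ∃[ c ] ∃[ l ] ¬ (seq (exponent (List.lookup rest j) c) l ≅[ l ] seq (a₀ c) l)
      separation j =
        let α = exponent (List.lookup rest j)
            c , h = Fin.¬∀⟶∃¬ d (λ c → α c ≈ᶻ a₀ c) (λ c → dec em) (All.lookup rest-distinct (∈-lookup j))
        in c , separated (α c) (a₀ c) h (dec em)

      k′ : ℕ
      k′ = maximum (λ j → proj₁ (proj₂ (separation j)))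

    module _ (n : ℕ) where
      open AtLevel n
      open Support n F

      -- Characters with ω(G) = 0 are included, since `≼` holds vacuously at 0.
      Bad : Index → Set r
      Bad k = 1ℚ ≼ eval n (χ k) G

      bad? : Decidable Bad
      bad? k = dec em

      private
        eval-F : ∀ k → eval n (χ k) F ≈ nat (ℓ ℕ.^ μ) * eval n (χ k) G
        eval-F k = eval-scale (ℓ ℕ.^ μ) n (χ k) G

        G≉0 : ∀ {k} → eval n (χ k) F ≉ 0# → eval n (χ k) G ≉ 0#
        G≉0 {k} nz e = nz (trans (eval-F k) (trans (*-congˡ e) (zeroʳ _)))

        ord-F : ∀ k nz → ord (eval n (χ k) F) nz ≡ ⟪ μ ⟫ ℚ.+ ord (eval n (χ k) G) (G≉0 nz)
        ord-F k nz = ord-scaled μ nz (G≉0 nz) (eval-F k)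

        value : Index → ℚ
        value k = contribution (χ k) (isZero? k)

      value-good : ∀ k → ¬ Bad k → value k ≡ ⟪ μ ⟫
      value-good k ¬bad = go (isZero? k)
        where
        go : ∀ z → contribution (χ k) z ≡ ⟪ μ ⟫
        go (yes z) = contradiction (trans (sym (eval-F k)) z) (*-≉0 (nat-ℓ^≉0 μ) (λ e → ¬bad (≼-0 e)))
        go (no nz) = ≡.trans (ord-F k nz) (≡.trans (cong (λ q → ⟪ μ ⟫ ℚ.+ q) (eval-gap k G ¬bad (G≉0 nz))) (ℚ.+-identityʳ _))

      -- Outside the support the deviation is μ; inside it is ord ω(G), which lies between 0 and B.
      -- The sum μ + B covers both cases.
      value-bounded : ∀ k → ℚ.∣ value k ℚ.- ⟪ μ ⟫ ∣ ℚ.≤ ⟪ μ ℕ.+ B ⟫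
      value-bounded k = go (isZero? k)
        where
        go : ∀ z → ℚ.∣ contribution (χ k) z ℚ.- ⟪ μ ⟫ ∣ ℚ.≤ ⟪ μ ℕ.+ B ⟫
        go (yes _) = subst (ℚ._≤ ⟪ μ ℕ.+ B ⟫) (≡.sym (≡.trans (cong ℚ.∣_∣ (ℚ.+-identityˡ (ℚ.- ⟪ μ ⟫)))
          (≡.trans (ℚ.∣-p∣≡∣p∣ ⟪ μ ⟫) (ℚ.0≤p⇒∣p∣≡p (0≤⟪⟫ μ))))) (⟪⟫-mono (ℕ.m≤m+n μ B))
        go (no nz) = subst (ℚ._≤ ⟪ μ ℕ.+ B ⟫) (≡.sym (≡.trans (cong ℚ.∣_∣ difference)
            (ℚ.0≤p⇒∣p∣≡p (eval-integral k G (G≉0 nz)))))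
          (ℚ.≤-trans (eval-bounded k G (G≉0 nz)) (⟪⟫-mono (ℕ.m≤n+m B μ)))
          where
          difference : ord (eval n (χ k) F) nz ℚ.- ⟪ μ ⟫ ≡ ord (eval n (χ k) G) (G≉0 nz)
          difference = ≡.trans (cong (ℚ._- ⟪ μ ⟫) (ord-F k nz)) (xyx⁻¹≈y ⟪ μ ⟫ _)

      bad-collision : ∀ {k} → Bad k → Any (λ t → Collision k (exponent t) a₀) rest
      bad-collision {k} bad = eval-collision k b₀ a₀ rest ℓ∤b₀ (≼-cong (front n (χ k)) bad)

      -- A bad character is encoded by the position in `rest` of an exponent that collides with a₀,
      -- together with the code belonging to that pair of exponents.
      bad-count : ∀ m → n ≡ m ℕ.+ n₀ ℕ.+ k′ →
                  length (List.filter bad? (allFin _)) ℕ.≤ length rest ℕ.* ((p ℕ.^ n) ℕ.^ d′ ℕ.* p ℕ.^ (n₀ ℕ.+ k′))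
      bad-count m n≡ = length-≤ (Unique.filter⁺ bad? (Unique.allFin⁺ _))
        (λ k∈ → combine (index k∈) (code (index k∈) _))
        λ {j} {k} j∈ k∈ e → let e₁ , e₂ = Fin.combine-injective (index j∈) (code (index j∈) j) (index k∈) (code (index k∈) k) e in
          same (index j∈) (index k∈) e₁ (collides j∈) (collides k∈) e₂
        where
        module C i = Counting m k′ n≡ (proj₁ (separation i)) (exponent (List.lookup rest i)) a₀
          (≤-maximum (λ j → proj₁ (proj₂ (separation j))) i) (proj₂ (proj₂ (separation i)))
        open C using (code; code-injective)

        collision-of : ∀ {k} → k ∈ List.filter bad? (allFin _) → Any (λ t → Collision k (exponent t) a₀) rest
        collision-of k∈ = bad-collision (proj₂ (∈-filter⁻ bad? {xs = allFin _} k∈))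

        index : ∀ {k} → k ∈ List.filter bad? (allFin _) → Fin (length rest)
        index k∈ = Any.index (collision-of k∈)

        collides : ∀ {k} (k∈ : k ∈ List.filter bad? (allFin _)) → Collision k (exponent (List.lookup rest (index k∈))) a₀
        collides k∈ = Any.lookup-index (collision-of k∈)

        same : ∀ {j k} i i′ → i ≡ i′ → Collision j (exponent (List.lookup rest i)) a₀ →
               Collision k (exponent (List.lookup rest i′)) a₀ → code i j ≡ code i′ k → j ≡ k
        same {j} {k} i .i ≡.refl hj hk e = code-injective i j k hj hk e

      sum : ℚ
      sum = sumℚ (map (ordSupp n F) (supported (allFin _)))

      sum-estimate : n₀ ℕ.+ k′ ℕ.≤ n → ℚ.∣ sum ℚ.- ℕ→ℚ (p ℕ.^ (n ℕ.* d)) ℚ.* ⟪ μ ⟫ ∣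
                     ℚ.≤ ⟪ length rest ℕ.* p ℕ.^ (n₀ ℕ.+ k′) ⟫ ℚ.* ⟪ μ ℕ.+ B ⟫ ℚ.* ℕ→ℚ (p ℕ.^ (d′ ℕ.* n))
      sum-estimate e≤n = begin
          ℚ.∣ sum ℚ.- ℕ→ℚ (p ℕ.^ (n ℕ.* d)) ℚ.* ⟪ μ ⟫ ∣
            ≡⟨ cong₂ (λ s q → ℚ.∣ s ℚ.- q ℚ.* ⟪ μ ⟫ ∣) (sum-supported (allFin _)) total-count ⟩
          ℚ.∣ sumℚ (map value (allFin _)) ℚ.- ⟪ length (allFin ((p ℕ.^ n) ℕ.^ d)) ⟫ ℚ.* ⟪ μ ⟫ ∣
            ≤⟨ sum-deviation bad? value ⟪ μ ⟫ ⟪ μ ℕ.+ B ⟫ value-good value-bounded (allFin _) ⟩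
          ⟪ length (List.filter bad? (allFin _)) ⟫ ℚ.* ⟪ μ ℕ.+ B ⟫
            ≤⟨ ℚ.*-monoʳ-≤-nonNeg ⟪ μ ℕ.+ B ⟫ bad-count′ ⟩
          ⟪ length rest ℕ.* p ℕ.^ (n₀ ℕ.+ k′) ⟫ ℚ.* ⟪ p ℕ.^ (d′ ℕ.* n) ⟫ ℚ.* ⟪ μ ℕ.+ B ⟫
            ≡⟨ alg ⟪ length rest ℕ.* p ℕ.^ (n₀ ℕ.+ k′) ⟫ ⟪ p ℕ.^ (d′ ℕ.* n) ⟫ ⟪ μ ℕ.+ B ⟫ ⟩
          ⟪ length rest ℕ.* p ℕ.^ (n₀ ℕ.+ k′) ⟫ ℚ.* ⟪ μ ℕ.+ B ⟫ ℚ.* ⟪ p ℕ.^ (d′ ℕ.* n) ⟫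
            ≡⟨ cong (⟪ length rest ℕ.* p ℕ.^ (n₀ ℕ.+ k′) ⟫ ℚ.* ⟪ μ ℕ.+ B ⟫ ℚ.*_) (⟪⟫≡ℕ→ℚ (p ℕ.^ (d′ ℕ.* n))) ⟩
          ⟪ length rest ℕ.* p ℕ.^ (n₀ ℕ.+ k′) ⟫ ℚ.* ⟪ μ ℕ.+ B ⟫ ℚ.* ℕ→ℚ (p ℕ.^ (d′ ℕ.* n)) ∎
        where
        open ℚ.≤-Reasoning
        total-count : ℕ→ℚ (p ℕ.^ (n ℕ.* d)) ≡ ⟪ length (allFin ((p ℕ.^ n) ℕ.^ d)) ⟫
        total-count = ≡.trans (≡.sym (⟪⟫≡ℕ→ℚ _)) (cong ⟪_⟫ (≡.trans (≡.sym (ℕ.^-*-assoc p n d))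
          (≡.sym (List.length-tabulate {n = (p ℕ.^ n) ℕ.^ d} id))))

        -- The threshold n₀ + k′ ≤ n provides the m with n = m + n₀ + k′ for which the bad
        -- characters were counted.
        bad-count′ : ⟪ length (List.filter bad? (allFin _)) ⟫ ℚ.≤ ⟪ length rest ℕ.* p ℕ.^ (n₀ ℕ.+ k′) ⟫ ℚ.* ⟪ p ℕ.^ (d′ ℕ.* n) ⟫
        bad-count′ = ℚ.≤-trans (⟪⟫-mono (bad-count (n ℕ.∸ (n₀ ℕ.+ k′))
            (≡.trans (≡.sym (ℕ.m∸n+n≡m e≤n)) (≡.sym (ℕ.+-assoc (n ℕ.∸ (n₀ ℕ.+ k′)) n₀ k′)))))
          (ℚ.≤-reflexive (≡.trans (cong ⟪_⟫ (≡.trans (alg (length rest) ((p ℕ.^ n) ℕ.^ d′) (p ℕ.^ (n₀ ℕ.+ k′)))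
            (cong (length rest ℕ.* p ℕ.^ (n₀ ℕ.+ k′) ℕ.*_) (≡.trans (ℕ.^-*-assoc p n d′) (cong (p ℕ.^_) (ℕ.*-comm n d′))))))
            (⟪⟫-* (length rest ℕ.* p ℕ.^ (n₀ ℕ.+ k′)) (p ℕ.^ (d′ ℕ.* n)))))
          where
          alg : ∀ x y z → x ℕ.* (y ℕ.* z) ≡ x ℕ.* z ℕ.* y
          alg = ℕ-solve-∀

        instance
          B≥0 : ℚ.NonNegative ⟪ μ ℕ.+ B ⟫
          B≥0 = ℚ.nonNegative (0≤⟪⟫ (μ ℕ.+ B))

        alg : ∀ x y z → x ℚ.* y ℚ.* z ≡ x ℚ.* z ℚ.* y
        alg x y z = ≡.trans (ℚ.*-assoc x y z) (≡.trans (cong (x ℚ.*_) (ℚ.*-comm y z)) (≡.sym (ℚ.*-assoc x z y)))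

    asymptotics : Σ[ S ∈ (ℕ → ℚ) ]
      ((∀ n → HasSum (Supp n F) (ordSupp n F) (S n))
       × (λ n → S n ℚ.- ℕ→ℚ (p ℕ.^ (n ℕ.* d)) ℚ.* ⟪ μ ⟫) =O[ (λ n → p ℕ.^ (d′ ℕ.* n)) ])
    asymptotics = sum , (λ n → Support.hasSum n F) ,
      ⟪ length rest ℕ.* p ℕ.^ (n₀ ℕ.+ k′) ⟫ ℚ.* ⟪ μ ℕ.+ B ⟫ , n₀ ℕ.+ k′ , sum-estimate

open import Data.Nat using (_≤_; _∸_; _*_; _^_)
open import Data.Rational using () renaming (_*_ to _*ℚ_; _-_ to _-ℚ_)

corollary6p6 : {a r s : Level} → ExcludedMiddle (a ⊔ r ⊔ s) →
    (p ℓ : ℕ) (p-prime : Prime p) (ℓ-prime : Prime ℓ) → p ≢ ℓ →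
    (d : ℕ) → 1 ≤ d →
    (K : HeytingField a r s)
    (closure : Closure.IsAlgebraicClosure ℓ ℓ-prime K)
    (v : Closure.Valuation ℓ ℓ-prime K closure) →
    let open Gamma p p-prime d
        open Characters p ℓ p-prime ℓ-prime d K closure v in
    (F : Φ) → DistinctExponents F → ¬ (F ≈Φ 0Φ) →
    Σ[ μ ∈ ℚ ] Σ[ S ∈ (ℕ → ℚ) ]
      (IsMu F μ
       × (∀ n → HasSum (Supp n F) (ordSupp n F) (S n))
       × (λ n → S n -ℚ ℕ→ℚ (p ^ (n * d)) *ℚ μ) =O[ (λ n → p ^ ((d ∸ 1) * n)) ])
corollary6p6 em p ℓ p-prime ℓ-prime p≢ℓ (suc d′) _ K closure v F F! F≉0 =
  let _ , t∈F , t≢0 = nonzero-coefficient F F≉0 in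
  go F! (Content.content ℓ-prime F t∈F t≢0)
  where
  open Gamma p p-prime (suc d′)
  open Characters p ℓ p-prime ℓ-prime (suc d′) K closure v
  open Assembly em p ℓ p-prime ℓ-prime p≢ℓ d′ K closure v
  open Content ℓ-prime {X = ∣Γ∣} using (scale)

  go : ∀ {F} → DistinctExponents F →
       (∃[ m ] ∃[ G ] F ≡ map (scale (ℓ ^ m)) G × (∃[ t ] (t ∈ G × ¬ (ℓ ℕ∣.∣ ℤ.∣ proj₁ t ∣)))) →
       Σ[ μ ∈ ℚ ] Σ[ S ∈ (ℕ → ℚ) ]
         (IsMu F μ
          × (∀ n → HasSum (Supp n F) (ordSupp n F) (S n))
          × (λ n → S n -ℚ ℕ→ℚ (p ^ (n * suc d′)) *ℚ μ) =O[ (λ n → p ^ (d′ * n)) ])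
  go F! (m , G , ≡.refl , t , t∈G , ℓ∤t) =
    -- Scaling changes coefficients only, so the exponents of G are distinct as well.
    let G! = AllPairs.map⁻ F!
        S , hasSum , bound = asymptotics m G t∈G ℓ∤t G!
    in ⟪ m ⟫ , S , isMu m G t∈G ℓ∤t G! , hasSum , bound
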